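{- For every integer $n\geq 6$, \[ 2n-10n^{2/3}-7<f(n,4)\leq 2n-4. \] Consequently, \[ f(n,4)=2n-o(n)\qquad (n\to\infty). \] Equivalently (to the lower bound), for every $n\ge 6$, \[ \mu(n,\mathcal E_3)\geq \left\lfloor 2n-10n^{2/3}-7\right\rfloor . \]
   Context: All graphs are finite and simple (no loops or multiple edges). For a graph $G$ with vertex set $V(G)$ and edge set $E(G)$ and a permutation $\sigma$ of $V(G)$, $\sigma(G)$ denotes the graph with vertex set $V(G)$ and edge set $E(\sigma(G))=\{\sigma(u)\sigma(v):uv\in E(G)\}$. Put $I_G(\sigma):=|E(G)\cap E(\sigma(G))|$. For $k\ge 1$, \[ f(n,k):=\min\bigl\{|E(G)|:|V(G)|=n\text{ and } I_G(\sigma)\geq k\text{ for every permutation }\sigma\text{ of }V(G)\bigr\}. \] For a family of graphs $\mathcal F$, a permutation $\sigma$ of $V(G)$ is an $\mathcal F$-near-packing of $G$ if the graph formed by the common edges $E(G)\cap E(\sigma(G))$ belongs to $\mathcal F$. $\mu(n,\mathcal F)$ is the maximum integer $m$ such that every graph of order $n$ (number of vertices) and size (number of edges) at most $m$ has an $\mathcal F$-near-packing. For $r\ge 0$, $\mathcal E_r$ denotes the family of all graphs with at most $r$ edges; thus an $\mathcal E_3$-near-packing of $G$ is a permutation $\sigma$ of $V(G)$ with $I_G(\sigma)\le 3$. -}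

module Defs where

open import Data.Bool.Base using (Bool; true; false; _∧_)
open import Data.Fin.Base using (Fin)
import Data.Fin.Properties as Fin
open import Data.Fin.Permutation using (Permutation′; _⟨$⟩ˡ_)
open import Data.Integer.Base using (ℤ; +_; _+_)
import Data.Integer.Base as ℤ
open import Data.List.Base using (List; length; filterᵇ; cartesianProduct; allFin)
open import Data.Nat.Base using (ℕ)
import Data.Nat.Base as ℕ
open import Data.Product.Base using (_×_; _,_; Σ-syntax; ∃-syntax)
open import Data.Rational.Base using (ℚ; 0ℚ; _-_; _*_; ∣_∣; Positive)
import Data.Rational.Base as ℚ
open import Level using (0ℓ)
open import Relation.Binary.Core using (Rel)
open import Relation.Binary.PropositionalEquality.Core using (_≡_; cong; cong₂)
open import Relation.Nullary.Decidable.Core using (does)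
open import Relation.Nullary.Negation.Core using (¬_)
open import Relation.Unary using (Pred)

record Graph (n : ℕ) : Set where
  field
    adj    : Fin n → Fin n → Bool
    sym    : ∀ u v → adj u v ≡ adj v u
    irrefl : ∀ v → adj v v ≡ false

open Graph public

-- Each edge is listed once, as the pair of its ends in increasing order.
edges : ∀ {n} → Graph n → List (Fin n × Fin n)
edges {n} G =
  filterᵇ (λ (u , v) → does (u Fin.<? v) ∧ adj G u v)
          (cartesianProduct (allFin n) (allFin n))

size : ∀ {n} → Graph n → ℕ
size G = length (edges G)

-- xy is of the form σ(u)σ(v) with uv an edge iff σ⁻¹(x)σ⁻¹(y) is an edge;
-- _⟨$⟩ˡ_ applies the inverse.
image : ∀ {n} → Permutation′ n → Graph n → Graph n
image σ G .adj x y  = adj G (σ ⟨$⟩ˡ x) (σ ⟨$⟩ˡ y)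
image σ G .sym x y  = sym G (σ ⟨$⟩ˡ x) (σ ⟨$⟩ˡ y)
image σ G .irrefl x = irrefl G (σ ⟨$⟩ˡ x)

_∩_ : ∀ {n} → Graph n → Graph n → Graph n
(G ∩ H) .adj u v  = adj G u v ∧ adj H u v
(G ∩ H) .sym u v  = cong₂ _∧_ (sym G u v) (sym H u v)
(G ∩ H) .irrefl v = cong₂ _∧_ (irrefl G v) (irrefl H v)

common : ∀ {n} → Graph n → Permutation′ n → Graph n
common G σ = G ∩ image σ G

I : ∀ {n} → Graph n → Permutation′ n → ℕ
I G σ = size (common G σ)

IsMinimum : Pred ℕ 0ℓ → ℕ → Set
IsMinimum P m = P m × (∀ x → P x → m ℕ.≤ x)

IsMaximum : Pred ℤ 0ℓ → ℤ → Set
IsMaximum P m = P m × (∀ x → P x → x ℤ.≤ m)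

-- f(n,k) and μ(n,𝓕) are given by the relations `m is f(n,k)' and
-- `m is μ(n,𝓕)', since the minimum and the maximum need not exist
-- for all arguments.
Is-f : ℕ → ℕ → ℕ → Set
Is-f n k = IsMinimum λ e →
  Σ[ G ∈ Graph n ] (size G ≡ e × (∀ (σ : Permutation′ n) → k ℕ.≤ I G σ))

Family : Set₁
Family = ∀ {n} → Pred (Graph n) 0ℓ

IsNearPacking : ∀ {n} → Family → Graph n → Permutation′ n → Set
IsNearPacking 𝓕 G σ = 𝓕 (common G σ)

Is-μ : ℕ → Family → ℤ → Set
Is-μ n 𝓕 = IsMaximum λ m →
  ∀ (G : Graph n) → + size G ℤ.≤ m →
  Σ[ σ ∈ Permutation′ n ] IsNearPacking 𝓕 G σ

𝓔 : ℕ → Family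
𝓔 r G = size G ℕ.≤ r

fromℤ : ℤ → ℚ
fromℤ i = i ℚ./ 1

fromℕ : ℕ → ℚ
fromℕ n = fromℤ (+ n)

-- A real number, presented by its Dedekind cut: the rationals strictly
-- below it and those strictly above it.
record Cut : Set₁ where
  field
    below above : Pred ℚ 0ℓ

open Cut public

-- The real number n^{2/3}, that is, the real cube root of n².
_^⅔ : ℕ → Cut
(n ^⅔) .below q = q * q * q ℚ.< fromℕ (n ℕ.^ 2)
(n ^⅔) .above q = fromℕ (n ℕ.^ 2) ℚ.< q * q * q

-- a −[ c ]· x is the real number a - c x. As c > 0, the map
-- r ↦ a - c r reverses the order.
_−[_]·_ : ℚ → (c : ℚ) → .{{Positive c}} → Cut → Cut
(a −[ c ]· x) .below q = ∃[ r ] (above x r × q ≡ a - c * r)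
(a −[ c ]· x) .above q = ∃[ r ] (below x r × q ≡ a - c * r)

infix 4 _<ᶻ_ _≤ᶜ_

_<ᶻ_ : Cut → ℤ → Set
x <ᶻ i = above x (fromℤ i)

_≤ᶜ_ : ℤ → Cut → Set
i ≤ᶜ x = ¬ (x <ᶻ i)

IsFloor : Cut → ℤ → Set
IsFloor x i = i ≤ᶜ x × x <ᶻ i + + 1

⌊_⌋≤_ : Cut → ℤ → Set
⌊ x ⌋≤ m = ∃[ i ] (IsFloor x i × i ℤ.≤ m)

-- The real number 2n - 10 n^{2/3} - 7.
bound : ℕ → Cut
bound n = (fromℕ (2 ℕ.* n) - fromℕ 7) −[ fromℕ 10 ]· (n ^⅔)

-- g = o(h) as n → ∞.
_isLittleO_ : Rel (ℕ → ℚ) 0ℓ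
g isLittleO h = ∀ ε → 0ℚ ℚ.< ε →
  ∃[ N ] ∀ n → N ℕ.≤ n → ∣ g n ∣ ℚ.≤ ε * ∣ h n ∣

{-# OPTIONS --safe #-}
module Submission where

-- The upper bound is attained by K_{2,n-2}.  For the lower bound let G have
-- 2n - 7 - q edges with q³ ≥ 1000 n², and call the vertices of degree at least
-- √(q/5) - 1 hubs.  Charge every edge between a hub and another vertex to the
-- latter, and every edge between non-hubs half to each end.  On average less
-- than 2 is charged to a non-hub, with a total deficit of order n^{2/3}, so many
-- vertices have either no hub neighbour and at most three others, or one hub
-- neighbour and at most one other.  A permutation is built from swaps: hubs go
-- to an independent set A of such vertices and A goes to the hubs; the boundedly
-- many vertices whose neighbours in A meet hubs of large total degree are
-- exchanged with further vertices of the same kind.  Swapping images within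
-- these classes leaves at most three common edges, one of each of three types.
-- All other common edges disappear by swaps in the manner of Sauer and Spencer,
-- since a vertex outside these classes has few positions where it conflicts.

open import Defs
open import Data.Bool.Base using (Bool; true; false; not; _∧_; _∨_; _xor_; T)
import Data.Bool.Properties as Bool
open import Data.Empty using (⊥; ⊥-elim)
open import Data.Fin.Base using (Fin; zero; suc; toℕ)
import Data.Fin.Base as Fin using (fromℕ<)
open import Data.Fin.Permutation using (Permutation′; _⟨$⟩ʳ_; _⟨$⟩ˡ_; transpose; _∘ₚ_; inverseˡ; inverseʳ; flip; permutation)
import Data.Fin.Permutation as Perm
import Data.Fin.Properties as Fin
open import Data.Integer.Base using (ℤ; +_; -[1+_]; +[1+_])
import Data.Integer.Base as ℤ
import Data.Integer.Properties as ℤ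
import Data.Integer.Solver as ℤ
open import Data.List.Base using (List; []; _∷_; _++_; length; filterᵇ; cartesianProduct)
import Data.List.Base as List
open import Data.Nat.Base
open import Data.Nat.DivMod using (_/_; _%_; m≡m%n+[m/n]*n; m%n<n; m/n*n≤m)
open import Data.Nat.Induction using (<-wellFounded)
open import Data.Nat.Properties
open import Algebra.Properties.Semiring.Sum +-*-semiring
  using (sum; sum-cong-≗; ∑-distrib-+; ∑-comm; sum-permute; sum-replicate-zero; *-distribˡ-sum; *-distribʳ-sum)
open import Data.Nat.Tactic.RingSolver using (solve-∀)
open import Data.Product.Base using (_×_; _,_; Σ-syntax; ∃-syntax; proj₁; proj₂)
open import Data.Rational.Base using (ℚ; mkℚ; 0ℚ; toℚᵘ; _-_)
import Data.Rational.Base as ℚ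
import Data.Rational.Properties as ℚ
import Data.Rational.Solver as ℚ
open import Data.Rational.Unnormalised.Base as ℚᵘ using (mkℚᵘ; *≡*; *≤*; *<*)
import Data.Rational.Unnormalised.Properties as ℚᵘ
open import Data.Sum.Base using (_⊎_; inj₁; inj₂)
open import Data.Vec.Base using (Vec; []; _∷_; lookup; tabulate)
open import Data.Vec.Properties using (lookup∘tabulate)
open import Function.Base using (_∘_; case_of_)
open import Function.Bundles using (_⇔_; mk⇔)
open import Induction.WellFounded using (Acc; acc)
open import Relation.Binary.Definitions using (tri<; tri≈; tri>)
open import Relation.Binary.PropositionalEquality as ≡ using (_≡_; _≢_; refl; trans; cong; cong₂; subst; subst₂)
open import Relation.Nullary using (¬_; Dec; yes; no; does; contradiction; ¬?)
open import Relation.Nullary.Decidable using (_×-dec_; map′)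

-- Where the exponent comes from: with `h` hubs, the non-hubs have total weight (twice the deficit)
-- at least about 2 q - 4 h, and one of the two kinds of vertices suffices as pool once 8 h plus a
-- multiple of the hub threshold is available. Hubs have degree at least m - 1, so h is at most
-- about 2 n / m (edges inside the hubs only raise the weight), and 24 n / m has to stay below 2 q.
-- With m near the square root of q / 5 this compares q³ with n². The second demand is that a vertex
-- outside the fixed classes has fewer than n bad positions. Those caused by hubs are cut off at f /
-- 5 both for the permutation and for its inverse, where f < 2 n counts the edges between hubs and
-- non-hubs; together they take at most 4 n / 5. The two kinds of pool vertices are never mixed. If
-- no pool vertex has a hub neighbour, none of the three types of common edges occurs. If each has
-- one hub neighbour and at most one other, both neighbours are unique, and this is what makes
-- swapping images safe.

private variable n : ℕ

-- Sums and subsets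

sum-mono : {f g : Fin n → ℕ} → (∀ i → f i ≤ g i) → sum f ≤ sum g
sum-mono {n = zero}  _   = z≤n
sum-mono {n = suc n} f≤g = +-mono-≤ (f≤g zero) (sum-mono (f≤g ∘ suc))

sum-mono-< : {f g : Fin n → ℕ} → (∀ i → f i ≤ g i) → ∀ j → f j < g j → sum f < sum g
sum-mono-< f≤g zero    lt = +-mono-<-≤ lt (sum-mono (f≤g ∘ suc))
sum-mono-< f≤g (suc j) lt = +-mono-≤-< (f≤g zero) (sum-mono-< (f≤g ∘ suc) j lt)

sum-const : ∀ n {c} → sum {n} (λ _ → c) ≡ n * c
sum-const zero    = refl
sum-const (suc n) = cong (λ □ → _ + □) (sum-const n)

term≤sum : (f : Fin n → ℕ) (i : Fin n) → f i ≤ sum f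
term≤sum f zero    = m≤m+n _ _
term≤sum f (suc i) = ≤-trans (term≤sum (f ∘ suc) i) (m≤n+m _ _)

sum-<⇒∃ : {f g : Fin n → ℕ} → sum f < sum g → ∃[ i ] f i < g i
sum-<⇒∃ {n = suc n} {f} {g} lt with f zero <? g zero
... | yes p = zero , p
... | no ¬p with sum-<⇒∃ {f = f ∘ suc} {g ∘ suc}
                   (≰⇒> λ ge → <⇒≱ lt (+-mono-≤ (≮⇒≥ ¬p) ge))
...   | i , q = suc i , q

0<sum⇒∃ : {f : Fin n → ℕ} → 0 < sum f → ∃[ i ] 0 < f i
0<sum⇒∃ {n} {f} p = sum-<⇒∃ {f = λ _ → 0} (subst (_< sum f) (≡.sym (sum-replicate-zero n)) p)

sum-zero : {f : Fin n → ℕ} → (∀ i → f i ≡ 0) → sum f ≡ 0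
sum-zero {n} f≡0 = trans (sum-cong-≗ f≡0) (sum-replicate-zero n)

sum≤1 : {f : Fin n → ℕ} → (∀ i → f i ≤ 1) →
        (∀ i j → 0 < f i → 0 < f j → i ≡ j) → sum f ≤ 1
sum≤1 {n = zero}      _    _    = z≤n
sum≤1 {n = suc n} {f} f≤1 uniq with f zero in eq
... | zero  = sum≤1 (f≤1 ∘ suc) λ i j p q → Fin.suc-injective (uniq (suc i) (suc j) p q)
... | suc k = subst (suc k + sum (f ∘ suc) ≤_) (+-identityʳ 1)
                (+-mono-≤ (subst (_≤ 1) eq (f≤1 zero)) (≤-reflexive (sum-zero rest)))
  where
  rest : ∀ i → f (suc i) ≡ 0
  rest i with f (suc i) in eq′
  ... | zero  = refl
  ... | suc _ with uniq zero (suc i) (subst (0 <_) (≡.sym eq) (s≤s z≤n))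
                                     (subst (0 <_) (≡.sym eq′) (s≤s z≤n))
  ...   | ()

⟦_⟧ : Bool → ℕ
⟦ false ⟧ = 0
⟦ true ⟧  = 1

⟦⟧≤1 : ∀ b → ⟦ b ⟧ ≤ 1
⟦⟧≤1 false = z≤n
⟦⟧≤1 true  = ≤-refl

Subset : ℕ → Set
Subset n = Fin n → Bool

infix 4 _∈_ _∉_

_∈_ _∉_ : Fin n → Subset n → Set
v ∈ S = S v ≡ true
v ∉ S = S v ≡ false

_∈?_ : (v : Fin n) (S : Subset n) → v ∈ S ⊎ v ∉ S
v ∈? S with S v
... | true  = inj₁ refl
... | false = inj₂ refl

∈∉-absurd : ∀ {a} {A : Set a} {b : Bool} → b ≡ true → b ≡ false → A
∈∉-absurd refl ()

≢true⇒false : ∀ {b} → ¬ b ≡ true → b ≡ false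
≢true⇒false {false} _ = refl
≢true⇒false {true}  f = ⊥-elim (f refl)

∧-true : ∀ {a b} → a ∧ b ≡ true → a ≡ true × b ≡ true
∧-true {true} {true} _ = refl , refl

∧-true⁻¹ : ∀ {a b} → a ≡ true → b ≡ true → a ∧ b ≡ true
∧-true⁻¹ refl refl = refl

not-true : ∀ {a} → not a ≡ true → a ≡ false
not-true {false} _ = refl

∣_∣ₛ : Subset n → ℕ
∣ S ∣ₛ = sum λ v → ⟦ S v ⟧

⟦⟧-mono : ∀ {a b} → (a ≡ true → b ≡ true) → ⟦ a ⟧ ≤ ⟦ b ⟧
⟦⟧-mono {false} _ = z≤n
⟦⟧-mono {true}  f rewrite f refl = ≤-refl

0<⟦⟧ : ∀ {a} → 0 < ⟦ a ⟧ → a ≡ true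
0<⟦⟧ {true} _ = refl

⟦true⟧ : ∀ {a} → a ≡ true → ⟦ a ⟧ ≡ 1
⟦true⟧ refl = refl

⟦false⟧ : ∀ {a} → a ≡ false → ⟦ a ⟧ ≡ 0
⟦false⟧ refl = refl

⟦not⟧ : ∀ a → ⟦ a ⟧ + ⟦ not a ⟧ ≡ 1
⟦not⟧ false = refl
⟦not⟧ true  = refl

⟦⟧*-mono : ∀ a {x y} → (a ≡ true → x ≤ y) → ⟦ a ⟧ * x ≤ ⟦ a ⟧ * y
⟦⟧*-mono false _ = z≤n
⟦⟧*-mono true  f = +-monoˡ-≤ 0 (f refl)

⟦⟧*≤ : ∀ a {x} → ⟦ a ⟧ * x ≤ x
⟦⟧*≤ false = z≤n
⟦⟧*≤ true  = ≤-reflexive (+-identityʳ _)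

*⟦⟧≤ : ∀ {x} a → x * ⟦ a ⟧ ≤ x
*⟦⟧≤ {x} a = subst (_≤ x) (*-comm ⟦ a ⟧ x) (⟦⟧*≤ a)

∣∣-strict : {S T : Subset n} → (∀ v → v ∈ S → v ∈ T) → ∀ {w} → w ∈ T → w ∉ S →
            ∣ S ∣ₛ < ∣ T ∣ₛ
∣∣-strict S⊆T {w} w∈T w∉S = sum-mono-< (λ v → ⟦⟧-mono (S⊆T v)) w
  (subst (_< ⟦ _ ⟧) (≡.sym (⟦false⟧ w∉S)) (≤-reflexive (≡.sym (⟦true⟧ w∈T))))

exchange : (S T : Subset n) → ∣ S ∣ₛ ≤ ∣ T ∣ₛ → ∀ {x} → x ∈ S → x ∉ T →
           ∃[ w ] w ∈ T × w ∉ S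
exchange S T S≤T {x} x∈S x∉T
  with Fin.any? (λ w → T w ∧ not (S w) Bool.≟ true)
... | yes (w , p) = w , proj₁ (∧-true p) , not-true (proj₂ (∧-true {T w} p))
... | no ¬p = contradiction S≤T (<⇒≱ (∣∣-strict T⊆S x∈S x∉T))
  where
  T⊆S : ∀ v → v ∈ T → v ∈ S
  T⊆S v v∈T with S v in eq
  ... | true  = refl
  ... | false = ⊥-elim (¬p (v , ∧-true⁻¹ v∈T (cong not eq)))

sum-⟦≡⟧ : (v : Fin n) (f : Fin n → ℕ) → sum (λ u → ⟦ does (u Fin.≟ v) ⟧ * f u) ≡ f v
sum-⟦≡⟧ {suc n} zero    f = trans (cong₂ _+_ (+-identityʳ (f zero)) (sum-zero {n} {λ _ → 0} λ _ → refl)) (+-identityʳ _)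
sum-⟦≡⟧ {suc n} (suc v) f = sum-⟦≡⟧ v (f ∘ suc)

argmax : (S : Subset n) (w : Fin n → ℕ) → ∀ {x} → x ∈ S →
         ∃[ v ] v ∈ S × (∀ u → u ∈ S → w u ≤ w v)
argmax {suc n} S w {x} x∈S with Fin.any? (λ v → S (suc v) Bool.≟ true)
... | no ¬p = zero , S0 x x∈S , zero-max
  where
  S0 : ∀ x → x ∈ S → zero ∈ S
  S0 zero    p = p
  S0 (suc x) p = ⊥-elim (¬p (x , p))
  zero-max : ∀ u → u ∈ S → w u ≤ w zero
  zero-max zero    _ = ≤-refl
  zero-max (suc u) p = ⊥-elim (¬p (u , p))
... | yes (x′ , p) with argmax (S ∘ suc) (w ∘ suc) {x′} p | zero ∈? S
...   | v , v∈S , max | inj₂ 0∉S = suc v , v∈S , λ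
  { zero 0∈S → ∈∉-absurd 0∈S 0∉S ; (suc u) → max u }
...   | v , v∈S , max | inj₁ 0∈S with ≤-total (w zero) (w (suc v))
...     | inj₁ le = suc v , v∈S , λ { zero _ → le ; (suc u) → max u }
...     | inj₂ ge = zero , 0∈S , λ { zero _ → ≤-refl ; (suc u) q → ≤-trans (max u q) ge }

-- Swaps

-- The engine of all repeated swapping: a step either meets the goal or lowers a natural number.
descend : {A : Set} (μ : A → ℕ) {Good : A → Set} →
          (∀ a → Good a ⊎ ∃[ b ] μ b < μ a) → A → ∃[ a ] Good a
descend {A} μ {Good} step a = go a (<-wellFounded (μ a))
  where
  go : ∀ a → Acc _<_ (μ a) → ∃[ a ] Good a
  go a (acc rs) with step a
  ... | inj₁ good     = a , good
  ... | inj₂ (b , lt) = go b (rs lt)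

infixl 9 _·_

_·_ : Permutation′ n → Fin n → Fin n
σ · v = σ ⟨$⟩ʳ v

·-injective : (σ : Permutation′ n) → ∀ {u v} → σ · u ≡ σ · v → u ≡ v
·-injective σ eq = trans (≡.sym (inverseˡ σ)) (trans (cong (σ ⟨$⟩ˡ_) eq) (inverseˡ σ))

abstract

  swapAt : Permutation′ n → Fin n → Fin n → Permutation′ n
  swapAt σ v w = transpose v w ∘ₚ σ

  swap-fst : (σ : Permutation′ n) (v w : Fin n) → swapAt σ v w · v ≡ σ · w
  swap-fst σ v w with v Fin.≟ v
  ... | yes _  = refl
  ... | no v≢v = ⊥-elim (v≢v refl)

  swap-snd : (σ : Permutation′ n) (v w : Fin n) → swapAt σ v w · w ≡ σ · v
  swap-snd σ v w with w Fin.≟ v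
  ... | yes refl = refl
  ... | no _ with w Fin.≟ w
  ...   | yes _  = refl
  ...   | no w≢w = ⊥-elim (w≢w refl)

  swap-other : (σ : Permutation′ n) {v w u : Fin n} → u ≢ v → u ≢ w → swapAt σ v w · u ≡ σ · u
  swap-other σ {v} {w} {u} u≢v u≢w with u Fin.≟ v
  ... | yes p = ⊥-elim (u≢v p)
  ... | no _ with u Fin.≟ w
  ...   | yes p = ⊥-elim (u≢w p)
  ...   | no _  = refl

≢-from-∈∉ : {S : Subset n} {u v : Fin n} → u ∈ S → v ∉ S → u ≢ v
≢-from-∈∉ p q refl = ∈∉-absurd p q

∣∣-permute : (σ : Permutation′ n) (T : Subset n) → ∣ (λ v → T (σ · v)) ∣ₛ ≡ ∣ T ∣ₛ
∣∣-permute σ T = ≡.sym (sum-permute (λ v → ⟦ T v ⟧) σ)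

-- While some `x` in `S` is sent outside `T`, the preimage of `T`, being at least as large as `S`,
-- contains some `w` outside `S`; exchange the images of `x` and `w`. Only vertices of `S` and
-- vertices sitting on `T` ever move, which is why everything placed earlier survives.
improve-placement : (σ : Permutation′ n) (S T : Subset n) → ∣ S ∣ₛ ≤ ∣ T ∣ₛ →
        ∃[ τ ] (∀ u → u ∈ S → τ · u ∈ T) × (∀ u → u ∉ S → σ · u ∉ T → τ · u ≡ σ · u)
improve-placement {n} σ S T S≤T with descend {A = State} μ {λ s → ∀ u → u ∈ S → proj₁ s · u ∈ T} step (σ , λ _ _ _ → refl)
  where
  State : Set
  State = Σ[ τ ∈ Permutation′ n ] (∀ u → u ∉ S → σ · u ∉ T → τ · u ≡ σ · u)
  μ : State → ℕ
  μ (τ , _) = ∣ (λ u → S u ∧ not (T (τ · u))) ∣ₛ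
  step : ∀ s → (∀ u → u ∈ S → proj₁ s · u ∈ T) ⊎ ∃[ s′ ] μ s′ < μ s
  step s@(τ , inv) with Fin.any? (λ u → (S u Bool.≟ true) ×-dec (T (τ · u) Bool.≟ false))
  ... | no ¬p = inj₁ λ u u∈S → case T (τ · u) Bool.≟ true of λ
    { (yes p) → p ; (no q) → ⊥-elim (¬p (u , u∈S , ≢true⇒false q)) }
  ... | yes (x , x∈S , τx∉T)
    with exchange S (λ v → T (τ · v)) (subst (∣ S ∣ₛ ≤_) (≡.sym (∣∣-permute τ T)) S≤T) x∈S τx∉T
  ...   | w , τw∈T , w∉S = inj₂ ((τ′ , inv′) , ∣∣-strict shrink {x}
            (cong₂ _∧_ x∈S (cong not τx∉T))
            (cong₂ (λ a b → a ∧ not b) x∈S (trans (cong T (swap-fst τ x w)) τw∈T)))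
    where
    τ′ = swapAt τ x w
    inv′ : ∀ u → u ∉ S → σ · u ∉ T → τ′ · u ≡ σ · u
    inv′ u u∉S σu∉T = trans (swap-other τ (λ { refl → ∈∉-absurd x∈S u∉S })
      (λ { refl → ∈∉-absurd τw∈T (trans (cong T (inv u u∉S σu∉T)) σu∉T) })) (inv u u∉S σu∉T)
    shrink : ∀ v → (S v ∧ not (T (τ′ · v))) ≡ true → (S v ∧ not (T (τ · v))) ≡ true
    shrink v p with ∧-true {S v} p | v Fin.≟ x
    ... | v∈S , q | yes refl = cong₂ _∧_ x∈S (cong not τx∉T)
    ... | v∈S , q | no v≢x = ∧-true⁻¹ v∈S
      (trans (cong (not ∘ T) (≡.sym (swap-other τ v≢x (≢-from-∈∉ v∈S w∉S)))) q)
... | (τ , inv) , good = τ , good , inv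

abstract

  place : (σ : Permutation′ n) (S T : Subset n) → ∣ S ∣ₛ ≤ ∣ T ∣ₛ →
          ∃[ τ ] (∀ u → u ∈ S → τ · u ∈ T) × (∀ u → u ∉ S → σ · u ∉ T → τ · u ≡ σ · u)
  place = improve-placement

-- The preimage of `T` contains `S` and is no larger, so the two coincide.
place-onto : (τ : Permutation′ n) {S T : Subset n} → ∣ T ∣ₛ ≤ ∣ S ∣ₛ →
             (∀ u → u ∈ S → τ · u ∈ T) → ∀ u → τ · u ∈ T → u ∈ S
place-onto τ {S} {T} T≤S into u τu∈T with u ∈? S
... | inj₁ u∈S = u∈S
... | inj₂ u∉S = contradiction (subst (_≤ ∣ S ∣ₛ) (≡.sym (∣∣-permute τ T)) T≤S)
                   (<⇒≱ (∣∣-strict into τu∈T u∉S))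

-- Removing common edges by swaps

module _ {n} (G : Graph n) where

  nb : Subset n → Fin n → ℕ
  nb S v = sum λ u → ⟦ adj G v u ⟧ * ⟦ S u ⟧

  deg : Fin n → ℕ
  deg v = sum λ u → ⟦ adj G v u ⟧

  nb≤deg : ∀ S v → nb S v ≤ deg v
  nb≤deg S v = sum-mono λ u → *⟦⟧≤ (S u)

  -- Stated with `σ` itself, whereas `I` looks at the inverse; the conflicts of `σ` are therefore
  -- the common edges for `flip σ`.
  conflict : Permutation′ n → Fin n → Fin n → Bool
  conflict σ u v = adj G u v ∧ adj G (σ · u) (σ · v)

  conflict-sym : ∀ σ u v → conflict σ u v ≡ conflict σ v u
  conflict-sym σ u v = cong₂ _∧_ (Graph.sym G u v) (Graph.sym G (σ · u) (σ · v))

  conflict-cong : ∀ {σ τ u v} → σ · u ≡ τ · u → σ · v ≡ τ · v → conflict σ u v ≡ conflict τ u v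
  conflict-cong {u = u} {v} p q = cong₂ (λ x y → adj G u v ∧ adj G x y) p q

  adj-irrefl : ∀ {a} {A : Set a} {v} → adj G v v ≡ true → A
  adj-irrefl {v = v} p = ∈∉-absurd p (irrefl G v)

  between : Permutation′ n → Subset n → Subset n → ℕ
  between σ X Y = sum λ x → sum λ y → ⟦ X x ∧ (Y y ∧ conflict σ x y) ⟧

  between-elim : ∀ {σ X Y x y} → (X x ∧ (Y y ∧ conflict σ x y)) ≡ true →
                 x ∈ X × y ∈ Y × adj G x y ≡ true × adj G (σ · x) (σ · y) ≡ true
  between-elim {σ} {X} {Y} {x} {y} p with ∧-true {X x} p
  ... | x∈X , q with ∧-true {Y y} q
  ...   | y∈Y , r with ∧-true {adj G x y} r
  ...     | s , t = x∈X , y∈Y , s , t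

  module Separate (X Y X′ : Subset n) (disjoint : ∀ v → v ∈ X → v ∉ Y) (σ₀ : Permutation′ n) where

    Allowed : Permutation′ n → Set
    Allowed σ = (∀ u → u ∉ X → σ · u ≡ σ₀ · u) × (∀ u → u ∈ X → σ · u ∈ X′)

    -- By the first hypothesis each `x` has at most one conflict, so two conflicts have distinct
    -- first ends `x₁`, `x₂`. The second hypothesis, used in both directions, says that exchanging
    -- their images leaves both free of conflicts. As `Y` does not move, nothing changes at the
    -- other vertices of `X`, and the number of conflicts drops.
    remove-conflicts :
      (∀ σ → Allowed σ → ∀ {x y₁ y₂} → x ∈ X → y₁ ∈ Y → y₂ ∈ Y →
         adj G x y₁ ≡ true → adj G (σ · x) (σ · y₁) ≡ true →
         adj G x y₂ ≡ true → adj G (σ · x) (σ · y₂) ≡ true → y₁ ≡ y₂) →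
      (∀ σ → Allowed σ → ∀ {x₁ x₂ y₁ y₂ y} → x₁ ∈ X → x₂ ∈ X → x₁ ≢ x₂ →
         y₁ ∈ Y → y₂ ∈ Y → y ∈ Y →
         adj G x₁ y₁ ≡ true → adj G (σ · x₁) (σ · y₁) ≡ true →
         adj G x₂ y₂ ≡ true → adj G (σ · x₂) (σ · y₂) ≡ true →
         adj G x₁ y ≡ true → adj G (σ · x₂) (σ · y) ≡ true → ⊥) →
      Allowed σ₀ → ∃[ σ ] Allowed σ × between σ X Y ≤ 1
    remove-conflicts row swapOK ok₀
      with descend {A = State} μ {λ s → between (proj₁ s) X Y ≤ 1} step (σ₀ , ok₀)
      where
      State : Set
      State = Σ[ σ ∈ Permutation′ n ] Allowed σ
      μ : State → ℕ
      μ (σ , _) = between σ X Y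
      step : ∀ s → between (proj₁ s) X Y ≤ 1 ⊎ ∃[ s′ ] μ s′ < μ s
      step s@(σ , ok@(off , into))
        with Fin.any? (λ x₁ → Fin.any? λ x₂ → ¬? (x₁ Fin.≟ x₂) ×-dec
               (Fin.any? (λ y → (X x₁ ∧ (Y y ∧ conflict σ x₁ y)) Bool.≟ true) ×-dec
                Fin.any? (λ y → (X x₂ ∧ (Y y ∧ conflict σ x₂ y)) Bool.≟ true)))
      ... | no ¬p = inj₁ (sum≤1 rows λ x₁ x₂ p q → case x₁ Fin.≟ x₂ of λ
              { (yes eq) → eq
              ; (no x₁≢x₂) → ⊥-elim (¬p (x₁ , x₂ , x₁≢x₂ , pos x₁ p , pos x₂ q)) })
        where
        pos : ∀ x → 0 < (sum λ y → ⟦ X x ∧ (Y y ∧ conflict σ x y) ⟧) →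
              ∃[ y ] (X x ∧ (Y y ∧ conflict σ x y)) ≡ true
        pos x p with 0<sum⇒∃ p
        ... | y , q = y , 0<⟦⟧ q
        rows : ∀ x → (sum λ y → ⟦ X x ∧ (Y y ∧ conflict σ x y) ⟧) ≤ 1
        rows x = sum≤1 (λ y → ⟦⟧≤1 (X x ∧ (Y y ∧ conflict σ x y))) uniq
          where
          uniq : ∀ y₁ y₂ → 0 < ⟦ X x ∧ (Y y₁ ∧ conflict σ x y₁) ⟧ →
                 0 < ⟦ X x ∧ (Y y₂ ∧ conflict σ x y₂) ⟧ → y₁ ≡ y₂
          uniq y₁ y₂ p q with between-elim {σ} {X} {Y} {x} {y₁} (0<⟦⟧ p)
                            | between-elim {σ} {X} {Y} {x} {y₂} (0<⟦⟧ q)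
          ... | x∈X , y₁∈Y , a , b | _ , y₂∈Y , c , d = row σ ok x∈X y₁∈Y y₂∈Y a b c d
      ... | yes (x₁ , x₂ , x₁≢x₂ , (y₁ , p₁) , (y₂ , p₂))
        with between-elim {σ} {X} {Y} {x₁} {y₁} p₁ | between-elim {σ} {X} {Y} {x₂} {y₂} p₂
      ... | x₁∈X , y₁∈Y , a₁ , b₁ | x₂∈X , y₂∈Y , a₂ , b₂ =
          inj₂ ((τ , off′ , into′) , sum-mono-< (λ x → sum-mono (shrink x)) x₁
            (sum-mono-< (shrink x₁) y₁
              (subst (_< ⟦ X x₁ ∧ (Y y₁ ∧ conflict σ x₁ y₁) ⟧) (≡.sym (⟦false⟧ (none₁ y₁)))
                (≤-reflexive (≡.sym (⟦true⟧ p₁))))))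
        where
        τ = swapAt σ x₁ x₂
        off′ : ∀ u → u ∉ X → τ · u ≡ σ₀ · u
        off′ u u∉X = trans (swap-other σ (≢-from-∈∉ x₁∈X u∉X ∘ ≡.sym) (≢-from-∈∉ x₂∈X u∉X ∘ ≡.sym)) (off u u∉X)
        into′ : ∀ u → u ∈ X → τ · u ∈ X′
        into′ u u∈X with u Fin.≟ x₁ | u Fin.≟ x₂
        ... | yes refl | _ = trans (cong X′ (swap-fst σ u x₂)) (into x₂ x₂∈X)
        ... | no _ | yes refl = trans (cong X′ (swap-snd σ x₁ u)) (into x₁ x₁∈X)
        ... | no p | no q = trans (cong X′ (swap-other σ p q)) (into u u∈X)
        offY : ∀ {y} → y ∈ Y → τ · y ≡ σ · y
        offY {y} y∈Y = swap-other σ (λ { refl → ∈∉-absurd y∈Y (disjoint y x₁∈X) })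
                                    (λ { refl → ∈∉-absurd y∈Y (disjoint y x₂∈X) })
        none₁ : ∀ y → (X x₁ ∧ (Y y ∧ conflict τ x₁ y)) ≡ false
        none₁ y = ≢true⇒false λ p → case between-elim {τ} {X} {Y} {x₁} {y} p of λ
          { (_ , y∈Y , a , b) → swapOK σ ok x₁∈X x₂∈X x₁≢x₂ y₁∈Y y₂∈Y y∈Y a₁ b₁ a₂ b₂ a
              (subst (λ z → adj G z _ ≡ true) (swap-fst σ x₁ x₂)
                (subst (λ z → adj G _ z ≡ true) (offY y∈Y) b)) }
        none₂ : ∀ y → (X x₂ ∧ (Y y ∧ conflict τ x₂ y)) ≡ false
        none₂ y = ≢true⇒false λ p → case between-elim {τ} {X} {Y} {x₂} {y} p of λ
          { (_ , y∈Y , a , b) → swapOK σ ok x₂∈X x₁∈X (x₁≢x₂ ∘ ≡.sym) y₂∈Y y₁∈Y y∈Y a₂ b₂ a₁ b₁ a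
              (subst (λ z → adj G z _ ≡ true) (swap-snd σ x₁ x₂)
                (subst (λ z → adj G _ z ≡ true) (offY y∈Y) b)) }
        shrink : ∀ x y → ⟦ X x ∧ (Y y ∧ conflict τ x y) ⟧ ≤ ⟦ X x ∧ (Y y ∧ conflict σ x y) ⟧
        shrink x y with x Fin.≟ x₁ | x Fin.≟ x₂
        ... | yes refl | _ = subst (_≤ _) (≡.sym (⟦false⟧ (none₁ y))) z≤n
        ... | no _ | yes refl = subst (_≤ _) (≡.sym (⟦false⟧ (none₂ y))) z≤n
        ... | no p | no q = ⟦⟧-mono λ t → case between-elim {τ} {X} {Y} {x} {y} t of λ
          { (x∈X , y∈Y , a , b) → ∧-true⁻¹ x∈X (∧-true⁻¹ y∈Y (∧-true⁻¹ a
              (trans (cong₂ (adj G) (≡.sym (swap-other σ p q)) (≡.sym (offY y∈Y))) b))) }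
    ... | (σ , ok) , good = σ , ok , good

    abstract

      -- If swapping the images of the first ends of two conflicts never creates
      -- a conflict at these ends, then all but one of the conflicts can be removed.
      separate :
        (∀ σ → Allowed σ → ∀ {x y₁ y₂} → x ∈ X → y₁ ∈ Y → y₂ ∈ Y →
           adj G x y₁ ≡ true → adj G (σ · x) (σ · y₁) ≡ true →
           adj G x y₂ ≡ true → adj G (σ · x) (σ · y₂) ≡ true → y₁ ≡ y₂) →
        (∀ σ → Allowed σ → ∀ {x₁ x₂ y₁ y₂ y} → x₁ ∈ X → x₂ ∈ X → x₁ ≢ x₂ →
           y₁ ∈ Y → y₂ ∈ Y → y ∈ Y →
           adj G x₁ y₁ ≡ true → adj G (σ · x₁) (σ · y₁) ≡ true →
           adj G x₂ y₂ ≡ true → adj G (σ · x₂) (σ · y₂) ≡ true →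
           adj G x₁ y ≡ true → adj G (σ · x₂) (σ · y) ≡ true → ⊥) →
        Allowed σ₀ → ∃[ σ ] Allowed σ × between σ X Y ≤ 1
      separate = remove-conflicts

  module Spread (F : Subset n) (σ₀ : Permutation′ n) where

    Agrees : Permutation′ n → Set
    Agrees σ = ∀ u → u ∈ F → σ · u ≡ σ₀ · u

    -- Reasons against exchanging the images of `v` and `w`: `w` is fixed, `w` is adjacent to `v`,
    -- the new image of `v` would create a conflict at `v`, or likewise for `w`. A fixed `w` is
    -- already counted by the first term; the factors `not (F w)` keep it out of the others, so that
    -- the hubs among the neighbours of a hub do not enter the count.
    obstacles : Permutation′ n → Fin n → Fin n → ℕ
    obstacles σ v w =
      (⟦ F w ⟧ + ⟦ adj G v w ⟧) +
      ((sum λ u → ⟦ adj G v u ⟧ * (⟦ adj G (σ · u) (σ · w) ⟧ * ⟦ not (F w) ⟧)) +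
       (sum λ u → ⟦ adj G (σ · v) (σ · u) ⟧ * (⟦ adj G u w ⟧ * ⟦ not (F w) ⟧)))

    -- If the obstacles of `v` number fewer than `n`, some `w` has none, and exchanging images with
    -- it frees `v` and `w` of all conflicts without creating any elsewhere.
    spread-out : (∀ σ → Agrees σ → ∀ v → v ∉ F → sum (obstacles σ v) < n) →
             ∃[ σ ] Agrees σ × (∀ u v → conflict σ u v ≡ true → u ∈ F)
    spread-out few with descend {A = State} μ {Done} step (σ₀ , λ _ _ → refl)
      where
      State : Set
      State = Σ[ σ ∈ Permutation′ n ] Agrees σ
      Done : State → Set
      Done (σ , _) = ∀ u v → conflict σ u v ≡ true → u ∈ F
      -- Conflicts with both ends in `F` are out of reach of swaps outside `F`, so the measure
      -- ignores them.
      outer : Permutation′ n → Fin n → Fin n → Bool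
      outer σ a b = conflict σ a b ∧ not (F a ∧ F b)
      μ : State → ℕ
      μ (σ , _) = sum λ a → sum λ b → ⟦ outer σ a b ⟧
      step : ∀ s → Done s ⊎ ∃[ s′ ] μ s′ < μ s
      step (σ , agr) with Fin.any? (λ v → Fin.any? λ u →
                          (conflict σ v u Bool.≟ true) ×-dec (F v Bool.≟ false))
      ... | no ¬p = inj₁ λ u v c → case u ∈? F of λ
        { (inj₁ p) → p ; (inj₂ q) → ⊥-elim (¬p (u , v , c , q)) }
      ... | yes (v , u₀ , c , v∉F)
        with sum-<⇒∃ {f = obstacles σ v} {λ _ → 1}
               (subst (sum (obstacles σ v) <_) (≡.sym (trans (sum-const n) (*-identityʳ n))) (few σ agr v v∉F))
      -- The vertex `v` itself is never found here, since its conflict with `u₀` counts as an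
      -- obstacle to `w = v`.
      ... | w , lt = inj₂ ((τ , agr′) , sum-mono-< (λ a → sum-mono (shrink a)) v
                       (sum-mono-< (shrink v) u₀ strict))
        where
        τ = swapAt σ v w
        zero-obs : obstacles σ v w ≡ 0
        zero-obs = n<1⇒n≡0 lt
        firsts = m+n≡0⇒m≡0 (⟦ F w ⟧ + ⟦ adj G v w ⟧) zero-obs
        seconds = m+n≡0⇒n≡0 (⟦ F w ⟧ + ⟦ adj G v w ⟧) zero-obs
        zero⇒false : ∀ {b} → ⟦ b ⟧ ≡ 0 → b ≡ false
        zero⇒false {false} _ = refl
        w∉F : w ∉ F
        w∉F = zero⇒false (m+n≡0⇒m≡0 ⟦ F w ⟧ firsts)
        v≁w : adj G v w ≡ false
        v≁w = zero⇒false (m+n≡0⇒n≡0 ⟦ F w ⟧ firsts)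
        absent : ∀ {b c} → ⟦ b ⟧ * (⟦ c ⟧ * ⟦ not (F w) ⟧) ≡ 0 → b ≡ true → c ≡ true → ⊥
        absent eq refl refl rewrite w∉F with eq
        ... | ()
        term0 : ∀ {f : Fin n → ℕ} u → sum f ≡ 0 → f u ≡ 0
        term0 {f} u eq = n≤0⇒n≡0 (subst (f u ≤_) eq (term≤sum f u))
        safe₁ : ∀ u → adj G v u ≡ true → adj G (σ · u) (σ · w) ≡ true → ⊥
        safe₁ u = absent (term0 u (m+n≡0⇒m≡0 _ seconds))
        safe₂ : ∀ u → adj G (σ · v) (σ · u) ≡ true → adj G u w ≡ true → ⊥
        safe₂ u = absent (term0 u (m+n≡0⇒n≡0 (sum λ u → ⟦ adj G v u ⟧ * (⟦ adj G (σ · u) (σ · w) ⟧ * ⟦ not (F w) ⟧)) seconds))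
        agr′ : Agrees τ
        agr′ u u∈F = trans (swap-other σ (≢-from-∈∉ u∈F v∉F) (≢-from-∈∉ u∈F w∉F)) (agr u u∈F)
        none-v : ∀ b → conflict τ v b ≡ false
        none-v b = ≢true⇒false λ p → case ∧-true {adj G v b} p of λ
          { (v~b , e) → case ((b Fin.≟ v) , (b Fin.≟ w)) of λ
            { (yes refl , _) → adj-irrefl v~b
            ; (_ , yes refl) → ∈∉-absurd v~b v≁w
            ; (no b≢v , no b≢w) → safe₁ b v~b (trans (Graph.sym G _ _)
                (subst (λ z → adj G z _ ≡ true) (swap-fst σ v w)
                  (subst (λ z → adj G _ z ≡ true) (swap-other σ b≢v b≢w) e))) } }
        none-w : ∀ b → conflict τ w b ≡ false
        none-w b = ≢true⇒false λ p → case ∧-true {adj G w b} p of λ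
          { (w~b , e) → case ((b Fin.≟ w) , (b Fin.≟ v)) of λ
            { (yes refl , _) → adj-irrefl w~b
            ; (_ , yes refl) → ∈∉-absurd (trans (Graph.sym G v w) w~b) v≁w
            ; (no b≢w , no b≢v) → safe₂ b
                (subst (λ z → adj G z _ ≡ true) (swap-snd σ v w)
                  (subst (λ z → adj G _ z ≡ true) (swap-other σ b≢v b≢w) e))
                (trans (Graph.sym G b w) w~b) } }
        vanish : ∀ {a b k} → conflict τ a b ≡ false → ⟦ outer τ a b ⟧ ≤ k
        vanish {a} {b} eq = subst (_≤ _) (≡.sym (⟦false⟧ (cong (_∧ not (F a ∧ F b)) eq))) z≤n
        shrink : ∀ a b → ⟦ outer τ a b ⟧ ≤ ⟦ outer σ a b ⟧
        shrink a b with a Fin.≟ v | a Fin.≟ w | b Fin.≟ v | b Fin.≟ w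
        ... | yes refl | _ | _ | _ = vanish {a} {b} (none-v b)
        ... | _ | yes refl | _ | _ = vanish {a} {b} (none-w b)
        ... | _ | _ | yes refl | _ = vanish {a} {b} (trans (conflict-sym τ a b) (none-v a))
        ... | _ | _ | _ | yes refl = vanish {a} {b} (trans (conflict-sym τ a b) (none-w a))
        ... | no p | no q | no r | no s = ≤-reflexive (cong (λ c → ⟦ c ∧ not (F a ∧ F b) ⟧)
                (conflict-cong {τ} {σ} {a} {b} (swap-other σ p q) (swap-other σ r s)))
        strict : ⟦ outer τ v u₀ ⟧ < ⟦ outer σ v u₀ ⟧
        strict rewrite none-v u₀ | c | v∉F = s≤s z≤n
    ... | (σ , agr) , done = σ , agr , done

    abstract

      spread : (∀ σ → Agrees σ → ∀ v → v ∉ F → sum (obstacles σ v) < n) →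
               ∃[ σ ] Agrees σ × (∀ u v → conflict σ u v ≡ true → u ∈ F)
      spread = spread-out

-- Greedy selection and loads

is : Fin n → Subset n
is v u = does (u Fin.≟ v)

is⇒≡ : {u v : Fin n} → u ∈ is v → u ≡ v
is⇒≡ {u = u} {v} p with u Fin.≟ v
... | yes eq = eq

∨-true : ∀ {a b} → a ∨ b ≡ true → a ≡ true ⊎ b ≡ true
∨-true {true}  _ = inj₁ refl
∨-true {false} p = inj₂ p

∨-trueˡ : ∀ {a b} → a ≡ true → a ∨ b ≡ true
∨-trueˡ refl = refl

∨-trueʳ : ∀ {a b} → b ≡ true → a ∨ b ≡ true
∨-trueʳ {false} refl = refl
∨-trueʳ {true}  refl = refl

∨-false : ∀ {a b} → a ∨ b ≡ false → a ≡ false × b ≡ false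
∨-false {false} p = refl , p

two-terms≤sum : (f : Fin n → ℕ) {x y : Fin n} → x ≢ y → f x + f y ≤ sum f
two-terms≤sum f {zero}  {zero}  x≢y = ⊥-elim (x≢y refl)
two-terms≤sum f {zero}  {suc y} x≢y = +-monoʳ-≤ (f zero) (term≤sum (f ∘ suc) y)
two-terms≤sum f {suc x} {zero}  x≢y =
  subst (_≤ sum f) (+-comm (f zero) _) (+-monoʳ-≤ (f zero) (term≤sum (f ∘ suc) x))
two-terms≤sum f {suc x} {suc y} x≢y =
  ≤-trans (two-terms≤sum (f ∘ suc) (x≢y ∘ cong suc)) (m≤n+m _ (f zero))

weight : (Fin n → ℕ) → Subset n → ℕ
weight w S = sum λ v → ⟦ S v ⟧ * w v

∣∨∣ : (S T : Subset n) → ∣ (λ v → S v ∨ T v) ∣ₛ ≤ ∣ S ∣ₛ + ∣ T ∣ₛ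
∣∨∣ S T = ≤-trans (sum-mono pointwise) (≤-reflexive (∑-distrib-+ (λ v → ⟦ S v ⟧) (λ v → ⟦ T v ⟧)))
  where
  pointwise : ∀ v → ⟦ S v ∨ T v ⟧ ≤ ⟦ S v ⟧ + ⟦ T v ⟧
  pointwise v with S v
  ... | true  = m≤m+n 1 _
  ... | false = ≤-refl

sum-+ : (f g : Fin n → ℕ) → sum (λ i → f i + g i) ≡ sum f + sum g
sum-+ f g = ∑-distrib-+ f g

*-sum : ∀ c (f : Fin n → ℕ) → c * sum f ≡ sum (λ i → c * f i)
*-sum c f = *-distribˡ-sum c f

sum-* : ∀ (f : Fin n → ℕ) c → sum f * c ≡ sum (λ i → f i * c)
sum-* f c = *-distribʳ-sum c f

module _ {n} (G : Graph n) where

  nb-unique : ∀ {S v x y} → nb G S v ≤ 1 → x ∈ S → y ∈ S →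
              adj G v x ≡ true → adj G v y ≡ true → x ≡ y
  nb-unique {S} {v} {x} {y} ≤1 x∈S y∈S v~x v~y with x Fin.≟ y
  ... | yes eq = eq
  ... | no x≢y = contradiction ≤1 (<⇒≱ (subst (_≤ nb G S v)
          (cong₂ _+_ (cong₂ _*_ (⟦true⟧ v~x) (⟦true⟧ x∈S)) (cong₂ _*_ (⟦true⟧ v~y) (⟦true⟧ y∈S)))
          (two-terms≤sum (λ u → ⟦ adj G v u ⟧ * ⟦ S u ⟧) x≢y)))

  nb-pos : ∀ {S v x} → x ∈ S → adj G v x ≡ true → 0 < nb G S v
  nb-pos {S} {v} {x} x∈S v~x = ≤-trans
    (≤-reflexive (≡.sym (cong₂ _*_ (⟦true⟧ v~x) (⟦true⟧ x∈S))))
    (term≤sum (λ u → ⟦ adj G v u ⟧ * ⟦ S u ⟧) x)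

  nb-none : ∀ {S v x} → nb G S v ≡ 0 → x ∈ S → adj G v x ≡ true → ⊥
  nb-none eq x∈S v~x = <⇒≢ (nb-pos x∈S v~x) (≡.sym eq)

  nb-exists : ∀ {S v} → 0 < nb G S v → ∃[ x ] x ∈ S × adj G v x ≡ true
  nb-exists {S} {v} pos with 0<sum⇒∃ pos
  ... | x , q = x , both (adj G v x) (S x) q
    where
    both : ∀ a b → 0 < ⟦ a ⟧ * ⟦ b ⟧ → b ≡ true × a ≡ true
    both true true _ = refl , refl

  Independent : Subset n → Set
  Independent S = ∀ u v → u ∈ S → v ∈ S → adj G u v ≡ false

  -- `rest` is the supply for later selections, hence the demand that it be non-adjacent to
  -- `chosen`; `cheap` guarantees that it is still worth something.
  record Selection (w : Fin n → ℕ) (S : Subset n) (C N : ℕ) : Set where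
    field
      chosen rest : Subset n
      chosen⊆     : ∀ v → v ∈ chosen → v ∈ S
      independent : Independent chosen
      size≡       : ∣ chosen ∣ₛ ≡ N
      rest⊆       : ∀ v → v ∈ rest → v ∈ S
      rest∉       : ∀ v → v ∈ rest → v ∉ chosen
      rest≁       : ∀ u v → u ∈ chosen → v ∈ rest → adj G u v ≡ false
      cheap       : weight w S ≤ weight w rest + C * N

  without : Fin n → Subset n → Subset n
  without v S u = S u ∧ not (is v u ∨ adj G v u)

  without⊆ : ∀ v S u → u ∈ without v S → u ∈ S
  without⊆ v S u p = proj₁ (∧-true p)

  without-is : ∀ v S u → u ∈ without v S → is v u ≡ false
  without-is v S u p = proj₁ (∨-false (not-true (proj₂ (∧-true {S u} p))))

  without-adj : ∀ v S u → u ∈ without v S → adj G v u ≡ false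
  without-adj v S u p = proj₂ (∨-false {is v u} (not-true (proj₂ (∧-true {S u} p))))

  drop-one : ∀ (L : Subset n) (w : Fin n → ℕ) C (S : Subset n) → (∀ v → v ∈ S → v ∈ L) →
             ∀ v → (∀ u → u ∈ S → w u ≤ w v) → w v + nb G L v * w v ≤ C →
             weight w S ≤ weight w (without v S) + C
  drop-one L w C S S⊆L v max cost = begin
    weight w S
      ≤⟨ sum-mono pointwise ⟩
    sum (λ u → ⟦ S₁ u ⟧ * w u + (⟦ is v u ⟧ * w u + (⟦ adj G v u ⟧ * ⟦ L u ⟧) * w v))
      ≡⟨ sum-+ (λ u → ⟦ S₁ u ⟧ * w u) (λ u → ⟦ is v u ⟧ * w u + (⟦ adj G v u ⟧ * ⟦ L u ⟧) * w v) ⟩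
    weight w S₁ + sum (λ u → ⟦ is v u ⟧ * w u + (⟦ adj G v u ⟧ * ⟦ L u ⟧) * w v)
      ≡⟨ cong (λ □ → weight w S₁ + □) (trans
           (sum-+ (λ u → ⟦ is v u ⟧ * w u) (λ u → (⟦ adj G v u ⟧ * ⟦ L u ⟧) * w v))
           (cong₂ _+_ (sum-⟦≡⟧ v w) (≡.sym (sum-* (λ u → ⟦ adj G v u ⟧ * ⟦ L u ⟧) (w v))))) ⟩
    weight w S₁ + (w v + nb G L v * w v)
      ≤⟨ +-monoʳ-≤ (weight w S₁) cost ⟩
    weight w S₁ + C ∎
    where
    open ≤-Reasoning
    S₁ = without v S
    split : ∀ s i a l {x y} → (s ≡ true → l ≡ true × x ≤ y) →
            ⟦ s ⟧ * x ≤ ⟦ s ∧ not (i ∨ a) ⟧ * x + (⟦ i ⟧ * x + (⟦ a ⟧ * ⟦ l ⟧) * y)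
    split false _     _     _ _ = z≤n
    split true  true  _     _ {x} _ = m≤m+n (1 * x) _
    split true  false false _ {x} _ = m≤m+n (1 * x) _
    split true  false true  l f with f refl
    ... | refl , x≤y = +-monoˡ-≤ 0 x≤y
    pointwise : ∀ u → ⟦ S u ⟧ * w u ≤ ⟦ S₁ u ⟧ * w u + (⟦ is v u ⟧ * w u + (⟦ adj G v u ⟧ * ⟦ L u ⟧) * w v)
    pointwise u = split (S u) (is v u) (adj G v u) (L u) λ p → S⊆L u p , max u p

  add-one : ∀ {w C N} S v → v ∈ S → weight w S ≤ weight w (without v S) + C →
            Selection w (without v S) C N → Selection w S C (suc N)
  add-one {w} {C} {N} S v v∈S drop sel = record
    { chosen = chosen′ ; rest = rest
    ; chosen⊆ = λ u p → case ∨-true p of λ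
        { (inj₁ q) → subst (_∈ S) (≡.sym (is⇒≡ q)) v∈S ; (inj₂ q) → without⊆ v S u (chosen⊆ u q) }
    ; independent = indep
    ; size≡ = trans (sum-cong-≗ λ u → split (is v u) (chosen u) (only u))
                (trans (sum-+ (λ u → ⟦ is v u ⟧ * 1) (λ u → ⟦ chosen u ⟧))
                (cong₂ _+_ (sum-⟦≡⟧ v (λ _ → 1)) size≡))
    ; rest⊆ = λ u p → without⊆ v S u (rest⊆ u p)
    ; rest∉ = λ u p → cong₂ _∨_ (without-is v S u (rest⊆ u p)) (rest∉ u p)
    ; rest≁ = λ u u′ p q → case ∨-true p of λ
        { (inj₁ r) → subst (λ z → adj G z u′ ≡ false) (≡.sym (is⇒≡ r)) (without-adj v S u′ (rest⊆ u′ q))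
        ; (inj₂ r) → rest≁ u u′ r q }
    ; cheap = ≤-trans drop (≤-trans (+-monoˡ-≤ C cheap) (≤-reflexive (shuffle (weight w rest) C N)))
    }
    where
    open Selection sel
    chosen′ : Subset n
    chosen′ u = is v u ∨ chosen u
    shuffle : ∀ r C N → (r + C * N) + C ≡ r + C * suc N
    shuffle = solve-∀
    only : ∀ u → is v u ≡ true → chosen u ≡ false
    only u p = ≢true⇒false λ q → ∈∉-absurd p (without-is v S u (chosen⊆ u q))
    split : ∀ i c → (i ≡ true → c ≡ false) → ⟦ i ∨ c ⟧ ≡ ⟦ i ⟧ * 1 + ⟦ c ⟧
    split false _     _ = refl
    split true  false _ = refl
    split true  true  f = ∈∉-absurd refl (f refl)
    apart : ∀ {x y} → is v x ≡ true → chosen y ≡ true → adj G x y ≡ false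
    apart {x} {y} p q = subst (λ z → adj G z y ≡ false) (≡.sym (is⇒≡ p)) (without-adj v S y (chosen⊆ y q))
    indep : Independent chosen′
    indep x y p q with ∨-true p | ∨-true q
    ... | inj₁ r | inj₁ s = subst (λ z → adj G x z ≡ false) (trans (is⇒≡ r) (≡.sym (is⇒≡ s))) (irrefl G x)
    ... | inj₁ r | inj₂ s = apart r s
    ... | inj₂ r | inj₁ s = trans (Graph.sym G x y) (apart s r)
    ... | inj₂ r | inj₂ s = independent x y r s

  abstract

    -- Greedily choosing a vertex of maximum weight costs at most its own weight,
    -- once for itself and once for each of its neighbours.
    select : ∀ (L : Subset n) (w : Fin n → ℕ) C N (S : Subset n) → 0 < C →
             (∀ v → v ∈ S → v ∈ L) →
             (∀ v → v ∈ S → w v + nb G L v * w v ≤ C) →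
             C * N ≤ weight w S → Selection w S C N
    select L w C zero S _ _ _ _ = record
      { chosen = λ _ → false ; rest = S ; chosen⊆ = λ _ () ; independent = λ _ _ ()
      ; size≡ = sum-zero {n} {λ _ → 0} (λ _ → refl) ; rest⊆ = λ _ p → p ; rest∉ = λ _ _ → refl
      ; rest≁ = λ _ _ () ; cheap = m≤m+n _ _ }
    select L w C (suc N) S 0<C S⊆L cost enough
      with 0<sum⇒∃ (<-≤-trans 0<C (≤-trans (m≤m+n C (C * N)) (subst (_≤ weight w S) (*-suc C N) enough)))
    ... | x , pos with argmax S w (inS (S x) pos)
      where
      inS : ∀ b {y} → 0 < ⟦ b ⟧ * y → b ≡ true
      inS true _ = refl
    ...   | v , v∈S , max = add-one S v v∈S drop
        (select L w C N (without v S) 0<C (λ u p → S⊆L u (without⊆ v S u p)) (λ u p → cost u (without⊆ v S u p))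
          (+-cancelʳ-≤ C (C * N) (weight w (without v S)) (≤-trans
            (subst (_≤ weight w S) (trans (*-suc C N) (+-comm C (C * N))) enough) drop)))
      where
      drop : weight w S ≤ weight w (without v S) + C
      drop = drop-one L w C S S⊆L v max (cost v v∈S)

  load : Subset n → (Fin n → Fin n) → (Fin n → ℕ) → Fin n → ℕ
  load S p val u = sum λ s → ⟦ S s ⟧ * (⟦ adj G (p s) u ⟧ * val s)

  -- Exchanging the sums, each `s` contributes `val s` once for every neighbour of `p s` in `L`.
  total-load : ∀ L S p val k → (∀ s → s ∈ S → nb G L (p s) ≤ k) →
               weight (load S p val) L ≤ k * weight val S
  total-load L S p val k small = begin
    sum (λ u → ⟦ L u ⟧ * sum (λ s → ⟦ S s ⟧ * (⟦ adj G (p s) u ⟧ * val s)))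
      ≡⟨ sum-cong-≗ (λ u → *-sum ⟦ L u ⟧ (λ s → ⟦ S s ⟧ * (⟦ adj G (p s) u ⟧ * val s))) ⟩
    sum (λ u → sum (λ s → ⟦ L u ⟧ * (⟦ S s ⟧ * (⟦ adj G (p s) u ⟧ * val s))))
      ≡⟨ ∑-comm (λ u s → ⟦ L u ⟧ * (⟦ S s ⟧ * (⟦ adj G (p s) u ⟧ * val s))) ⟩
    sum (λ s → sum (λ u → ⟦ L u ⟧ * (⟦ S s ⟧ * (⟦ adj G (p s) u ⟧ * val s))))
      ≡⟨ sum-cong-≗ (λ s → trans (sum-cong-≗ (λ u → rearr ⟦ L u ⟧ ⟦ S s ⟧ ⟦ adj G (p s) u ⟧ (val s)))
           (≡.sym (sum-* (λ u → ⟦ adj G (p s) u ⟧ * ⟦ L u ⟧) (⟦ S s ⟧ * val s)))) ⟩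
    sum (λ s → nb G L (p s) * (⟦ S s ⟧ * val s))
      ≤⟨ sum-mono pointwise ⟩
    sum (λ s → k * (⟦ S s ⟧ * val s))
      ≡⟨ *-sum k (λ s → ⟦ S s ⟧ * val s) ⟨
    k * weight val S ∎
    where
    open ≤-Reasoning
    rearr : ∀ a b c d → a * (b * (c * d)) ≡ (c * a) * (b * d)
    rearr = solve-∀
    pointwise : ∀ s → nb G L (p s) * (⟦ S s ⟧ * val s) ≤ k * (⟦ S s ⟧ * val s)
    pointwise s with S s in eq
    ... | true  = *-monoˡ-≤ (1 * val s) (small s eq)
    ... | false = ≤-reflexive (trans (*-zeroʳ (nb G L (p s))) (≡.sym (*-zeroʳ k)))

heavy : (L : Subset n) (g : Fin n → ℕ) (c : ℕ) → Subset n
heavy L g c v = L v ∧ (c <ᵇ g v)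

<ᵇ-true : ∀ {a b} → (a <ᵇ b) ≡ true → a < b
<ᵇ-true {a} {b} eq = <ᵇ⇒< a b (subst T (≡.sym eq) _)

<ᵇ-true⁻¹ : ∀ {a b} → a < b → (a <ᵇ b) ≡ true
<ᵇ-true⁻¹ {a} {b} lt with a <ᵇ b in eq
... | true  = refl
... | false = ⊥-elim (subst T eq (<⇒<ᵇ lt))

<ᵇ-false : ∀ {a b} → (a <ᵇ b) ≡ false → b ≤ a
<ᵇ-false eq = ≮⇒≥ λ lt → ∈∉-absurd (<ᵇ-true⁻¹ lt) eq

markov : (L : Subset n) (g : Fin n → ℕ) (c : ℕ) → ∣ heavy L g c ∣ₛ * suc c ≤ weight g L
markov L g c = ≤-trans (≤-reflexive (sum-* (λ v → ⟦ heavy L g c v ⟧) (suc c))) (sum-mono pointwise)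
  where
  pointwise : ∀ v → ⟦ heavy L g c v ⟧ * suc c ≤ ⟦ L v ⟧ * g v
  pointwise v with L v | c <ᵇ g v in eq
  ... | false | _     = z≤n
  ... | true  | false = z≤n
  ... | true  | true  = +-monoˡ-≤ 0 (<ᵇ-true eq)

-- Placing the hubs

∁ : Subset n → Subset n
∁ S v = not (S v)

∁-true : (S : Subset n) {v : Fin n} → v ∉ S → v ∈ ∁ S
∁-true S eq = cong not eq

-- H is the set of hubs and P the pool of vertices which may take their places.
-- A vertex whose neighbours meet hubs of total degree above cap needs a place of
-- its own; capacity bounds the number of such vertices by o.
record Setup {n} (G : Graph n) : Set where
  field
    H P           : Subset n
    w             : Fin n → ℕ
    D cap k C o   : ℕ
    P∉H           : ∀ v → v ∈ P → v ∉ H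
    P-hub         : ∀ v → v ∈ P → nb G H v ≤ 1
    P-few         : ∀ v → v ∈ P → nb G (∁ H) v ≤ k
    -- Either hub neighbours are absent or non-hub neighbours are unique, uniformly over the pool:
    -- the arguments below compare two different pool vertices, one with a hub neighbour and one
    -- with two non-hub neighbours.
    P-kind        : (∀ v → v ∈ P → nb G H v ≡ 0) ⊎ (∀ v → v ∈ P → nb G (∁ H) v ≤ 1)
    -- A pool vertex with a non-hub neighbour thus has weight at most `k`, which bounds the weight
    -- lost in avoiding the neighbours of heavy vertices.
    P-weight      : ∀ v → v ∈ P → w v + nb G (∁ H) v ≤ suc k
    P-cost        : ∀ v → v ∈ P → w v + nb G (∁ H) v * w v ≤ C
    C-pos         : 0 < C
    light         : ∀ v → v ∉ H → deg G v ≤ D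
    capacity      : k * weight (nb G (∁ H)) H < suc o * suc cap
    -- One set of `∣ H ∣ₛ` vertices is selected, then two sets of at most `o`, which may overlap and
    -- so are paid for once. The last term is the loss from avoiding neighbours of heavy vertices.
    rich          : C * (∣ H ∣ₛ + o) + k * (o * D) ≤ weight w P
    -- The fixed vertices number at most `2 * ∣ H ∣ₛ + 2 * o`, the neighbours of a vertex at most
    -- `D`; each of the two remaining sorts of obstacles accounts for at most `D * D + cap`.
    room          : 2 * ∣ H ∣ₛ + 2 * o + D + 2 * (D * D + cap) < n

module Build {n} {G : Graph n} (setup : Setup G) where
  open Setup setup

  L : Subset n
  L = ∁ H

  adj-comm : ∀ {u v} → adj G u v ≡ true → adj G v u ≡ true
  adj-comm {u} {v} = trans (Graph.sym G v u)

  hub-unique : ∀ {v x y} → v ∈ P → x ∈ H → y ∈ H → adj G v x ≡ true → adj G v y ≡ true → x ≡ y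
  hub-unique v∈P = nb-unique G (P-hub _ v∈P)

  -- A pool vertex `v′` with a hub neighbour rules out the first alternative of `P-kind`; the second
  -- then speaks about `v`.
  low-unique : ∀ {v x y z} → v ∈ P → x ∉ H → y ∉ H → adj G v x ≡ true → adj G v y ≡ true →
               ∀ {v′} → v′ ∈ P → z ∈ H → adj G v′ z ≡ true → x ≡ y
  low-unique v∈P x∉H y∉H v~x v~y v′∈P z∈H v′~z with P-kind
  ... | inj₁ none = ⊥-elim (nb-none G (none _ v′∈P) z∈H v′~z)
  ... | inj₂ few  = nb-unique G (few _ v∈P) (∁-true H x∉H) (∁-true H y∉H) v~x v~y

  between-cong : ∀ σ τ X Y → (∀ x → x ∈ X → σ · x ≡ τ · x) → (∀ y → y ∈ Y → σ · y ≡ τ · y) →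
                 between G σ X Y ≤ between G τ X Y
  between-cong σ τ X Y f g = sum-mono λ x → sum-mono λ y → ⟦⟧-mono λ p →
    case between-elim G {σ} {X} {Y} {x} {y} p of λ
      { (x∈X , y∈Y , a , b) → ∧-true⁻¹ x∈X (∧-true⁻¹ y∈Y
          (trans (≡.sym (conflict-cong G {σ} {τ} {x} {y} (f x x∈X) (g y y∈Y))) (∧-true⁻¹ a b))) }

  ≡⇒∉ : ∀ (S : Subset n) {u v} → u ≡ v → v ∉ S → u ∉ S
  ≡⇒∉ S refl p = p

  record Hubs : Set where
    field
      selection : Selection G w P C ∣ H ∣ₛ
      σ         : Permutation′ n
    open Selection selection public renaming (chosen to A; rest to R)
    field
      H→A : ∀ u → u ∈ H → σ · u ∈ A
      A→H : ∀ u → u ∈ A → σ · u ∈ H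
      few : between G σ H A ≤ 1

    A∈P : ∀ {v} → v ∈ A → v ∈ P
    A∈P = chosen⊆ _
    A∉H : ∀ {v} → v ∈ A → v ∉ H
    A∉H p = P∉H _ (A∈P p)
    R∈P : ∀ {v} → v ∈ R → v ∈ P
    R∈P = rest⊆ _
    R∉H : ∀ {v} → v ∈ R → v ∉ H
    R∉H p = P∉H _ (R∈P p)
    H∉A : ∀ {v} → v ∈ H → v ∉ A
    H∉A p = ≢true⇒false λ q → ∈∉-absurd p (A∉H q)

  hubs : Hubs
  hubs = record { selection = sel ; σ = proj₁ third ; H→A = proj₂ (proj₁ (proj₂ third))
                ; A→H = λ u p → subst (_∈ H) (≡.sym (proj₁ (proj₁ (proj₂ third)) u (A∉H p))) (A→H₂ u p)
                ; few = proj₂ (proj₂ third) }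
    where
    sel : Selection G w P C ∣ H ∣ₛ
    sel = select G L w C ∣ H ∣ₛ P C-pos (λ v p → ∁-true H (P∉H v p)) P-cost
            (≤-trans (*-monoʳ-≤ C (m≤m+n ∣ H ∣ₛ o)) (≤-trans (m≤m+n _ (k * (o * D))) rich))
    open Selection sel renaming (chosen to A)
    A∉H : ∀ {v} → v ∈ A → v ∉ H
    A∉H p = P∉H _ (chosen⊆ _ p)
    H∉A : ∀ {v} → v ∈ H → v ∉ A
    H∉A p = ≢true⇒false λ q → ∈∉-absurd p (A∉H q)
    first = place Perm.id H A (≤-reflexive (≡.sym size≡))
    second = place (proj₁ first) A H (≤-reflexive size≡)
    σ₂ = proj₁ second
    H→A₂ : ∀ u → u ∈ H → σ₂ · u ∈ A
    H→A₂ u p = subst (_∈ A) (≡.sym (proj₂ (proj₂ second) u (H∉A p) (A∉H (proj₁ (proj₂ first) u p))))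
                 (proj₁ (proj₂ first) u p)
    A→H₂ = proj₁ (proj₂ second)
    module S = Separate G H A A (λ _ → H∉A) σ₂
    A→H′ : ∀ σ → S.Allowed σ → ∀ {u} → u ∈ A → σ · u ∈ H
    A→H′ σ (off , _) {u} p = subst (_∈ H) (≡.sym (off u (A∉H p))) (A→H₂ u p)
    third = S.separate
      -- The images of `y₁` and `y₂` are hubs adjacent to the image of `x`, which lies in the pool.
      (λ σ ok x∈H y₁∈A y₂∈A _ b _ d → ·-injective σ
        (hub-unique (chosen⊆ _ (proj₂ ok _ x∈H)) (A→H′ σ ok y₁∈A) (A→H′ σ ok y₂∈A) b d))
      -- The image of `x₂` has a single hub neighbour, so `y = y₂`; then `x₁` and `x₂` are both hub
      -- neighbours of `y`, which is in the pool.
      (λ σ ok {y₂ = y₂} {y = y} x₁∈H x₂∈H x₁≢x₂ _ y₂∈A y∈A _ _ c d e f → x₁≢x₂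
        (hub-unique (chosen⊆ _ y∈A) x₁∈H x₂∈H (adj-comm e)
          (adj-comm (subst (λ z → adj G _ z ≡ true)
            (·-injective σ (hub-unique (chosen⊆ _ (proj₂ ok _ x₂∈H)) (A→H′ σ ok y₂∈A) (A→H′ σ ok y∈A) d f)) c))))
      ((λ _ _ → refl) , H→A₂)

  module WithHubs (hs : Hubs) where
    open Hubs hs

    A≡H∘σ : ∀ u → A u ≡ H (σ · u)
    A≡H∘σ u with u ∈? A
    ... | inj₁ p = trans p (≡.sym (A→H u p))
    ... | inj₂ q = trans q (≡.sym (≢true⇒false λ r →
            ∈∉-absurd (place-onto σ (≤-reflexive (≡.sym size≡)) A→H u r) q))

    -- The image of u must avoid the neighbours of the hubs σ a with a ~ u, at most
    -- loadB u of which are not hubs; loadA is the same for the inverse of σ.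
    loadB loadA : Fin n → ℕ
    loadB = load G A (λ a → a) (λ a → nb G L (σ · a))
    loadA = load G H (σ ·_) (nb G L)

    OB OA : Subset n
    OB = heavy L loadB cap
    OA = heavy L loadA cap

    few-heavy : ∀ {ℓ} → weight ℓ L ≤ k * weight (nb G L) H → ∣ heavy L ℓ cap ∣ₛ ≤ o
    few-heavy {ℓ} le = s≤s⁻¹ (*-cancelʳ-< _ _ (suc o)
      (≤-<-trans (≤-trans (markov L ℓ cap) le) capacity))

    ∣OA∣≤o : ∣ OA ∣ₛ ≤ o
    ∣OA∣≤o = few-heavy (total-load G L H (σ ·_) (nb G L) k (λ x p → P-few _ (A∈P (H→A x p))))

    ∣OB∣≤o : ∣ OB ∣ₛ ≤ o
    ∣OB∣≤o = few-heavy (≤-trans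
      (total-load G L A (λ a → a) (λ a → nb G L (σ · a)) k (λ a p → P-few _ (A∈P p)))
      -- As `A` is exactly the preimage of `H`, the values over `A` are those over the hubs,
      -- rearranged by `σ`.
      (*-monoʳ-≤ k (≤-reflexive (trans
        (sum-cong-≗ λ u → cong (λ b → ⟦ b ⟧ * nb G L (σ · u)) (A≡H∘σ u))
        (≡.sym (sum-permute (λ u → ⟦ H u ⟧ * nb G L u) σ))))))

    load-pos : ∀ {S p val u} → 0 < load G S p val u → ∃[ s ] s ∈ S × adj G (p s) u ≡ true
    load-pos {S} {p} {val} {u} pos with 0<sum⇒∃ pos
    ... | s , q = s , both (S s) (adj G (p s) u) q
      where
      both : ∀ a b {x} → 0 < ⟦ a ⟧ * (⟦ b ⟧ * x) → a ≡ true × b ≡ true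
      both true true _ = refl , refl

    heavy-∉H : ∀ {ℓ u} → u ∈ heavy L ℓ cap → u ∉ H
    heavy-∉H {u = u} p = not-true (proj₁ (∧-true p))

    heavy-pos : ∀ {ℓ u} → u ∈ heavy L ℓ cap → 0 < ℓ u
    heavy-pos {u = u} p = ≤-<-trans z≤n (<ᵇ-true {cap} (proj₂ (∧-true {L u} p)))

    OB∉H : ∀ {u} → u ∈ OB → u ∉ H
    OB∉H = heavy-∉H {loadB}

    OA∉H : ∀ {u} → u ∈ OA → u ∉ H
    OA∉H = heavy-∉H {loadA}

    -- All heavy vertices are of this sort. Since `A` is independent and no vertex of `R` is
    -- adjacent to it, they lie outside `A` and `R`, hence outside everything selected so far or
    -- later.
    TouchesA : Fin n → Set
    TouchesA u = ∃[ a ] a ∈ A × adj G a u ≡ true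

    OB-touches : ∀ {u} → u ∈ OB → TouchesA u
    OB-touches p = load-pos {A} {λ a → a} {λ a → nb G L (σ · a)} (heavy-pos {loadB} p)

    OA-touches : ∀ {u} → u ∈ OA → TouchesA u
    OA-touches p with load-pos {H} {σ ·_} {nb G L} (heavy-pos {loadA} p)
    ... | x , x∈H , e = σ · x , H→A x x∈H , e

    touches-∉A : ∀ {u} → TouchesA u → u ∉ A
    touches-∉A {u} (a , a∈A , e) = ≢true⇒false λ p → ∈∉-absurd e (independent a u a∈A p)

    touches-∉R : ∀ {u} → TouchesA u → u ∉ R
    touches-∉R {u} (a , a∈A , e) = ≢true⇒false λ p → ∈∉-absurd e (rest≁ a u a∈A p)

    -- The places for `OB` are taken from here: the places in `OA` will be filled by other fixed
    -- vertices, and no edge may join the two sets of places.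
    R₀ : Subset n
    R₀ v = R v ∧ (nb G OA v ≡ᵇ 0)

    weight-R : C * o + k * (o * D) ≤ weight w R
    weight-R = +-cancelʳ-≤ (C * ∣ H ∣ₛ) _ _ (≤-trans (≤-reflexive (shuffle C ∣ H ∣ₛ o (k * (o * D)))) (≤-trans rich cheap))
      where
      shuffle : ∀ C h o x → C * o + x + C * h ≡ C * (h + o) + x
      shuffle = solve-∀

    -- Each vertex dropped has a neighbour in `OA` and therefore weight at most `k`, so charging `k`
    -- to every edge at `OA` suffices; at most `o` vertices of degree at most `D` have no more than
    -- `o * D` edges.
    lost : weight w R ≤ weight w R₀ + k * (o * D)
    lost = begin
      weight w R
        ≤⟨ sum-mono (λ v → split (R v) (nb G OA v) (w v) (cheaper v)) ⟩
      sum (λ v → ⟦ R₀ v ⟧ * w v + k * nb G OA v)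
        ≡⟨ sum-+ (λ v → ⟦ R₀ v ⟧ * w v) (λ v → k * nb G OA v) ⟩
      weight w R₀ + sum (λ v → k * nb G OA v)
        ≡⟨ cong (λ □ → weight w R₀ + □) (≡.sym (*-sum k (nb G OA))) ⟩
      weight w R₀ + k * sum (nb G OA)
        ≤⟨ +-monoʳ-≤ (weight w R₀) (*-monoʳ-≤ k neighbours) ⟩
      weight w R₀ + k * (o * D) ∎
      where
      open ≤-Reasoning
      split : ∀ r m x → (r ≡ true → 0 < m → x ≤ k) → ⟦ r ⟧ * x ≤ ⟦ r ∧ (m ≡ᵇ 0) ⟧ * x + k * m
      split false m       x f = z≤n
      split true  zero    x f = m≤m+n (1 * x) _
      split true  (suc m) x f = ≤-trans (≤-reflexive (+-identityʳ x))
        (≤-trans (f refl z<s) (≤-trans (m≤m+n k (k * m)) (≤-reflexive (≡.sym (*-suc k m)))))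
      cheaper : ∀ v → v ∈ R → 0 < nb G OA v → w v ≤ k
      cheaper v v∈R pos with nb-exists G pos
      ... | x , x∈OA , v~x = s≤s⁻¹ (≤-trans (≤-reflexive (+-comm 1 (w v)))
        (≤-trans (+-monoʳ-≤ (w v) (nb-pos G {L} (∁-true H (OA∉H x∈OA)) v~x)) (P-weight v (R∈P v∈R))))
      neighbours : sum (nb G OA) ≤ o * D
      neighbours = begin
        sum (λ v → sum λ u → ⟦ adj G v u ⟧ * ⟦ OA u ⟧)
          ≡⟨ ∑-comm (λ v u → ⟦ adj G v u ⟧ * ⟦ OA u ⟧) ⟩
        sum (λ u → sum λ v → ⟦ adj G v u ⟧ * ⟦ OA u ⟧)
          ≤⟨ sum-mono (λ u → ≤-trans
               (≤-reflexive (trans (≡.sym (sum-* (λ v → ⟦ adj G v u ⟧) ⟦ OA u ⟧)) (*-comm _ ⟦ OA u ⟧)))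
               (⟦⟧*-mono (OA u) λ p → ≤-trans
                 (≤-reflexive (sum-cong-≗ λ v → cong ⟦_⟧ (Graph.sym G v u))) (light u (OA∉H p)))) ⟩
        sum (λ u → ⟦ OA u ⟧ * D)
          ≡⟨ ≡.sym (sum-* (λ u → ⟦ OA u ⟧) D) ⟩
        ∣ OA ∣ₛ * D
          ≤⟨ *-monoˡ-≤ D ∣OA∣≤o ⟩
        o * D ∎

    pick : ∀ S → (∀ v → v ∈ S → v ∈ R) → C * o ≤ weight w S → ∀ {N} → N ≤ o → Selection G w S C N
    pick S S⊆R enough {N} N≤o = select G L w C N S C-pos (λ v p → ∁-true H (R∉H (S⊆R v p)))
      (λ v p → P-cost v (R∈P (S⊆R v p))) (≤-trans (*-monoʳ-≤ C N≤o) enough)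

    R₀⊆R : ∀ v → v ∈ R₀ → v ∈ R
    R₀⊆R v p = proj₁ (∧-true p)

    sel-Q : Selection G w R₀ C ∣ OB ∣ₛ
    sel-Q = pick R₀ R₀⊆R (+-cancelʳ-≤ (k * (o * D)) _ _ (≤-trans weight-R lost)) ∣OB∣≤o

    sel-W : Selection G w R C ∣ OA ∣ₛ
    sel-W = pick R (λ _ p → p) (≤-trans (m≤m+n _ _) weight-R) ∣OA∣≤o

  -- A vertex of `OB` has too many bad positions, and a position in `OA` is bad for too many
  -- vertices. Accordingly `Q` is a set of positions receiving `OB`, and `W` a set of vertices sent
  -- to `OA`; being on opposite sides of the permutation, they may overlap.
  record Loads (hs : Hubs) : Set where
    open Hubs hs using (A; R; R∈P; A→H; H→A; A∉H; H∉A; A∈P)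
    open WithHubs hs
    field
      Q W   : Subset n
      Q∈R   : ∀ {v} → v ∈ Q → v ∈ R
      W∈R   : ∀ {v} → v ∈ W → v ∈ R
      Q-ind : Independent G Q
      W-ind : Independent G W
      ∣W∣   : ∣ W ∣ₛ ≡ ∣ OA ∣ₛ
      Q≁OA  : ∀ {u v} → u ∈ Q → v ∈ OA → adj G u v ≡ false
      τ     : Permutation′ n
      τ-H   : ∀ u → u ∈ H → τ · u ≡ Hubs.σ hs · u
      τ-A   : ∀ u → u ∈ A → τ · u ≡ Hubs.σ hs · u
      OB→Q  : ∀ u → u ∈ OB → τ · u ∈ Q
      W→OA  : ∀ u → u ∈ W → τ · u ∈ OA
      fewB  : between G τ OB A ≤ 1
      fewW  : between G τ W H ≤ 1

  loads : (hs : Hubs) → Loads hs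
  loads hs = record
    { Q = Q ; W = W ; Q∈R = Q∈R ; W∈R = W∈R ; Q-ind = SQ.independent ; W-ind = SW.independent
    ; ∣W∣ = SW.size≡ ; Q≁OA = Q≁OA ; τ = τ
    ; τ-H = λ u p → trans (τ≡σ₄ u (H∉W p) (≡⇒∉ OA (σ₄-H u p) (A∉OA (H→A u p)))) (σ₄-H u p)
    ; τ-A = λ u p → trans (τ≡σ₄ u (A∉W p) (≡⇒∉ OA (σ₄-A u p) (H∉OA (A→H u p)))) (σ₄-A u p)
    ; OB→Q = λ u p → subst (_∈ Q) (≡.sym (τ-OB u p)) (σ₄-OB u p)
    ; W→OA = proj₂ τ-ok
    ; fewB = ≤-trans (between-cong τ σ₄ OB A τ-OB
               (λ u p → τ≡σ₄ u (A∉W p) (≡⇒∉ OA (σ₄-A u p) (H∉OA (A→H u p))))) fewB₄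
    ; fewW = proj₂ (proj₂ sixth) }
    where
    open Hubs hs
    open WithHubs hs
    module SQ = Selection sel-Q
    module SW = Selection sel-W
    Q = SQ.chosen
    W = SW.chosen
    Q∈R : ∀ {v} → v ∈ Q → v ∈ R
    Q∈R p = R₀⊆R _ (SQ.chosen⊆ _ p)
    W∈R : ∀ {v} → v ∈ W → v ∈ R
    W∈R p = SW.chosen⊆ _ p
    Q≁OA : ∀ {u v} → u ∈ Q → v ∈ OA → adj G u v ≡ false
    Q≁OA {u} p q = ≢true⇒false λ e → nb-none G (zero? (nb G OA u) (proj₂ (∧-true {R u} (SQ.chosen⊆ u p)))) q e
      where
      zero? : ∀ m → (m ≡ᵇ 0) ≡ true → m ≡ 0
      zero? zero _ = refl
    A∉OA : ∀ {u} → u ∈ A → u ∉ OA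
    A∉OA p = ≢true⇒false λ q → ∈∉-absurd p (touches-∉A (OA-touches q))
    H∉OA : ∀ {u} → u ∈ H → u ∉ OA
    H∉OA p = ≢true⇒false λ q → ∈∉-absurd p (OA∉H q)
    H∉OB : ∀ {u} → u ∈ H → u ∉ OB
    H∉OB p = ≢true⇒false λ q → ∈∉-absurd p (OB∉H q)
    A∉OB : ∀ {u} → u ∈ A → u ∉ OB
    A∉OB p = ≢true⇒false λ q → ∈∉-absurd p (touches-∉A (OB-touches q))
    A∉R : ∀ {u} → u ∈ A → u ∉ R
    A∉R p = ≢true⇒false λ q → ∈∉-absurd p (rest∉ _ q)
    A∉Q : ∀ {u} → u ∈ A → u ∉ Q
    A∉Q p = ≢true⇒false λ q → ∈∉-absurd (Q∈R q) (A∉R p)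
    H∉Q : ∀ {u} → u ∈ H → u ∉ Q
    H∉Q p = ≢true⇒false λ q → ∈∉-absurd p (R∉H (Q∈R q))
    A∉W : ∀ {u} → u ∈ A → u ∉ W
    A∉W p = ≢true⇒false λ q → ∈∉-absurd (W∈R q) (A∉R p)
    H∉W : ∀ {u} → u ∈ H → u ∉ W
    H∉W p = ≢true⇒false λ q → ∈∉-absurd p (R∉H (W∈R q))
    OB∉W : ∀ {u} → u ∈ OB → u ∉ W
    OB∉W p = ≢true⇒false λ q → ∈∉-absurd (W∈R q) (touches-∉R (OB-touches p))
    Q∉OA : ∀ {u} → u ∈ Q → u ∉ OA
    Q∉OA p = ≢true⇒false λ q → ∈∉-absurd (Q∈R p) (touches-∉R (OA-touches q))

    third = place σ OB Q (≤-reflexive (≡.sym SQ.size≡))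
    σ₃ = proj₁ third
    σ₃-H : ∀ u → u ∈ H → σ₃ · u ≡ σ · u
    σ₃-H u p = proj₂ (proj₂ third) u (H∉OB p) (A∉Q (H→A u p))
    σ₃-A : ∀ u → u ∈ A → σ₃ · u ≡ σ · u
    σ₃-A u p = proj₂ (proj₂ third) u (A∉OB p) (H∉Q (A→H u p))
    module S₄ = Separate G OB A Q (λ _ p → touches-∉A (OB-touches p)) σ₃
    A→H₄ : ∀ σ′ → S₄.Allowed σ′ → ∀ {u} → u ∈ A → σ′ · u ∈ H
    A→H₄ σ′ (off , _) {u} p = subst (_∈ H) (≡.sym (trans (off u (A∉OB p)) (σ₃-A u p))) (A→H u p)
    fourth = S₄.separate
      (λ σ′ ok x∈ y₁∈ y₂∈ _ b _ d → ·-injective σ′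
        (hub-unique (R∈P (Q∈R (proj₂ ok _ x∈))) (A→H₄ σ′ ok y₁∈) (A→H₄ σ′ ok y₂∈) b d))
      -- Again `y = y₂`, so `y` in `A` has the non-hub neighbours `x₁` and `x₂`, while the image of
      -- `x₂` is a pool vertex with a hub neighbour.
      (λ σ′ ok x₁∈ x₂∈ x₁≢x₂ _ y₂∈ y∈ _ _ c d e f → x₁≢x₂
        (low-unique (A∈P y∈) (OB∉H x₁∈) (OB∉H x₂∈) (adj-comm e)
          (adj-comm (subst (λ z → adj G _ z ≡ true) (·-injective σ′
            (hub-unique (R∈P (Q∈R (proj₂ ok _ x₂∈))) (A→H₄ σ′ ok y₂∈) (A→H₄ σ′ ok y∈) d f)) c))
          (R∈P (Q∈R (proj₂ ok _ x₂∈))) (A→H₄ σ′ ok y₂∈) d))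
      ((λ _ _ → refl) , proj₁ (proj₂ third))
    σ₄ = proj₁ fourth
    σ₄-ok = proj₁ (proj₂ fourth)
    fewB₄ = proj₂ (proj₂ fourth)
    σ₄-H : ∀ u → u ∈ H → σ₄ · u ≡ σ · u
    σ₄-H u p = trans (proj₁ σ₄-ok u (H∉OB p)) (σ₃-H u p)
    σ₄-A : ∀ u → u ∈ A → σ₄ · u ≡ σ · u
    σ₄-A u p = trans (proj₁ σ₄-ok u (A∉OB p)) (σ₃-A u p)
    σ₄-OB : ∀ u → u ∈ OB → σ₄ · u ∈ Q
    σ₄-OB = proj₂ σ₄-ok

    -- This moves only `W` and whatever sits on `OA`. The images of `H`, `A` and `OB` lie in `A`,
    -- `H` and `Q`, all disjoint from `OA`, so the earlier placements stay.
    fifth = place σ₄ W OA (≤-reflexive SW.size≡)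
    σ₅ = proj₁ fifth
    module S₆ = Separate G W H OA (λ _ p → R∉H (W∈R p)) σ₅
    σ₅-H : ∀ u → u ∈ H → σ₅ · u ≡ σ · u
    σ₅-H u p = trans (proj₂ (proj₂ fifth) u (H∉W p) (≡⇒∉ OA (σ₄-H u p) (A∉OA (H→A u p)))) (σ₄-H u p)
    H→A₆ : ∀ σ′ → S₆.Allowed σ′ → ∀ {u} → u ∈ H → σ′ · u ∈ A
    H→A₆ σ′ (off , _) {u} p = subst (_∈ A) (≡.sym (trans (off u (H∉W p)) (σ₅-H u p))) (H→A u p)
    sixth = S₆.separate
      (λ σ′ ok x∈ y₁∈ y₂∈ a _ c _ → hub-unique (R∈P (W∈R x∈)) y₁∈ y₂∈ a c)
      -- The dual argument: `x₁` has a single hub neighbour, so `y = y₁`, and its image in `A` is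
      -- adjacent to the images of both `x₁` and `x₂`, which are non-hubs.
      (λ σ′ ok x₁∈ x₂∈ x₁≢x₂ y₁∈ _ y∈ a b _ _ e f → x₁≢x₂ (·-injective σ′
        (low-unique (A∈P (H→A₆ σ′ ok y₁∈)) (OA∉H (proj₂ ok _ x₁∈)) (OA∉H (proj₂ ok _ x₂∈))
          (adj-comm b)
          (adj-comm (subst (λ z → adj G _ (σ′ · z) ≡ true) (hub-unique (R∈P (W∈R x₁∈)) y∈ y₁∈ e a) f))
          (R∈P (W∈R x₁∈)) y₁∈ a)))
      ((λ _ _ → refl) , proj₁ (proj₂ fifth))
    τ = proj₁ sixth
    τ-ok = proj₁ (proj₂ sixth)
    τ≡σ₄ : ∀ u → u ∉ W → σ₄ · u ∉ OA → τ · u ≡ σ₄ · u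
    τ≡σ₄ u u∉W q = trans (proj₁ τ-ok u u∉W) (proj₂ (proj₂ fifth) u u∉W q)
    τ-OB : ∀ u → u ∈ OB → τ · u ≡ σ₄ · u
    τ-OB u p = τ≡σ₄ u (OB∉W p) (Q∉OA (σ₄-OB u p))

-- Placing the remaining vertices

sum-sum-mono : ∀ {m n} {f g : Fin m → Fin n → ℕ} → (∀ i j → f i j ≤ g i j) →
               sum (λ i → sum (f i)) ≤ sum (λ i → sum (g i))
sum-sum-mono le = sum-mono λ i → sum-mono (le i)

sum-sum-+ : ∀ {m n} (f g : Fin m → Fin n → ℕ) →
            sum (λ i → sum λ j → f i j + g i j) ≡ sum (λ i → sum (f i)) + sum (λ i → sum (g i))
sum-sum-+ f g = trans (sum-cong-≗ λ i → sum-+ (f i) (g i)) (sum-+ (λ i → sum (f i)) (λ i → sum (g i)))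

pairs : (Fin n → Fin n → Bool) → ℕ
pairs r = sum λ u → sum λ v → ⟦ does (u Fin.<? v) ∧ r u v ⟧

-- An unordered pair may be charged to either of its orders, and distinct unordered pairs use
-- distinct ordered ones.
pairs≤ : (r : Fin n → Fin n → Bool) (t : Fin n → Fin n → ℕ) →
         (∀ u v → r u v ≡ true → 0 < t u v + t v u) → pairs r ≤ sum λ u → sum (t u)
pairs≤ {n} r t cover = begin
  pairs r
    ≤⟨ sum-sum-mono pointwise ⟩
  sum (λ u → sum λ v → up u v * t u v + up u v * t v u)
    ≡⟨ sum-sum-+ (λ u v → up u v * t u v) (λ u v → up u v * t v u) ⟩
  sum (λ u → sum λ v → up u v * t u v) + sum (λ u → sum λ v → up u v * t v u)
    ≡⟨ cong (λ □ → sum (λ u → sum λ v → up u v * t u v) + □) (∑-comm (λ u v → up u v * t v u)) ⟩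
  sum (λ u → sum λ v → up u v * t u v) + sum (λ u → sum λ v → up v u * t u v)
    ≡⟨ sum-sum-+ (λ u v → up u v * t u v) (λ u v → up v u * t u v) ⟨
  sum (λ u → sum λ v → up u v * t u v + up v u * t u v)
    ≤⟨ sum-sum-mono (λ u v → once u v) ⟩
  sum (λ u → sum (t u)) ∎
  where
  open ≤-Reasoning
  up : Fin n → Fin n → ℕ
  up u v = ⟦ does (u Fin.<? v) ⟧
  split : ∀ b c {x y} → (c ≡ true → 0 < x + y) → ⟦ b ∧ c ⟧ ≤ ⟦ b ⟧ * x + ⟦ b ⟧ * y
  split false c     f = z≤n
  split true  false f = z≤n
  split true  true  {x} {y} f = ≤-trans (f refl)
    (≤-reflexive (≡.sym (cong₂ _+_ (+-identityʳ x) (+-identityʳ y))))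
  pointwise : ∀ u v → ⟦ does (u Fin.<? v) ∧ r u v ⟧ ≤ up u v * t u v + up u v * t v u
  pointwise u v = split (does (u Fin.<? v)) (r u v) (cover u v)
  exclusive : ∀ a b x → (a ≡ true → b ≡ false) → ⟦ a ⟧ * x + ⟦ b ⟧ * x ≤ x
  exclusive false b     x _ = ⟦⟧*≤ b
  exclusive true  false x _ = ≤-reflexive (trans (+-identityʳ _) (+-identityʳ x))
  exclusive true  true  x f = ∈∉-absurd refl (f refl)
  once : ∀ u v → up u v * t u v + up v u * t u v ≤ t u v
  once u v = exclusive (does (u Fin.<? v)) (does (v Fin.<? u)) (t u v) λ p →
    ≢true⇒false λ q → <-asym (<ᵇ-true {toℕ u} {toℕ v} p) (<ᵇ-true {toℕ v} {toℕ u} q)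

module Finish {n} {G : Graph n} (setup : Setup G)
              (hs : Build.Hubs setup) (ls : Build.Loads setup hs) where
  open Setup setup
  open Build setup
  open Hubs hs
  open WithHubs hs
  open Loads ls

  F : Subset n
  F u = H u ∨ (A u ∨ (OB u ∨ W u))

  data Kind (u : Fin n) : Set where
    hub    : u ∈ H → Kind u
    pool   : u ∈ A → Kind u
    heavyB : u ∈ OB → Kind u
    spare  : u ∈ W → Kind u

  kind : ∀ {u} → u ∈ F → Kind u
  kind {u} p with ∨-true {H u} p
  ... | inj₁ q = hub q
  ... | inj₂ q with ∨-true {A u} q
  ...   | inj₁ r = pool r
  ...   | inj₂ r with ∨-true {OB u} r
  ...     | inj₁ s = heavyB s
  ...     | inj₂ s = spare s

  kind⁻¹ : ∀ {u} → Kind u → u ∈ F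
  kind⁻¹ (hub p)        = ∨-trueˡ p
  kind⁻¹ {u} (pool p)   = ∨-trueʳ {H u} (∨-trueˡ p)
  kind⁻¹ {u} (heavyB p) = ∨-trueʳ {H u} (∨-trueʳ {A u} (∨-trueˡ p))
  kind⁻¹ {u} (spare p)  = ∨-trueʳ {H u} (∨-trueʳ {A u} (∨-trueʳ {OB u} p))

  outside : ∀ {S u} → (u ∈ S → Kind u) → u ∉ F → u ∉ S
  outside f u∉F = ≢true⇒false λ p → ∈∉-absurd (kind⁻¹ (f p)) u∉F

  module S = Spread G F τ

  module Agreeing (ρ : Permutation′ n) (agr : S.Agrees ρ) where

    ρ-H : ∀ {u} → u ∈ H → ρ · u ≡ σ · u
    ρ-H p = trans (agr _ (kind⁻¹ (hub p))) (τ-H _ p)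

    ρ-A : ∀ {u} → u ∈ A → ρ · u ≡ σ · u
    ρ-A p = trans (agr _ (kind⁻¹ (pool p))) (τ-A _ p)

    ρ-W : ∀ {u} → u ∈ W → ρ · u ≡ τ · u
    ρ-W p = agr _ (kind⁻¹ (spare p))

    ρ-OB : ∀ {u} → u ∈ OB → ρ · u ≡ τ · u
    ρ-OB p = agr _ (kind⁻¹ (heavyB p))

    ρ:H→A : ∀ {u} → u ∈ H → ρ · u ∈ A
    ρ:H→A p = subst (_∈ A) (≡.sym (ρ-H p)) (H→A _ p)

    ρ:A→H : ∀ {u} → u ∈ A → ρ · u ∈ H
    ρ:A→H p = subst (_∈ H) (≡.sym (ρ-A p)) (A→H _ p)

    ρ:OB→Q : ∀ {u} → u ∈ OB → ρ · u ∈ Q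
    ρ:OB→Q p = subst (_∈ Q) (≡.sym (ρ-OB p)) (OB→Q _ p)

    ρ:W→OA : ∀ {u} → u ∈ W → ρ · u ∈ OA
    ρ:W→OA p = subst (_∈ OA) (≡.sym (ρ-W p)) (W→OA _ p)

    H-onto : ∀ {u} → u ∉ A → ρ · u ∉ H
    H-onto u∉A = ≢true⇒false λ p →
      ∈∉-absurd (place-onto ρ {A} {H} (≤-reflexive (≡.sym size≡)) (λ _ → ρ:A→H) _ p) u∉A

    OA-onto : ∀ {u} → u ∉ W → ρ · u ∉ OA
    OA-onto u∉W = ≢true⇒false λ p →
      ∈∉-absurd (place-onto ρ {W} {OA} (≤-reflexive (≡.sym ∣W∣)) (λ _ → ρ:W→OA) _ p) u∉W

    ∣F∣ : ∣ F ∣ₛ ≤ 2 * ∣ H ∣ₛ + 2 * o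
    ∣F∣ = begin
      ∣ F ∣ₛ
        ≤⟨ ∣∨∣ H (λ u → A u ∨ (OB u ∨ W u)) ⟩
      ∣ H ∣ₛ + ∣ (λ u → A u ∨ (OB u ∨ W u)) ∣ₛ
        ≤⟨ +-monoʳ-≤ ∣ H ∣ₛ (≤-trans (∣∨∣ A (λ u → OB u ∨ W u)) (+-mono-≤ (≤-reflexive size≡)
             (≤-trans (∣∨∣ OB W) (+-mono-≤ ∣OB∣≤o (≤-trans (≤-reflexive ∣W∣) ∣OA∣≤o))))) ⟩
      ∣ H ∣ₛ + (∣ H ∣ₛ + (o + o))
        ≡⟨ double ∣ H ∣ₛ o ⟩
      2 * ∣ H ∣ₛ + 2 * o ∎
      where
      open ≤-Reasoning
      double : ∀ h o → h + (h + (o + o)) ≡ 2 * h + 2 * o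
      double = solve-∀

    light-or : ∀ b c {x y} → (b ≡ true → x ≤ y) → (b ≡ false → x ≤ D) →
               ⟦ c ⟧ * x ≤ ⟦ b ⟧ * (⟦ c ⟧ * y) + ⟦ c ⟧ * D
    light-or true  c f g = ≤-trans (⟦⟧*-mono c λ _ → f refl)
      (≤-trans (≤-reflexive (≡.sym (+-identityʳ _))) (m≤m+n _ _))
    light-or false c f g = ⟦⟧*-mono c λ _ → g refl

    not-heavy : ∀ {ℓ u} → u ∉ H → u ∉ heavy L ℓ cap → ℓ u ≤ cap
    not-heavy {ℓ} {u} u∉H p = <ᵇ-false (trans (≡.sym (cong (_∧ (cap <ᵇ ℓ u)) (∁-true H u∉H))) p)

    outer-swap : ∀ (f : Fin n → ℕ) (g : Fin n → Fin n → ℕ) →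
                 sum (λ w → sum λ u → f u * g u w) ≡ sum (λ u → f u * sum (g u))
    outer-swap f g = trans (∑-comm (λ w u → f u * g u w)) (sum-cong-≗ λ u → ≡.sym (*-sum (f u) (g u)))

    sum-obstacles : ∀ v → v ∉ F → sum (S.obstacles ρ v) < n
    sum-obstacles v v∉F = ≤-<-trans total room
      where
      open ≤-Reasoning
      v∉H = outside {H} hub v∉F
      ρv∉H = H-onto (outside {A} pool v∉F)
      first : Fin n → ℕ
      first w = sum λ u → ⟦ adj G v u ⟧ * (⟦ adj G (ρ · u) (ρ · w) ⟧ * ⟦ not (F w) ⟧)
      second : Fin n → ℕ
      second w = sum λ u → ⟦ adj G (ρ · v) (ρ · u) ⟧ * (⟦ adj G u w ⟧ * ⟦ not (F w) ⟧)
      -- For `w` outside `F` the image is no hub, so a neighbour `u` of `v` forbids at most as many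
      -- `w` as its image has non-hub neighbours. The `u` in `A`, whose images are hubs, forbid
      -- `loadB v` in total, at most `cap` because `v` is not heavy; each of the at most `D` others
      -- forbids at most `D`.
      first≤ : sum first ≤ cap + D * D
      first≤ = begin
        sum first
          ≡⟨ outer-swap (λ u → ⟦ adj G v u ⟧) (λ u w → ⟦ adj G (ρ · u) (ρ · w) ⟧ * ⟦ not (F w) ⟧) ⟩
        sum (λ u → ⟦ adj G v u ⟧ * sum (λ w → ⟦ adj G (ρ · u) (ρ · w) ⟧ * ⟦ not (F w) ⟧))
          ≤⟨ sum-mono (λ u → *-monoʳ-≤ ⟦ adj G v u ⟧ (≤-trans
               (sum-mono λ w → *-monoʳ-≤ ⟦ adj G (ρ · u) (ρ · w) ⟧ (⟦⟧-mono λ p →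
                 ∁-true H (H-onto (outside {A} pool (not-true p)))))
               (≤-reflexive (≡.sym (sum-permute (λ w → ⟦ adj G (ρ · u) w ⟧ * ⟦ L w ⟧) ρ))))) ⟩
        sum (λ u → ⟦ adj G v u ⟧ * nb G L (ρ · u))
          ≤⟨ sum-mono (λ u → light-or (A u) (adj G v u)
               (λ p → ≤-reflexive (cong (nb G L) (ρ-A p)))
               (λ p → ≤-trans (nb≤deg G L (ρ · u)) (light _ (H-onto p)))) ⟩
        sum (λ u → ⟦ A u ⟧ * (⟦ adj G v u ⟧ * nb G L (σ · u)) + ⟦ adj G v u ⟧ * D)
          ≡⟨ sum-+ (λ u → ⟦ A u ⟧ * (⟦ adj G v u ⟧ * nb G L (σ · u))) (λ u → ⟦ adj G v u ⟧ * D) ⟩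
        sum (λ u → ⟦ A u ⟧ * (⟦ adj G v u ⟧ * nb G L (σ · u))) + sum (λ u → ⟦ adj G v u ⟧ * D)
          ≡⟨ cong₂ _+_ (sum-cong-≗ λ u → cong (λ b → ⟦ A u ⟧ * (⟦ b ⟧ * nb G L (σ · u))) (Graph.sym G v u))
               (≡.sym (sum-* (λ u → ⟦ adj G v u ⟧) D)) ⟩
        loadB v + deg G v * D
          ≤⟨ +-mono-≤ (not-heavy {loadB} v∉H (outside {OB} heavyB v∉F)) (*-monoˡ-≤ D (light v v∉H)) ⟩
        cap + D * D ∎
      -- The same count for the inverse permutation, with the position of `v` in place of `v`: hubs
      -- `u` placed next to it contribute `loadA`, and the position is outside `OA` because `W` is
      -- its whole preimage.
      second≤ : sum second ≤ cap + D * D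
      second≤ = begin
        sum second
          ≡⟨ outer-swap (λ u → ⟦ adj G (ρ · v) (ρ · u) ⟧) (λ u w → ⟦ adj G u w ⟧ * ⟦ not (F w) ⟧) ⟩
        sum (λ u → ⟦ adj G (ρ · v) (ρ · u) ⟧ * sum (λ w → ⟦ adj G u w ⟧ * ⟦ not (F w) ⟧))
          ≤⟨ sum-mono (λ u → *-monoʳ-≤ ⟦ adj G (ρ · v) (ρ · u) ⟧
               (sum-mono λ w → *-monoʳ-≤ ⟦ adj G u w ⟧ (⟦⟧-mono λ p →
                 ∁-true H (outside {H} hub (not-true p))))) ⟩
        sum (λ u → ⟦ adj G (ρ · v) (ρ · u) ⟧ * nb G L u)
          ≤⟨ sum-mono (λ u → light-or (H u) (adj G (ρ · v) (ρ · u))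
               (λ _ → ≤-refl)
               (λ p → ≤-trans (nb≤deg G L u) (light _ p))) ⟩
        sum (λ u → ⟦ H u ⟧ * (⟦ adj G (ρ · v) (ρ · u) ⟧ * nb G L u) + ⟦ adj G (ρ · v) (ρ · u) ⟧ * D)
          ≡⟨ sum-+ (λ u → ⟦ H u ⟧ * (⟦ adj G (ρ · v) (ρ · u) ⟧ * nb G L u)) (λ u → ⟦ adj G (ρ · v) (ρ · u) ⟧ * D) ⟩
        sum (λ u → ⟦ H u ⟧ * (⟦ adj G (ρ · v) (ρ · u) ⟧ * nb G L u)) + sum (λ u → ⟦ adj G (ρ · v) (ρ · u) ⟧ * D)
          ≡⟨ cong₂ _+_ (sum-cong-≗ at-hub)
               (trans (≡.sym (sum-* (λ u → ⟦ adj G (ρ · v) (ρ · u) ⟧) D))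
                 (cong (_* D) (≡.sym (sum-permute (λ u → ⟦ adj G (ρ · v) u ⟧) ρ)))) ⟩
        loadA (ρ · v) + deg G (ρ · v) * D
          ≤⟨ +-mono-≤ (not-heavy {loadA} ρv∉H (OA-onto (outside {W} spare v∉F)))
               (*-monoˡ-≤ D (light (ρ · v) ρv∉H)) ⟩
        cap + D * D ∎
        where
        at-hub : ∀ u → ⟦ H u ⟧ * (⟦ adj G (ρ · v) (ρ · u) ⟧ * nb G L u) ≡
                       ⟦ H u ⟧ * (⟦ adj G (σ · u) (ρ · v) ⟧ * nb G L u)
        at-hub u with H u in eq
        ... | false = refl
        ... | true  = cong (λ b → 1 * (⟦ b ⟧ * nb G L u))
                        (trans (Graph.sym G (ρ · v) (ρ · u)) (cong (λ z → adj G z (ρ · v)) (ρ-H eq)))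
      total : sum (S.obstacles ρ v) ≤ 2 * ∣ H ∣ₛ + 2 * o + D + 2 * (D * D + cap)
      total = begin
        sum (S.obstacles ρ v)
          ≡⟨ trans (sum-+ (λ w → ⟦ F w ⟧ + ⟦ adj G v w ⟧) (λ w → first w + second w))
               (cong₂ _+_ (sum-+ (λ w → ⟦ F w ⟧) (λ w → ⟦ adj G v w ⟧)) (sum-+ first second)) ⟩
        (∣ F ∣ₛ + deg G v) + (sum first + sum second)
          ≤⟨ +-mono-≤ (+-mono-≤ ∣F∣ (light v v∉H)) (+-mono-≤ first≤ second≤) ⟩
        (2 * ∣ H ∣ₛ + 2 * o + D) + ((cap + D * D) + (cap + D * D))
          ≡⟨ shuffle (2 * ∣ H ∣ₛ + 2 * o + D) cap (D * D) ⟩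
        2 * ∣ H ∣ₛ + 2 * o + D + 2 * (D * D + cap) ∎
        where
        shuffle : ∀ x c d → x + ((c + d) + (c + d)) ≡ x + 2 * (d + c)
        shuffle = solve-∀

    Typed : Fin n → Fin n → Set
    Typed u v = (u ∈ H × v ∈ A) ⊎ ((u ∈ OB × v ∈ A) ⊎ (u ∈ W × v ∈ H))

    -- For every other combination of kinds, either the ends lie in sets with no edge between them,
    -- or their images do.
    classify : ∀ {u v} → Kind u → Kind v → adj G u v ≡ true → adj G (ρ · u) (ρ · v) ≡ true →
               Typed u v ⊎ Typed v u
    classify (hub p)    (hub q)    _ e = ∈∉-absurd e (independent _ _ (ρ:H→A p) (ρ:H→A q))
    classify (hub p)    (pool q)   _ _ = inj₁ (inj₁ (p , q))
    classify (hub p)    (heavyB q) _ e = ∈∉-absurd e (rest≁ _ _ (ρ:H→A p) (Q∈R (ρ:OB→Q q)))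
    classify (hub p)    (spare q)  _ _ = inj₂ (inj₂ (inj₂ (q , p)))
    classify (pool p)   (hub q)    _ _ = inj₂ (inj₁ (q , p))
    classify (pool p)   (pool q)   e _ = ∈∉-absurd e (independent _ _ p q)
    classify (pool p)   (heavyB q) _ _ = inj₂ (inj₂ (inj₁ (q , p)))
    classify (pool p)   (spare q)  e _ = ∈∉-absurd e (rest≁ _ _ p (W∈R q))
    classify (heavyB p) (hub q)    _ e = ∈∉-absurd (adj-comm e) (rest≁ _ _ (ρ:H→A q) (Q∈R (ρ:OB→Q p)))
    classify (heavyB p) (pool q)   _ _ = inj₁ (inj₂ (inj₁ (p , q)))
    classify (heavyB p) (heavyB q) _ e = ∈∉-absurd e (Q-ind _ _ (ρ:OB→Q p) (ρ:OB→Q q))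
    classify (heavyB p) (spare q)  _ e = ∈∉-absurd e (Q≁OA (ρ:OB→Q p) (ρ:W→OA q))
    classify (spare p)  (hub q)    _ _ = inj₁ (inj₂ (inj₂ (p , q)))
    classify (spare p)  (pool q)   e _ = ∈∉-absurd (adj-comm e) (rest≁ _ _ q (W∈R p))
    classify (spare p)  (heavyB q) _ e = ∈∉-absurd (adj-comm e) (Q≁OA (ρ:OB→Q q) (ρ:W→OA p))
    classify (spare p)  (spare q)  e _ = ∈∉-absurd e (W-ind _ _ p q)

    cell : Subset n → Subset n → Fin n → Fin n → ℕ
    cell X Y u v = ⟦ X u ∧ (Y v ∧ conflict G ρ u v) ⟧

    cells : Fin n → Fin n → ℕ
    cells u v = cell H A u v + (cell OB A u v + cell W H u v)

    typed-pos : ∀ {u v} → conflict G ρ u v ≡ true → Typed u v → 0 < cells u v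
    typed-pos {u} {v} c (inj₁ (p , q)) =
      ≤-trans (≤-reflexive (≡.sym (⟦true⟧ (∧-true⁻¹ p (∧-true⁻¹ q c))))) (m≤m+n (cell H A u v) _)
    typed-pos {u} {v} c (inj₂ (inj₁ (p , q))) =
      ≤-trans (≤-reflexive (≡.sym (⟦true⟧ (∧-true⁻¹ p (∧-true⁻¹ q c)))))
        (≤-trans (m≤m+n (cell OB A u v) _) (m≤n+m _ (cell H A u v)))
    typed-pos {u} {v} c (inj₂ (inj₂ (p , q))) =
      ≤-trans (≤-reflexive (≡.sym (⟦true⟧ (∧-true⁻¹ p (∧-true⁻¹ q c)))))
        (≤-trans (m≤n+m (cell W H u v) (cell OB A u v)) (m≤n+m _ (cell H A u v)))

    at-most-three : (∀ u v → conflict G ρ u v ≡ true → u ∈ F) → pairs (conflict G ρ) ≤ 3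
    at-most-three inside = begin
      pairs (conflict G ρ)
        ≤⟨ pairs≤ (conflict G ρ) cells cover ⟩
      sum (λ u → sum (cells u))
        ≡⟨ trans (sum-sum-+ (cell H A) (λ u v → cell OB A u v + cell W H u v))
             (cong (λ □ → between G ρ H A + □) (sum-sum-+ (cell OB A) (cell W H))) ⟩
      between G ρ H A + (between G ρ OB A + between G ρ W H)
        ≤⟨ +-mono-≤ (≤-trans (between-cong ρ σ H A (λ _ → ρ-H) (λ _ → ρ-A)) few)
             (+-mono-≤ (≤-trans (between-cong ρ τ OB A (λ _ → ρ-OB) (λ _ p → agr _ (kind⁻¹ (pool p)))) fewB)
                       (≤-trans (between-cong ρ τ W H (λ _ → ρ-W) (λ _ p → agr _ (kind⁻¹ (hub p)))) fewW)) ⟩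
      3 ∎
      where
      open ≤-Reasoning
      cover : ∀ u v → conflict G ρ u v ≡ true → 0 < cells u v + cells v u
      cover u v c with ∧-true {adj G u v} c
      ... | e , e′ with classify (kind (inside u v c)) (kind (inside v u (trans (conflict-sym G ρ v u) c))) e e′
      ...   | inj₁ t = ≤-trans (typed-pos c t) (m≤m+n _ _)
      ...   | inj₂ t = ≤-trans (typed-pos (trans (conflict-sym G ρ v u) c) t) (m≤n+m _ (cells u v))

  finish : ∃[ ρ ] pairs (conflict G ρ) ≤ 3
  finish with S.spread (λ ρ agr → Agreeing.sum-obstacles ρ agr)
  ... | ρ , agr , inside = ρ , Agreeing.at-most-three ρ agr inside

abstract

  few-conflicts : {G : Graph n} → Setup G → ∃[ ρ ] pairs (conflict G ρ) ≤ 3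
  few-conflicts setup = Finish.finish setup (Build.hubs setup) (Build.loads setup (Build.hubs setup))

-- Arithmetic of the parameters

module _ where

  open ≤-Reasoning

  square-mono : ∀ {a b} → a ≤ b → a * a ≤ b * b
  square-mono le = *-mono-≤ le le

  square-root : ∀ q → ∃[ m ] 5 * (m * m) ≤ q × q < 5 * (suc m * suc m)
  square-root zero = 0 , z≤n , s≤s z≤n
  square-root (suc q) with square-root q
  ... | m , lo , hi with suc q <? 5 * (suc m * suc m)
  ...   | yes lt = m , m≤n⇒m≤1+n lo , lt
  ...   | no ¬lt = suc m , ≮⇒≥ ¬lt , ≤-<-trans hi (*-monoʳ-< 5 (*-mono-< (n<1+n (suc m)) (n<1+n (suc m))))

  -- With M = 6 + d, for large M the surplus comes from n ≥ q / 2, for small M from n ≤ q (M + 2) / 14.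
  room-core : ∀ d n q → q ≤ 2 * n → 5 * ((7 + d) * (7 + d)) ≤ q → 14 * n ≤ q * (8 + d) →
              (2 * (6 + d) + 10) * (2 * n) + 5 * (6 + d) * (29 + (5 + d) + 2 * ((5 + d) * (5 + d))) ≤
              5 * (6 + d) * n + (2 * (6 + d) + 10) * (q + 7)
  -- The coefficient of `n` is 4 M + 20 on the left and 5 M on the right. So M = 20, that is d = 14,
  -- separates a surplus of n's from a shortage.
  room-core d n q q≤2n lower linear with ≤-total 14 d
  ... | inj₁ 14≤d = large (proj₁ (m≤n⇒∃[o]m+o≡n 14≤d)) (proj₂ (m≤n⇒∃[o]m+o≡n 14≤d))
    where
    large : ∀ j → 14 + j ≡ d →
            (2 * (6 + d) + 10) * (2 * n) + 5 * (6 + d) * (29 + (5 + d) + 2 * ((5 + d) * (5 + d))) ≤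
            5 * (6 + d) * n + (2 * (6 + d) + 10) * (q + 7)
    large j refl = *-cancelˡ-≤ 2 (begin
      2 * ((2 * (20 + j) + 10) * (2 * n) + 5 * (20 + j) * (29 + (19 + j) + 2 * ((19 + j) * (19 + j))))
        ≡⟨ large₁ j n ⟩
      2 * ((4 * (20 + j) + 20) * n) + 10 * (20 + j) * (29 + (19 + j) + 2 * ((19 + j) * (19 + j)))
        ≤⟨ +-monoʳ-≤ (2 * ((4 * (20 + j) + 20) * n)) (≤-trans (m≤m+n _ (5 * j * j * j + 380 * j * j + 8925 * j + 66500)) (≤-reflexive (large₂ j))) ⟩
      2 * ((4 * (20 + j) + 20) * n) + 5 * (20 + j) * (5 * ((21 + j) * (21 + j)))
        ≤⟨ +-monoʳ-≤ (2 * ((4 * (20 + j) + 20) * n)) (*-monoʳ-≤ (5 * (20 + j)) lower) ⟩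
      2 * ((4 * (20 + j) + 20) * n) + 5 * (20 + j) * q
        ≡⟨ large₃ j n q ⟩
      2 * ((4 * (20 + j) + 20) * n) + (j * q + 2 * (2 * (20 + j) + 10) * q)
        ≤⟨ +-monoʳ-≤ (2 * ((4 * (20 + j) + 20) * n)) (+-mono-≤ (*-monoʳ-≤ j q≤2n) (*-monoʳ-≤ (2 * (2 * (20 + j) + 10)) (m≤m+n q 7))) ⟩
      2 * ((4 * (20 + j) + 20) * n) + (j * (2 * n) + 2 * (2 * (20 + j) + 10) * (q + 7))
        ≡⟨ large₄ j n q ⟩
      2 * (5 * (20 + j) * n + (2 * (20 + j) + 10) * (q + 7)) ∎)
      where
      large₁ : ∀ j n → 2 * ((2 * (20 + j) + 10) * (2 * n) + 5 * (20 + j) * (29 + (19 + j) + 2 * ((19 + j) * (19 + j)))) ≡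
               2 * ((4 * (20 + j) + 20) * n) + 10 * (20 + j) * (29 + (19 + j) + 2 * ((19 + j) * (19 + j)))
      large₁ = solve-∀
      large₂ : ∀ j → 10 * (20 + j) * (29 + (19 + j) + 2 * ((19 + j) * (19 + j))) + (5 * j * j * j + 380 * j * j + 8925 * j + 66500) ≡
               5 * (20 + j) * (5 * ((21 + j) * (21 + j)))
      large₂ = solve-∀
      large₃ : ∀ j n q → 2 * ((4 * (20 + j) + 20) * n) + 5 * (20 + j) * q ≡
               2 * ((4 * (20 + j) + 20) * n) + (j * q + 2 * (2 * (20 + j) + 10) * q)
      large₃ = solve-∀
      large₄ : ∀ j n q → 2 * ((4 * (20 + j) + 20) * n) + (j * (2 * n) + 2 * (2 * (20 + j) + 10) * (q + 7)) ≡
               2 * (5 * (20 + j) * n + (2 * (20 + j) + 10) * (q + 7))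
      large₄ = solve-∀
  ... | inj₂ d≤14 = small (proj₁ (m≤n⇒∃[o]m+o≡n d≤14)) (proj₂ (m≤n⇒∃[o]m+o≡n d≤14))
    where
    M poly : ℕ
    M = 6 + d
    poly = 5 * M * (29 + (5 + d) + 2 * ((5 + d) * (5 + d)))
    small : ∀ j → d + j ≡ 14 → (2 * M + 10) * (2 * n) + poly ≤ 5 * M * n + (2 * M + 10) * (q + 7)
    small j eq = *-cancelˡ-≤ 14 (begin
      14 * ((2 * M + 10) * (2 * n) + poly)
        ≡⟨ small₁ d n poly ⟩
      14 * (4 * M * n) + 20 * (14 * n) + 14 * poly
        ≡⟨ cong (λ z → 14 * (4 * M * n) + (6 + z) * (14 * n) + 14 * poly) (≡.sym eq) ⟩
      14 * (4 * M * n) + (6 + (d + j)) * (14 * n) + 14 * poly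
        ≡⟨ small₂ d j n (14 * poly) ⟩
      14 * (5 * M * n) + (j * (14 * n) + 14 * poly)
        ≤⟨ +-monoʳ-≤ (14 * (5 * M * n)) (+-mono-≤ (*-monoʳ-≤ j linear) bounded) ⟩
      14 * (5 * M * n) + (j * (q * (8 + d)) + (28 * M + 19) * q)
        ≤⟨ +-monoʳ-≤ (14 * (5 * M * n)) (≤-trans (≤-reflexive (small₃ j q d)) (*-monoʳ-≤ q product)) ⟩
      14 * (5 * M * n) + q * (14 * (2 * M + 10))
        ≤⟨ +-monoʳ-≤ (14 * (5 * M * n)) (*-monoˡ-≤ (14 * (2 * M + 10)) (m≤m+n q 7)) ⟩
      14 * (5 * M * n) + (q + 7) * (14 * (2 * M + 10))
        ≡⟨ small₄ d n (q + 7) ⟩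
      14 * (5 * M * n + (2 * M + 10) * (q + 7)) ∎)
      where
      small₁ : ∀ d n p → 14 * ((2 * (6 + d) + 10) * (2 * n) + p) ≡ 14 * (4 * (6 + d) * n) + 20 * (14 * n) + 14 * p
      small₁ = solve-∀
      small₂ : ∀ d j n p → 14 * (4 * (6 + d) * n) + (6 + (d + j)) * (14 * n) + p ≡ 14 * (5 * (6 + d) * n) + (j * (14 * n) + p)
      small₂ = solve-∀
      small₃ : ∀ j q d → j * (q * (8 + d)) + (28 * (6 + d) + 19) * q ≡ q * (j * (8 + d) + (28 * (6 + d) + 19))
      small₃ = solve-∀
      small₄ : ∀ d n x → 14 * (5 * (6 + d) * n) + x * (14 * (2 * (6 + d) + 10)) ≡ 14 * (5 * (6 + d) * n + (2 * (6 + d) + 10) * x)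
      small₄ = solve-∀
      bounded : 14 * poly ≤ (28 * M + 19) * q
      bounded = ≤-trans (≤-trans (m≤m+n _ (585 * d * d + 5250 * d + 10535)) (≤-reflexive (identity d)))
        (*-monoʳ-≤ (28 * M + 19) lower)
        where
        identity : ∀ d → 14 * (5 * (6 + d) * (29 + (5 + d) + 2 * ((5 + d) * (5 + d)))) + (585 * d * d + 5250 * d + 10535) ≡
                   (28 * (6 + d) + 19) * (5 * ((7 + d) * (7 + d)))
        identity = solve-∀
      product : j * (8 + d) + (28 * M + 19) ≤ 14 * (2 * M + 10)
      product = ≤-trans (+-monoˡ-≤ (28 * M + 19) j[8+d]≤121) (≤-reflexive (numeral d))
        where
        numeral : ∀ d → 121 + (28 * (6 + d) + 19) ≡ 14 * (2 * (6 + d) + 10)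
        numeral = solve-∀
        -- The factors add up to 22, so their product is at most 11 * 11. With the 19 set aside in
        -- `bounded` this makes exactly the 14 * 10 available.
        j[8+d]≤121 : j * (8 + d) ≤ 121
        j[8+d]≤121 = amgm j (8 + d) (trans (rot j d) (cong (λ □ → 8 + □) eq))
          where
          rot : ∀ j d → j + (8 + d) ≡ 8 + (d + j)
          rot = solve-∀
          amgm : ∀ a b → a + b ≡ 22 → a * b ≤ 121
          amgm a b ab = *-cancelˡ-≤ 4 (≤-trans (four a b) (≤-reflexive (cong (λ z → z * z) ab)))
            where
            split-sq : ∀ x y → 4 * (x * (x + y)) + y * y ≡ (x + (x + y)) * (x + (x + y))
            split-sq = solve-∀
            four : ∀ a b → 4 * (a * b) ≤ (a + b) * (a + b)
            four a b with ≤-total a b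
            ... | inj₁ le with m≤n⇒∃[o]m+o≡n le
            ...   | y , refl = ≤-trans (m≤m+n _ (y * y)) (≤-reflexive (split-sq a y))
            four a b | inj₂ ge with m≤n⇒∃[o]m+o≡n ge
            ...   | y , refl = ≤-trans (m≤m+n _ (y * y)) (≤-reflexive (flipped b y))
              where
              flipped : ∀ b y → 4 * ((b + y) * b) + y * y ≡ (b + y + b) * (b + y + b)
              flipped = solve-∀

  module Numbers (n e q : ℕ) (total : e + q + 7 ≡ 2 * n) (cubic : 1000 * (n * n) ≤ q * q * q) where

    q≤2n : q ≤ 2 * n
    q≤2n = ≤-trans (≤-trans (m≤n+m q e) (m≤m+n (e + q) 7)) (≤-reflexive total)

    q>0 : 0 < q
    q>0 = n≢0⇒n>0 λ q≡0 → absurd n total (subst (λ z → 1000 * (n * n) ≤ z * z * z) q≡0 cubic)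
      where
      absurd : ∀ n → e + q + 7 ≡ 2 * n → 1000 * (n * n) ≤ 0 → ⊥
      absurd zero    t _ = contradiction (≤-trans (m≤n+m 7 (e + q)) (≤-reflexive t)) λ ()
      absurd (suc n) _ ()

    -- From q ≤ 2 n the hypothesis q³ ≥ 1000 n² gives q³ ≥ 250 q². As 250 exceeds 5 * 7 * 7, the hub
    -- threshold cannot be too small.
    q≥250 : 250 ≤ q
    q≥250 = *-cancelʳ-≤ 250 q (q * q) {{>-nonZero (*-mono-≤ q>0 q>0)}} (begin
      250 * (q * q)             ≤⟨ *-monoʳ-≤ 250 (square-mono q≤2n) ⟩
      250 * ((2 * n) * (2 * n)) ≡⟨ four n ⟩
      1000 * (n * n)            ≤⟨ cubic ⟩
      q * q * q                 ≡⟨ *-assoc q q q ⟩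
      q * (q * q)               ∎)
      where
      four : ∀ n → 250 * ((2 * n) * (2 * n)) ≡ 1000 * (n * n)
      four = solve-∀

    -- Hubs have degree at least m - 1.
    m : ℕ
    m = proj₁ (square-root q)

    5m²≤q : 5 * (m * m) ≤ q
    5m²≤q = proj₁ (proj₂ (square-root q))

    q<5[1+m]² : q < 5 * (suc m * suc m)
    q<5[1+m]² = proj₂ (proj₂ (square-root q))

    7≤m : 7 ≤ m
    7≤m = ≮⇒≥ λ m<7 → <⇒≱ (<-≤-trans q<5[1+m]² (*-monoʳ-≤ 5 (square-mono m<7))) (≤-trans (m≤m+n 245 5) q≥250)

    -- Replacing one factor q of q³ by 5 (m + 1)² makes the cubic hypothesis a comparison of
    -- squares; 14 is the largest integer whose square times 5, namely 980, stays below 1000.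
    14n≤q[1+m] : 14 * n ≤ q * suc m
    14n≤q[1+m] = ≮⇒≥ λ lt → <⇒≱ (begin-strict
      5 * ((q * suc m) * (q * suc m)) <⟨ *-monoʳ-< 5 (*-mono-< lt lt) ⟩
      5 * ((14 * n) * (14 * n))       ≡⟨ expand n ⟩
      980 * (n * n)                   ≤⟨ *-monoˡ-≤ (n * n) (m≤m+n 980 20) ⟩
      1000 * (n * n)                  ≤⟨ cubic ⟩
      q * q * q                       ≤⟨ *-monoʳ-≤ (q * q) (<⇒≤ q<5[1+m]²) ⟩
      q * q * (5 * (suc m * suc m))   ≡⟨ regroup q (suc m) ⟩
      5 * ((q * suc m) * (q * suc m)) ∎) ≤-refl
      where
      expand : ∀ n → 5 * ((14 * n) * (14 * n)) ≡ 980 * (n * n)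
      expand = solve-∀
      regroup : ∀ q m → q * q * (5 * (m * m)) ≡ 5 * ((q * m) * (q * m))
      regroup = solve-∀

    -- Writing m = 7 + d removes all subtractions: `D` is m - 2 and `M = suc D`, the least degree of
    -- a hub, is m - 1.
    d : ℕ
    d = proj₁ (m≤n⇒∃[o]m+o≡n 7≤m)

    7+d≡m : 7 + d ≡ m
    7+d≡m = proj₂ (m≤n⇒∃[o]m+o≡n 7≤m)

    D M : ℕ
    D = 5 + d
    M = 6 + d

    lower : 5 * ((7 + d) * (7 + d)) ≤ q
    lower = subst (λ z → 5 * (z * z) ≤ q) (≡.sym 7+d≡m) 5m²≤q

    linear : 14 * n ≤ q * (8 + d)
    linear = subst (λ z → 14 * n ≤ q * suc z) (≡.sym 7+d≡m) 14n≤q[1+m]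

    module _ (h f EE : ℕ) (hubs : M * h ≤ f + EE) (ends : 2 * f + EE ≤ 2 * e) where

      -- After multiplication by `M` the hubs cost 12 (f + EE), which is 6 (2 f + EE) + 6 EE. The
      -- first part is bounded by the number of edges and the second is absorbed by `M * EE`, as `M`
      -- is at least 6.
      rich : 2 * e + 12 * h + (46 * D + 92) ≤ 4 * n + EE
      rich = *-cancelˡ-≤ M (+-cancelʳ-≤ (12 * q + 84) _ _ (begin
        M * (2 * e + 12 * h + (46 * D + 92)) + (12 * q + 84)
          ≡⟨ step₁ d e h q ⟩
        12 * (M * h) + (2 * M * e + 46 * M * (7 + d) + (12 * q + 84))
          ≤⟨ +-monoˡ-≤ _ (*-monoʳ-≤ 12 hubs) ⟩
        12 * (f + EE) + (2 * M * e + 46 * M * (7 + d) + (12 * q + 84))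
          ≡⟨ step₂ f EE d e q ⟩
        6 * (2 * f + EE) + 6 * EE + (2 * M * e + 46 * M * (7 + d) + (12 * q + 84))
          ≤⟨ +-monoˡ-≤ _ (+-mono-≤ (*-monoʳ-≤ 6 ends) (*-monoˡ-≤ EE (m≤m+n 6 d))) ⟩
        6 * (2 * e) + M * EE + (2 * M * e + 46 * M * (7 + d) + (12 * q + 84))
          ≡⟨ step₃ e EE d q ⟩
        12 * (e + q + 7) + 46 * M * (7 + d) + (2 * M * e + M * EE)
          ≡⟨ cong (λ z → 12 * z + 46 * M * (7 + d) + (2 * M * e + M * EE)) total ⟩
        12 * (2 * n) + 46 * M * (7 + d) + (2 * M * e + M * EE)
          ≤⟨ +-monoˡ-≤ (2 * M * e + M * EE) core ⟩
        2 * M * q + 14 * M + (12 * q + 84) + (2 * M * e + M * EE)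
          ≡⟨ step₄ d q e EE ⟩
        2 * M * (e + q + 7) + (M * EE + (12 * q + 84))
          ≡⟨ cong (λ z → 2 * M * z + (M * EE + (12 * q + 84))) total ⟩
        2 * M * (2 * n) + (M * EE + (12 * q + 84))
          ≡⟨ step₅ d n EE q ⟩
        M * (4 * n + EE) + (12 * q + 84) ∎))
        where
        step₁ : ∀ d e h q → (6 + d) * (2 * e + 12 * h + (46 * (5 + d) + 92)) + (12 * q + 84) ≡
                12 * ((6 + d) * h) + (2 * (6 + d) * e + 46 * (6 + d) * (7 + d) + (12 * q + 84))
        step₁ = solve-∀
        step₂ : ∀ f EE d e q → 12 * (f + EE) + (2 * (6 + d) * e + 46 * (6 + d) * (7 + d) + (12 * q + 84)) ≡
                6 * (2 * f + EE) + 6 * EE + (2 * (6 + d) * e + 46 * (6 + d) * (7 + d) + (12 * q + 84))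
        step₂ = solve-∀
        step₃ : ∀ e EE d q → 6 * (2 * e) + (6 + d) * EE + (2 * (6 + d) * e + 46 * (6 + d) * (7 + d) + (12 * q + 84)) ≡
                12 * (e + q + 7) + 46 * (6 + d) * (7 + d) + (2 * (6 + d) * e + (6 + d) * EE)
        step₃ = solve-∀
        step₄ : ∀ d q e EE → 2 * (6 + d) * q + 14 * (6 + d) + (12 * q + 84) + (2 * (6 + d) * e + (6 + d) * EE) ≡
                2 * (6 + d) * (e + q + 7) + ((6 + d) * EE + (12 * q + 84))
        step₄ = solve-∀
        step₅ : ∀ d n EE q → 2 * (6 + d) * (2 * n) + ((6 + d) * EE + (12 * q + 84)) ≡
                (6 + d) * (4 * n + EE) + (12 * q + 84)
        step₅ = solve-∀
        -- The bound for 28 n overshoots the target by 2 q; adding 4 n on both sides lets q ≤ 2 n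
        -- pay for it.
        core : 12 * (2 * n) + 46 * M * (7 + d) ≤ 2 * M * q + 14 * M + (12 * q + 84)
        core = +-cancelʳ-≤ (2 * (2 * n)) _ _ (begin
          12 * (2 * n) + 46 * M * (7 + d) + 2 * (2 * n)
            ≡⟨ core₁ n (46 * M * (7 + d)) ⟩
          2 * (14 * n) + 46 * M * (7 + d)
            ≤⟨ +-mono-≤ (*-monoʳ-≤ 2 linear) (≤-trans (m≤m+n _ (4 * (7 + d) * (7 + d) + 46 * (7 + d))) (≤-reflexive (core₂ d))) ⟩
          2 * (q * (8 + d)) + 10 * (5 * ((7 + d) * (7 + d)))
            ≤⟨ +-monoʳ-≤ (2 * (q * (8 + d))) (*-monoʳ-≤ 10 lower) ⟩
          2 * (q * (8 + d)) + 10 * q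
            ≡⟨ core₃ q d ⟩
          (2 * M * q + 12 * q) + 2 * q
            ≤⟨ +-mono-≤ (≤-trans (m≤m+n (2 * M * q + 12 * q) (14 * M + 84)) (≤-reflexive (core₄ (2 * M * q) (12 * q) (14 * M))))
                 (*-monoʳ-≤ 2 q≤2n) ⟩
          2 * M * q + 14 * M + (12 * q + 84) + 2 * (2 * n) ∎)
          where
          core₁ : ∀ n x → 12 * (2 * n) + x + 2 * (2 * n) ≡ 2 * (14 * n) + x
          core₁ = solve-∀
          core₂ : ∀ d → 46 * (6 + d) * (7 + d) + (4 * (7 + d) * (7 + d) + 46 * (7 + d)) ≡ 10 * (5 * ((7 + d) * (7 + d)))
          core₂ = solve-∀
          core₃ : ∀ q d → 2 * (q * (8 + d)) + 10 * q ≡ (2 * (6 + d) * q + 12 * q) + 2 * q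
          core₃ = solve-∀
          core₄ : ∀ a b c → a + b + (c + 84) ≡ a + c + (b + 84)
          core₄ = solve-∀

      -- The two bounds are added with weights 10 and 2 M, chosen so that the sum fits under M + 5
      -- times 2 f + EE, hence under a multiple of the number of edges.
      room : ∀ c → 5 * c ≤ f → 2 * h + 28 + D + 2 * (D * D + c) < n
      room c 5c≤f = *-cancelˡ-≤ (5 * M) (+-cancelʳ-≤ ((2 * M + 10) * (q + 7)) _ _ (begin
        5 * M * suc (2 * h + 28 + D + 2 * (D * D + c)) + (2 * M + 10) * (q + 7)
          ≡⟨ step₁ d h c q ⟩
        10 * (M * h) + 2 * M * (5 * c) + (poly + (2 * M + 10) * (q + 7))
          ≤⟨ +-monoˡ-≤ _ (+-mono-≤ (*-monoʳ-≤ 10 hubs) (*-monoʳ-≤ (2 * M) 5c≤f)) ⟩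
        10 * (f + EE) + 2 * M * f + (poly + (2 * M + 10) * (q + 7))
          ≤⟨ +-monoˡ-≤ _ (≤-trans (m≤m+n _ ((1 + d) * EE)) (≤-reflexive (step₂ f EE d))) ⟩
        (M + 5) * (2 * f + EE) + (poly + (2 * M + 10) * (q + 7))
          ≤⟨ +-monoˡ-≤ _ (*-monoʳ-≤ (M + 5) ends) ⟩
        (M + 5) * (2 * e) + (poly + (2 * M + 10) * (q + 7))
          ≡⟨ step₃ d e q poly ⟩
        (2 * M + 10) * (e + q + 7) + poly
          ≡⟨ cong (λ z → (2 * M + 10) * z + poly) total ⟩
        (2 * M + 10) * (2 * n) + poly
          ≤⟨ core ⟩
        5 * M * n + (2 * M + 10) * (q + 7) ∎))
        where
        poly : ℕ
        poly = 5 * M * (29 + D + 2 * (D * D))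
        step₁ : ∀ d h c q → 5 * (6 + d) * suc (2 * h + 28 + (5 + d) + 2 * ((5 + d) * (5 + d) + c)) + (2 * (6 + d) + 10) * (q + 7) ≡
                10 * ((6 + d) * h) + 2 * (6 + d) * (5 * c) + (5 * (6 + d) * (29 + (5 + d) + 2 * ((5 + d) * (5 + d))) + (2 * (6 + d) + 10) * (q + 7))
        step₁ = solve-∀
        step₂ : ∀ f EE d → 10 * (f + EE) + 2 * (6 + d) * f + (1 + d) * EE ≡ ((6 + d) + 5) * (2 * f + EE)
        step₂ = solve-∀
        step₃ : ∀ d e q p → ((6 + d) + 5) * (2 * e) + (p + (2 * (6 + d) + 10) * (q + 7)) ≡
                (2 * (6 + d) + 10) * (e + q + 7) + p
        step₃ = solve-∀
        core : (2 * M + 10) * (2 * n) + poly ≤ 5 * M * n + (2 * M + 10) * (q + 7)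
        core = room-core d n q q≤2n lower linear

-- Finding the pool

sum-sum-cong : ∀ {m n} {f g : Fin m → Fin n → ℕ} → (∀ i j → f i j ≡ g i j) →
               sum (λ i → sum (f i)) ≡ sum (λ i → sum (g i))
sum-sum-cong eq = sum-cong-≗ λ i → sum-cong-≗ (eq i)

handshake : (r : Fin n → Fin n → Bool) → (∀ u v → r u v ≡ r v u) → (∀ v → r v v ≡ false) →
            sum (λ u → sum λ v → ⟦ r u v ⟧) ≡ 2 * pairs r
handshake {n} r symm irr = begin
  sum (λ u → sum λ v → ⟦ r u v ⟧)
    ≡⟨ sum-sum-cong split ⟩
  sum (λ u → sum λ v → up u v + up v u)
    ≡⟨ sum-sum-+ up (λ u v → up v u) ⟩
  pairs r + sum (λ u → sum λ v → up v u)
    ≡⟨ cong (λ □ → pairs r + □) (∑-comm (λ u v → up v u)) ⟩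
  pairs r + pairs r
    ≡⟨ cong (λ □ → pairs r + □) (≡.sym (+-identityʳ (pairs r))) ⟩
  2 * pairs r ∎
  where
  open ≡.≡-Reasoning
  up : Fin n → Fin n → ℕ
  up u v = ⟦ does (u Fin.<? v) ∧ r u v ⟧
  split : ∀ u v → ⟦ r u v ⟧ ≡ up u v + up v u
  split u v rewrite symm v u with Fin.<-cmp u v
  ... | tri< p _ ¬q rewrite <ᵇ-true⁻¹ p | ≢true⇒false (¬q ∘ <ᵇ-true {toℕ v} {toℕ u}) = ≡.sym (+-identityʳ _)
  ... | tri> ¬p _ q rewrite <ᵇ-true⁻¹ q | ≢true⇒false (¬p ∘ <ᵇ-true {toℕ u} {toℕ v}) = refl
  ... | tri≈ _ refl _ rewrite irr u with does (u Fin.<? u)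
  ...   | true  = refl
  ...   | false = refl

weight-split : (S : Subset n) (g : Fin n → ℕ) → sum g ≡ weight g S + weight g (∁ S)
weight-split S g = trans (sum-cong-≗ λ v → split (S v) (g v)) (sum-+ (λ v → ⟦ S v ⟧ * g v) (λ v → ⟦ ∁ S v ⟧ * g v))
  where
  split : ∀ b x → x ≡ ⟦ b ⟧ * x + ⟦ not b ⟧ * x
  split true  x = ≡.sym (trans (+-identityʳ _) (+-identityʳ x))
  split false x = ≡.sym (+-identityʳ x)

weight-+ : (S : Subset n) (f g : Fin n → ℕ) → weight (λ v → f v + g v) S ≡ weight f S + weight g S
weight-+ S f g = trans (sum-cong-≗ λ v → *-distribˡ-+ ⟦ S v ⟧ (f v) (g v))
                   (sum-+ (λ v → ⟦ S v ⟧ * f v) (λ v → ⟦ S v ⟧ * g v))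

weight-const : (S : Subset n) (c : ℕ) → weight (λ _ → c) S ≡ ∣ S ∣ₛ * c
weight-const S c = ≡.sym (sum-* (λ v → ⟦ S v ⟧) c)

weight-mono : (S : Subset n) {f g : Fin n → ℕ} → (∀ v → v ∈ S → f v ≤ g v) → weight f S ≤ weight g S
weight-mono S le = sum-mono λ v → ⟦⟧*-mono (S v) (le v)

module _ {n} (G : Graph n) where

  deg-split : ∀ S v → deg G v ≡ nb G S v + nb G (∁ S) v
  deg-split S v = trans (sum-cong-≗ λ u → split ⟦ adj G v u ⟧ (S u))
    (sum-+ (λ u → ⟦ adj G v u ⟧ * ⟦ S u ⟧) (λ u → ⟦ adj G v u ⟧ * ⟦ ∁ S u ⟧))
    where
    split : ∀ a b → a ≡ a * ⟦ b ⟧ + a * ⟦ not b ⟧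
    split a true  = ≡.sym (trans (cong₂ _+_ (*-identityʳ a) (*-zeroʳ a)) (+-identityʳ a))
    split a false = ≡.sym (cong₂ _+_ (*-zeroʳ a) (*-identityʳ a))

  nb-swap : ∀ S T → weight (nb G S) T ≡ weight (nb G T) S
  nb-swap S T = begin
    sum (λ v → ⟦ T v ⟧ * nb G S v)
      ≡⟨ sum-cong-≗ (λ v → *-sum ⟦ T v ⟧ (λ u → ⟦ adj G v u ⟧ * ⟦ S u ⟧)) ⟩
    sum (λ v → sum λ u → ⟦ T v ⟧ * (⟦ adj G v u ⟧ * ⟦ S u ⟧))
      ≡⟨ ∑-comm (λ v u → ⟦ T v ⟧ * (⟦ adj G v u ⟧ * ⟦ S u ⟧)) ⟩
    sum (λ u → sum λ v → ⟦ T v ⟧ * (⟦ adj G v u ⟧ * ⟦ S u ⟧))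
      ≡⟨ sum-sum-cong (λ u v → trans (cong (λ b → ⟦ T v ⟧ * (⟦ b ⟧ * ⟦ S u ⟧)) (Graph.sym G v u))
           (reverse ⟦ T v ⟧ ⟦ adj G u v ⟧ ⟦ S u ⟧)) ⟩
    sum (λ u → sum λ v → ⟦ S u ⟧ * (⟦ adj G u v ⟧ * ⟦ T v ⟧))
      ≡⟨ sum-cong-≗ (λ u → ≡.sym (*-sum ⟦ S u ⟧ (λ v → ⟦ adj G u v ⟧ * ⟦ T v ⟧))) ⟩
    sum (λ u → ⟦ S u ⟧ * nb G T u) ∎
    where
    open ≡.≡-Reasoning
    reverse : ∀ a b c → a * (b * c) ≡ c * (b * a)
    reverse = solve-∀

  module Choose (D : ℕ) where

    H L : Subset n
    H v = D <ᵇ deg G v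
    L = ∁ H

    -- w is twice the deficit 2 - (hub + low / 2), or 0 if that is negative.
    hub low w : Fin n → ℕ
    hub = nb G H
    low = nb G L
    w v = 4 ∸ (2 * hub v + low v)

    P : ℕ → Subset n
    P c v = L v ∧ ((hub v ≡ᵇ c) ∧ (0 <ᵇ w v))

    h f EE e : ℕ
    h  = ∣ H ∣ₛ
    f  = weight low H
    EE = weight hub H
    e  = pairs (adj G)

    light : ∀ v → v ∉ H → deg G v ≤ D
    light v = <ᵇ-false

    hubs-heavy : suc D * h ≤ f + EE
    hubs-heavy = begin
      suc D * h                        ≡⟨ *-comm (suc D) h ⟩
      h * suc D                        ≡⟨ weight-const H (suc D) ⟨
      weight (λ _ → suc D) H           ≤⟨ weight-mono H (λ v p → <ᵇ-true p) ⟩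
      weight (deg G) H                 ≡⟨ sum-cong-≗ (λ v → cong (⟦ H v ⟧ *_) (deg-split H v)) ⟩
      weight (λ v → hub v + low v) H   ≡⟨ weight-+ H hub low ⟩
      EE + f                           ≡⟨ +-comm EE f ⟩
      f + EE                           ∎
      where open ≤-Reasoning

    degree-sum : (EE + f) + (f + weight low L) ≡ 2 * e
    degree-sum = begin
      (EE + f) + (f + weight low L)
        ≡⟨ cong₂ _+_ (weight-+ H hub low) (trans (weight-+ L hub low) (cong (_+ weight low L) (nb-swap H L))) ⟨
      weight (λ v → hub v + low v) H + weight (λ v → hub v + low v) L
        ≡⟨ weight-split H (λ v → hub v + low v) ⟨
      sum (λ v → hub v + low v)
        ≡⟨ sum-cong-≗ (λ v → deg-split H v) ⟨
      sum (deg G)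
        ≡⟨ handshake (adj G) (Graph.sym G) (irrefl G) ⟩
      2 * e ∎
      where open ≡.≡-Reasoning

    ends : 2 * f + EE ≤ 2 * e
    ends = ≤-trans (≤-trans (≤-reflexive (shuffle f EE)) (+-monoʳ-≤ (EE + f) (m≤m+n f (weight low L)))) (≤-reflexive degree-sum)
      where
      shuffle : ∀ f E → 2 * f + E ≡ (E + f) + f
      shuffle = solve-∀

    ∣L∣+h : ∣ L ∣ₛ + h ≡ n
    ∣L∣+h = trans (≡.sym (sum-+ (λ v → ⟦ L v ⟧) (λ v → ⟦ H v ⟧)))
      (trans (sum-cong-≗ λ v → trans (+-comm ⟦ L v ⟧ ⟦ H v ⟧) (⟦not⟧ (H v)))
        (trans (sum-const n) (*-identityʳ n)))

    -- The edges between hubs and others count twice in 2 hub + low, so that quantity sums over `L`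
    -- to 2 e - EE; it is subtracted from 4 for each of the n - h non-hubs.
    total-weight : 4 * n + EE ≤ weight w L + (2 * e + 4 * h)
    total-weight = begin
      4 * n + EE
        ≡⟨ cong (λ z → 4 * z + EE) ∣L∣+h ⟨
      4 * (∣ L ∣ₛ + h) + EE
        ≡⟨ shuffle₁ ∣ L ∣ₛ h EE ⟩
      ∣ L ∣ₛ * 4 + (EE + 4 * h)
        ≡⟨ cong (_+ (EE + 4 * h)) (weight-const L 4) ⟨
      weight (λ _ → 4) L + (EE + 4 * h)
        ≤⟨ +-monoˡ-≤ (EE + 4 * h) (weight-mono L λ v _ →
             subst (4 ≤_) (trans (+-comm _ (w v)) (cong (λ □ → w v + □) (shuffle₂ (hub v) (low v)))) (m≤n+m∸n 4 (2 * hub v + low v))) ⟩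
      weight (λ v → w v + ((hub v + hub v) + low v)) L + (EE + 4 * h)
        ≡⟨ cong (_+ (EE + 4 * h)) (trans (weight-+ L w (λ v → (hub v + hub v) + low v))
             (cong (λ □ → weight w L + □) (trans (weight-+ L (λ v → hub v + hub v) low)
               (cong (_+ weight low L) (trans (weight-+ L hub hub) (cong₂ _+_ (nb-swap H L) (nb-swap H L))))))) ⟩
      (weight w L + ((f + f) + weight low L)) + (EE + 4 * h)
        ≡⟨ shuffle₃ (weight w L) f (weight low L) EE h ⟩
      weight w L + (((EE + f) + (f + weight low L)) + 4 * h)
        ≡⟨ cong (λ z → weight w L + (z + 4 * h)) degree-sum ⟩
      weight w L + (2 * e + 4 * h) ∎
      where
      open ≤-Reasoning
      shuffle₁ : ∀ l h E → 4 * (l + h) + E ≡ l * 4 + (E + 4 * h)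
      shuffle₁ = solve-∀
      shuffle₂ : ∀ a b → 2 * a + b ≡ (a + a) + b
      shuffle₂ = solve-∀
      shuffle₃ : ∀ W f l E h → (W + ((f + f) + l)) + (E + 4 * h) ≡ W + (((E + f) + (f + l)) + 4 * h)
      shuffle₃ = solve-∀

    -- Two hub neighbours already bring the weight down to 0.
    classes : weight w L ≤ weight w (P 0) + weight w (P 1)
    classes = ≤-trans (sum-mono λ v → split (L v) (hub v) (low v))
      (≤-reflexive (sum-+ (λ v → ⟦ P 0 v ⟧ * w v) (λ v → ⟦ P 1 v ⟧ * w v)))
      where
      present : ∀ b x → ⟦ b ⟧ * x ≤ ⟦ b ∧ (true ∧ (0 <ᵇ x)) ⟧ * x
      present false x       = z≤n
      present true  zero    = z≤n
      present true  (suc x) = ≤-refl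
      split : ∀ b a l → let x = 4 ∸ (2 * a + l) in
              ⟦ b ⟧ * x ≤ ⟦ b ∧ ((a ≡ᵇ 0) ∧ (0 <ᵇ x)) ⟧ * x + ⟦ b ∧ ((a ≡ᵇ 1) ∧ (0 <ᵇ x)) ⟧ * x
      split b zero          l = ≤-trans (present b (4 ∸ l)) (m≤m+n _ _)
      split b (suc zero)    l = ≤-trans (present b (4 ∸ (2 + l)))
                                  (m≤n+m _ (⟦ b ∧ (false ∧ (0 <ᵇ (4 ∸ (2 + l)))) ⟧ * (4 ∸ (2 + l))))
      split b (suc (suc a)) l rewrite +-suc a (suc (a + 0)) | +-suc a (a + 0) | 0∸n≡0 (a + (a + 0) + l) =
        ≤-trans (≤-reflexive (*-zeroʳ ⟦ b ⟧)) z≤n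

    in-class : ∀ {c v} → v ∈ P c → v ∉ H × hub v ≡ c × 0 < w v
    in-class {c} {v} p with ∧-true {L v} p
    ... | l , p′ with ∧-true {hub v ≡ᵇ c} p′
    ...   | q , r = not-true l , ≡ᵇ⇒≡ (hub v) c (subst T (≡.sym q) _) , <ᵇ-true r

    module _ (room : 2 * h + 28 + D + 2 * (D * D + f / 5) < n) where

      -- The divisor 5 in `f / 5`: since `f` can only be bounded by nearly 2 n, twice `f / 4` could
      -- use up all n positions, whereas twice `f / 5` leaves n / 5 for the rest.
      capacity : f < 5 * suc (f / 5)
      capacity = begin-strict
        f                     ≡⟨ m≡m%n+[m/n]*n f 5 ⟩
        f % 5 + f / 5 * 5     <⟨ +-monoˡ-< (f / 5 * 5) (m%n<n f 5) ⟩
        5 + f / 5 * 5         ≡⟨ *-comm (suc (f / 5)) 5 ⟩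
        5 * suc (f / 5)       ∎
        where open ≤-Reasoning

      -- Here weight and non-hub degree sum to 4, so selecting a vertex of non-hub degree 0, 1, 2, 3
      -- costs at most 4, 6, 6, 4. From 3 f < 15 (f / 5 + 1) there are at most 14 heavy vertices.
      setup₀ : 6 * (h + 14) + 3 * (14 * D) ≤ weight w (P 0) → Setup G
      setup₀ rich = record
        { H = H ; P = P 0 ; w = w ; D = D ; cap = f / 5 ; k = 3 ; C = 6 ; o = 14
        ; P∉H = λ v p → proj₁ (in-class p)
        ; P-hub = λ v p → ≤-trans (≤-reflexive (proj₁ (proj₂ (in-class p)))) z≤n
        ; P-few = λ v p → s≤s⁻¹ (few v p)
        ; P-kind = inj₁ λ v p → proj₁ (proj₂ (in-class p))
        ; P-weight = λ v p → proj₁ (bounds (hub v) (low v) (proj₁ (proj₂ (in-class p))) (few v p))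
        ; P-cost = λ v p → proj₂ (bounds (hub v) (low v) (proj₁ (proj₂ (in-class p))) (few v p))
        ; C-pos = z<s ; light = light ; rich = rich
        ; capacity = ≤-trans (*-monoʳ-< 3 capacity) (≤-reflexive (≡.sym (*-assoc 3 5 (suc (f / 5)))))
        ; room = room }
        where
        few : ∀ v → v ∈ P 0 → low v < 4
        few v p = ≰⇒> λ ge → <⇒≢ (proj₂ (proj₂ (in-class p)))
          (≡.sym (m≤n⇒m∸n≡0 (≤-trans ge (m≤n+m (low v) (2 * hub v)))))
        bounds : ∀ a l → a ≡ 0 → l < 4 → (4 ∸ (2 * a + l)) + l ≤ 4 ×
                 (4 ∸ (2 * a + l)) + l * (4 ∸ (2 * a + l)) ≤ 6
        bounds 0 0 _ _ = ≤-refl , m≤m+n 4 2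
        bounds 0 1 _ _ = ≤-refl , ≤-refl
        bounds 0 2 _ _ = ≤-refl , ≤-refl
        bounds 0 3 _ _ = ≤-refl , m≤m+n 4 2
        bounds 0 (suc (suc (suc (suc _)))) _ (s≤s (s≤s (s≤s (s≤s ()))))

      -- Here weight and non-hub degree sum to 2, and selecting a vertex costs at most 2 in either
      -- case. From f < 5 (f / 5 + 1) there are at most 4 heavy vertices.
      setup₁ : 2 * (h + 4) + 1 * (4 * D) ≤ weight w (P 1) → Setup G
      setup₁ rich = record
        { H = H ; P = P 1 ; w = w ; D = D ; cap = f / 5 ; k = 1 ; C = 2 ; o = 4
        ; P∉H = λ v p → proj₁ (in-class p)
        ; P-hub = λ v p → ≤-reflexive (proj₁ (proj₂ (in-class p)))
        ; P-few = λ v p → s≤s⁻¹ (few v p)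
        ; P-kind = inj₂ λ v p → s≤s⁻¹ (few v p)
        ; P-weight = λ v p → proj₁ (bounds (hub v) (low v) (proj₁ (proj₂ (in-class p))) (few v p))
        ; P-cost = λ v p → proj₂ (bounds (hub v) (low v) (proj₁ (proj₂ (in-class p))) (few v p))
        ; C-pos = z<s ; light = light ; rich = rich
        ; capacity = ≤-trans (*-monoʳ-< 1 capacity) (≤-reflexive (*-identityˡ (5 * suc (f / 5))))
        ; room = ≤-<-trans (+-monoˡ-≤ (2 * (D * D + f / 5)) (+-monoˡ-≤ D (+-monoʳ-≤ (2 * h) (m≤m+n 8 20)))) room }
        where
        few : ∀ v → v ∈ P 1 → low v < 2
        few v p = ≰⇒> λ ge → <⇒≢ (proj₂ (proj₂ (in-class p)))
          (≡.sym (m≤n⇒m∸n≡0 (+-mono-≤ (≤-reflexive (cong (2 *_) (≡.sym (proj₁ (proj₂ (in-class p)))))) ge)))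
        bounds : ∀ a l → a ≡ 1 → l < 2 → (4 ∸ (2 * a + l)) + l ≤ 2 ×
                 (4 ∸ (2 * a + l)) + l * (4 ∸ (2 * a + l)) ≤ 2
        bounds 1 0 _ _ = ≤-refl , ≤-refl
        bounds 1 1 _ _ = ≤-refl , ≤-refl
        bounds 1 (suc (suc _)) _ (s≤s (s≤s ()))

      -- The weight of `L` covers the demands of both kinds of pool together, so at least one kind
      -- meets its own.
      some-setup : 2 * e + 12 * h + (46 * D + 92) ≤ 4 * n + EE → Setup G
      some-setup rich with 6 * (h + 14) + 3 * (14 * D) ≤? weight w (P 0)
      ... | yes p = setup₀ p
      ... | no ¬p = setup₁ (+-cancelˡ-≤ (6 * (h + 14) + 3 * (14 * D)) _ _ (begin
        (6 * (h + 14) + 3 * (14 * D)) + (2 * (h + 4) + 1 * (4 * D))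
          ≤⟨ +-cancelʳ-≤ (2 * e + 4 * h) _ _ (begin
               (6 * (h + 14) + 3 * (14 * D)) + (2 * (h + 4) + 1 * (4 * D)) + (2 * e + 4 * h)
                 ≡⟨ shuffle h D e ⟩
               2 * e + 12 * h + (46 * D + 92)
                 ≤⟨ rich ⟩
               4 * n + EE
                 ≤⟨ total-weight ⟩
               weight w L + (2 * e + 4 * h) ∎) ⟩
        weight w L
          ≤⟨ classes ⟩
        weight w (P 0) + weight w (P 1)
          ≤⟨ +-monoˡ-≤ (weight w (P 1)) (≰⇒≥ ¬p) ⟩
        (6 * (h + 14) + 3 * (14 * D)) + weight w (P 1) ∎))
        where
        open ≤-Reasoning
        shuffle : ∀ h D e → (6 * (h + 14) + 3 * (14 * D)) + (2 * (h + 4) + 1 * (4 * D)) + (2 * e + 4 * h) ≡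
                  2 * e + 12 * h + (46 * D + 92)
        shuffle = solve-∀

  pack′ : ∀ q → pairs (adj G) + q + 7 ≡ 2 * n → 1000 * (n * n) ≤ q * q * q →
          ∃[ ρ ] pairs (conflict G ρ) ≤ 3
  pack′ q total cubic = few-conflicts (some-setup
      (N.room h f EE hubs-heavy ends (f / 5) (≤-trans (≤-reflexive (*-comm 5 (f / 5))) (m/n*n≤m f 5)))
      (N.rich h f EE hubs-heavy ends))
    where
    module N = Numbers n (pairs (adj G)) q total cubic
    open Choose N.D

  abstract

    pack : ∀ q → pairs (adj G) + q + 7 ≡ 2 * n → 1000 * (n * n) ≤ q * q * q →
           ∃[ ρ ] pairs (conflict G ρ) ≤ 3
    pack = pack′

-- The complete bipartite graph

module _ {A : Set} (p : A → Bool) where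

  hits : List A → ℕ
  hits xs = length (filterᵇ p xs)

  hits-∷ : ∀ x xs → hits (x ∷ xs) ≡ ⟦ p x ⟧ + hits xs
  hits-∷ x xs with p x
  ... | true  = refl
  ... | false = refl

  hits-++ : ∀ xs ys → hits (xs ++ ys) ≡ hits xs + hits ys
  hits-++ []       ys = refl
  hits-++ (x ∷ xs) ys = begin
    hits (x ∷ xs ++ ys)             ≡⟨ hits-∷ x (xs ++ ys) ⟩
    ⟦ p x ⟧ + hits (xs ++ ys)       ≡⟨ cong (λ □ → ⟦ p x ⟧ + □) (hits-++ xs ys) ⟩
    ⟦ p x ⟧ + (hits xs + hits ys)   ≡⟨ +-assoc ⟦ p x ⟧ (hits xs) (hits ys) ⟨
    ⟦ p x ⟧ + hits xs + hits ys     ≡⟨ cong (_+ hits ys) (hits-∷ x xs) ⟨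
    hits (x ∷ xs) + hits ys         ∎
    where open ≡.≡-Reasoning

hits-row : {A B : Set} (p : A × B → Bool) (a : A) (g : Fin n → B) →
           hits p (List.map (a ,_) (List.tabulate g)) ≡ sum λ j → ⟦ p (a , g j) ⟧
hits-row {zero}  p a g = refl
hits-row {suc n} p a g = trans (hits-∷ p (a , g zero) _) (cong (λ □ → ⟦ p (a , g zero) ⟧ + □) (hits-row p a (g ∘ suc)))

hits-product : ∀ {m n} {A B : Set} (p : A × B → Bool) (f : Fin m → A) (g : Fin n → B) →
               hits p (cartesianProduct (List.tabulate f) (List.tabulate g)) ≡ sum λ i → sum λ j → ⟦ p (f i , g j) ⟧
hits-product {zero}  p f g = refl
hits-product {suc m} p f g = trans (hits-++ p (List.map (f zero ,_) (List.tabulate g)) _)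
  (cong₂ _+_ (hits-row p (f zero) g) (hits-product p (f ∘ suc) g))

size≡pairs : (G : Graph n) → size G ≡ pairs (adj G)
size≡pairs G = hits-product (λ (u , v) → does (u Fin.<? v) ∧ adj G u v) (λ i → i) (λ i → i)

I≡pairs : (G : Graph n) (σ : Permutation′ n) → I G σ ≡ pairs (conflict G (flip σ))
I≡pairs G σ = size≡pairs (common G σ)

near-packing : (G : Graph n) → ∀ q → size G + q + 7 ≡ 2 * n → 1000 * (n * n) ≤ q * q * q →
               ∃[ σ ] I G σ ≤ 3
near-packing {n} G q total cubic
  with pack G q (subst (λ e → e + q + 7 ≡ 2 * n) (size≡pairs G) total) cubic
... | ρ , le = flip ρ , ≤-trans (≤-reflexive (I≡pairs G (flip ρ))) le

sum-product : (f g : Fin n → ℕ) → (sum λ u → sum λ v → f u * g v) ≡ sum f * sum g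
sum-product f g = trans (sum-cong-≗ λ u → ≡.sym (*-sum (f u) g)) (≡.sym (sum-* f (sum g)))

module CompleteBipartite {N : ℕ} (k : ℕ) (side : Subset N)
                         (∣side∣ : ∣ side ∣ₛ ≡ 2) (∣∁side∣ : ∣ ∁ side ∣ₛ ≡ k) where

  xor-comm : ∀ a b → a xor b ≡ b xor a
  xor-comm true  true  = refl
  xor-comm true  false = refl
  xor-comm false true  = refl
  xor-comm false false = refl

  xor-self : ∀ a → a xor a ≡ false
  xor-self true  = refl
  xor-self false = refl

  K : Graph N
  K .adj u v  = side u xor side v
  K .Graph.sym u v = xor-comm (side u) (side v)
  K .irrefl v = xor-self (side v)

  size-K : size K ≡ 2 * k
  size-K = *-cancelˡ-≡ (size K) (2 * k) 2 (begin
    2 * size K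
      ≡⟨ cong (2 *_) (size≡pairs K) ⟩
    2 * pairs (adj K)
      ≡⟨ handshake (adj K) (Graph.sym K) (irrefl K) ⟨
    (sum λ u → sum λ v → ⟦ side u xor side v ⟧)
      ≡⟨ sum-sum-cong (λ u v → split (side u) (side v)) ⟩
    (sum λ u → sum λ v → ⟦ side u ⟧ * ⟦ ∁ side v ⟧ + ⟦ ∁ side u ⟧ * ⟦ side v ⟧)
      ≡⟨ sum-sum-+ (λ u v → ⟦ side u ⟧ * ⟦ ∁ side v ⟧) (λ u v → ⟦ ∁ side u ⟧ * ⟦ side v ⟧) ⟩
    (sum λ u → sum λ v → ⟦ side u ⟧ * ⟦ ∁ side v ⟧) + (sum λ u → sum λ v → ⟦ ∁ side u ⟧ * ⟦ side v ⟧)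
      ≡⟨ cong₂ _+_ (sum-product (λ u → ⟦ side u ⟧) (λ v → ⟦ ∁ side v ⟧))
                   (sum-product (λ u → ⟦ ∁ side u ⟧) (λ v → ⟦ side v ⟧)) ⟩
    ∣ side ∣ₛ * ∣ ∁ side ∣ₛ + ∣ ∁ side ∣ₛ * ∣ side ∣ₛ
      ≡⟨ cong₂ (λ a b → a * b + b * a) ∣side∣ ∣∁side∣ ⟩
    2 * k + k * 2
      ≡⟨ shuffle k ⟩
    2 * (2 * k) ∎)
    where
    open ≡.≡-Reasoning
    split : ∀ a b → ⟦ a xor b ⟧ ≡ ⟦ a ⟧ * ⟦ not b ⟧ + ⟦ not a ⟧ * ⟦ b ⟧
    split true  true  = refl
    split true  false = refl
    split false true  = refl
    split false false = refl
    shuffle : ∀ k → 2 * k + k * 2 ≡ 2 * (2 * k)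
    shuffle = solve-∀

  -- The vertices are sorted by their side in the graph and in its image;
  -- the common edges join both-neither and one-other.
  K-overlaps : 4 ≤ k → ∀ σ → 4 ≤ I K σ
  K-overlaps 4≤k σ = *-cancelˡ-≤ 2 (subst (8 ≤_) (≡.sym twice)
    (eight ∣ both ∣ₛ ∣ one ∣ₛ ∣ other ∣ₛ ∣ neither ∣ₛ row column rest))
    where
    side′ : Subset N
    side′ v = side (σ ⟨$⟩ˡ v)
    both one other neither : Subset N
    both v    = side v ∧ side′ v
    one v     = side v ∧ not (side′ v)
    other v   = not (side v) ∧ side′ v
    neither v = not (side v) ∧ not (side′ v)
    partition : (S S₁ S₂ : Subset N) → (∀ v → ⟦ S₁ v ⟧ + ⟦ S₂ v ⟧ ≡ ⟦ S v ⟧) → ∣ S₁ ∣ₛ + ∣ S₂ ∣ₛ ≡ ∣ S ∣ₛ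
    partition S S₁ S₂ eq = trans (≡.sym (sum-+ (λ v → ⟦ S₁ v ⟧) (λ v → ⟦ S₂ v ⟧))) (sum-cong-≗ eq)
    ∧-split : ∀ a b → ⟦ a ∧ b ⟧ + ⟦ a ∧ not b ⟧ ≡ ⟦ a ⟧
    ∧-split true  true  = refl
    ∧-split true  false = refl
    ∧-split false b     = refl
    ∧-split′ : ∀ a b → ⟦ a ∧ b ⟧ + ⟦ not a ∧ b ⟧ ≡ ⟦ b ⟧
    ∧-split′ true  b = +-identityʳ _
    ∧-split′ false b = refl
    row : ∣ both ∣ₛ + ∣ one ∣ₛ ≡ 2
    row = trans (partition side both one λ v → ∧-split (side v) (side′ v)) ∣side∣
    column : ∣ both ∣ₛ + ∣ other ∣ₛ ≡ 2
    column = trans (partition side′ both other λ v → ∧-split′ (side v) (side′ v))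
      (trans (∣∣-permute (flip σ) side) ∣side∣)
    rest : ∣ other ∣ₛ + ∣ neither ∣ₛ ≡ k
    rest = trans (partition (∁ side) other neither λ v → ∧-split (not (side v)) (side′ v)) ∣∁side∣
    cell : (S T : Subset N) → ℕ
    cell S T = sum λ u → sum λ v → ⟦ S u ⟧ * ⟦ T v ⟧
    cell≡ : ∀ S T → cell S T ≡ ∣ S ∣ₛ * ∣ T ∣ₛ
    cell≡ S T = sum-product (λ u → ⟦ S u ⟧) (λ v → ⟦ T v ⟧)
    sorted : ∀ a a′ b b′ → ⟦ (a xor b) ∧ (a′ xor b′) ⟧ ≡
      (⟦ a ∧ a′ ⟧ * ⟦ not b ∧ not b′ ⟧ + ⟦ not a ∧ not a′ ⟧ * ⟦ b ∧ b′ ⟧) +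
      (⟦ a ∧ not a′ ⟧ * ⟦ not b ∧ b′ ⟧ + ⟦ not a ∧ a′ ⟧ * ⟦ b ∧ not b′ ⟧)
    sorted true  true  true  b′    = ≡.sym (trans (+-identityʳ _) (*-zeroʳ 0))
    sorted true  true  false true  = refl
    sorted true  true  false false = refl
    sorted true  false true  b′    = refl
    sorted true  false false true  = refl
    sorted true  false false false = refl
    sorted false true  true  true  = refl
    sorted false true  true  false = refl
    sorted false true  false b′    = refl
    sorted false false true  true  = refl
    sorted false false true  false = refl
    sorted false false false b′    = refl
    twice : 2 * I K σ ≡ (∣ both ∣ₛ * ∣ neither ∣ₛ + ∣ neither ∣ₛ * ∣ both ∣ₛ) + (∣ one ∣ₛ * ∣ other ∣ₛ + ∣ other ∣ₛ * ∣ one ∣ₛ)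
    twice = begin
      2 * I K σ
        ≡⟨ cong (2 *_) (I≡pairs K σ) ⟩
      2 * pairs (conflict K (flip σ))
        ≡⟨ handshake (conflict K (flip σ)) (conflict-sym K (flip σ))
             (λ v → cong (_∧ adj K (flip σ · v) (flip σ · v)) (irrefl K v)) ⟨
      (sum λ u → sum λ v → ⟦ (side u xor side v) ∧ (side′ u xor side′ v) ⟧)
        ≡⟨ sum-sum-cong (λ u v → sorted (side u) (side′ u) (side v) (side′ v)) ⟩
      (sum λ u → sum λ v → (⟦ both u ⟧ * ⟦ neither v ⟧ + ⟦ neither u ⟧ * ⟦ both v ⟧) +
                           (⟦ one u ⟧ * ⟦ other v ⟧ + ⟦ other u ⟧ * ⟦ one v ⟧))
        ≡⟨ trans (sum-sum-+ (λ u v → ⟦ both u ⟧ * ⟦ neither v ⟧ + ⟦ neither u ⟧ * ⟦ both v ⟧)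
                            (λ u v → ⟦ one u ⟧ * ⟦ other v ⟧ + ⟦ other u ⟧ * ⟦ one v ⟧))
             (cong₂ _+_ (sum-sum-+ (λ u v → ⟦ both u ⟧ * ⟦ neither v ⟧) (λ u v → ⟦ neither u ⟧ * ⟦ both v ⟧))
                        (sum-sum-+ (λ u v → ⟦ one u ⟧ * ⟦ other v ⟧) (λ u v → ⟦ other u ⟧ * ⟦ one v ⟧))) ⟩
      (cell both neither + cell neither both) + (cell one other + cell other one)
        ≡⟨ cong₂ _+_ (cong₂ _+_ (cell≡ both neither) (cell≡ neither both))
                     (cong₂ _+_ (cell≡ one other) (cell≡ other one)) ⟩
      (∣ both ∣ₛ * ∣ neither ∣ₛ + ∣ neither ∣ₛ * ∣ both ∣ₛ) + (∣ one ∣ₛ * ∣ other ∣ₛ + ∣ other ∣ₛ * ∣ one ∣ₛ) ∎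
      where open ≡.≡-Reasoning
    -- Half the right side is 4, k or 2 k according as `a` is 0, 1 or 2. The middle case is where k
    -- must be at least 4, that is, n at least 6.
    eight : ∀ a b c d → a + b ≡ 2 → a + c ≡ 2 → c + d ≡ k → 8 ≤ (a * d + d * a) + (b * c + c * b)
    eight 0 2 2 d refl refl _ = m≤n+m 8 (d * 0)
    eight 1 1 1 d refl refl refl = ≤-trans (+-mono-≤ (+-mono-≤ (≤-trans (s≤s⁻¹ 4≤k) (≤-reflexive (≡.sym (*-identityˡ d)))) (≤-trans (s≤s⁻¹ 4≤k) (≤-reflexive (≡.sym (*-identityʳ d))))) (≤-refl {2})) ≤-refl
    eight 2 0 0 d refl refl refl = ≤-trans (≤-trans (*-monoʳ-≤ 2 4≤k) (m≤m+n (2 * d) (d * 2))) (m≤m+n _ 0)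
    eight (suc (suc (suc _))) _ _ _ ()

Extremal : ℕ → ℕ → Set
Extremal n e = Σ[ G ∈ Graph n ] (size G ≡ e × (∀ (σ : Permutation′ n) → 4 ≤ I G σ))

extremal : ∀ n → 6 ≤ n → Extremal n (2 * n ∸ 4)
extremal (suc (suc k)) (s≤s (s≤s 4≤k)) = K , trans size-K (≡.sym sizes) , K-overlaps 4≤k
  where
  side : Subset (2 + k)
  side zero          = true
  side (suc zero)    = true
  side (suc (suc _)) = false
  open CompleteBipartite k side
    (cong (λ z → suc (suc z)) (sum-zero {k} {λ _ → 0} (λ _ → refl)))
    (trans (sum-const k) (*-identityʳ k))
  sizes : 2 * (2 + k) ∸ 4 ≡ 2 * k
  sizes = trans (cong (_∸ 4) (*-distribˡ-+ 2 2 k)) (m+n∸m≡n 4 (2 * k))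

-- Existence of the minimum and the maximum

Searchable : Set → Set₁
Searchable A = {P : A → Set} → (∀ a → Dec (P a)) → Dec (∃[ a ] P a)

search-Bool : Searchable Bool
search-Bool P? with P? true | P? false
... | yes p | _     = yes (true , p)
... | no _  | yes q = yes (false , q)
... | no ¬p | no ¬q = no λ { (true , p) → ¬p p ; (false , q) → ¬q q }

search-Vec : ∀ {A} → Searchable A → ∀ n → Searchable (Vec A n)
search-Vec any? zero    P? = map′ (λ p → [] , p) (λ { ([] , p) → p }) (P? [])
search-Vec any? (suc n) P? = map′ (λ (x , xs , p) → x ∷ xs , p) (λ { (x ∷ xs , p) → x , xs , p })
  (any? λ x → search-Vec any? n λ xs → P? (x ∷ xs))

pairs-cong : {r s : Fin n → Fin n → Bool} → (∀ u v → r u v ≡ s u v) → pairs r ≡ pairs s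
pairs-cong eq = sum-cong-≗ λ u → sum-cong-≗ λ v → cong (λ b → ⟦ does (u Fin.<? v) ∧ b ⟧) (eq u v)

-- A permutation is searched for as two tables, `xs` for the inverse and `ys` for the map itself;
-- the common edges are read off from `xs`.
near-packing? : (G : Graph n) → Dec (∃[ σ ] I G σ ≤ 3)
near-packing? {n} G = map′ from to
  (search-Vec Fin.any? n λ xs → search-Vec Fin.any? n λ ys →
     Fin.all? (λ i → lookup xs (lookup ys i) Fin.≟ i) ×-dec
     (Fin.all? (λ i → lookup ys (lookup xs i) Fin.≟ i) ×-dec
     (pairs (shared (lookup xs)) ≤? 3)))
  where
  shared : (Fin n → Fin n) → Fin n → Fin n → Bool
  shared g u v = adj G u v ∧ adj G (g u) (g v)
  Code : Set
  Code = ∃[ xs ] ∃[ ys ] ((∀ i → lookup xs (lookup ys i) ≡ i) ×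
           ((∀ i → lookup ys (lookup xs i) ≡ i) × pairs (shared (lookup xs)) ≤ 3))
  from : Code → ∃[ σ ] I G σ ≤ 3
  from (xs , ys , p , q , le) =
    let σ = permutation (lookup ys) (lookup xs) q p in
    σ , ≤-trans (≤-reflexive (I≡pairs G σ)) le
  to : (∃[ σ ] I G σ ≤ 3) → Code
  to (σ , le) = tabulate (σ ⟨$⟩ˡ_) , tabulate (σ ⟨$⟩ʳ_) ,
    (λ i → trans (cong (lookup (tabulate (σ ⟨$⟩ˡ_))) (lookup∘tabulate (σ ⟨$⟩ʳ_) i))
             (trans (lookup∘tabulate (σ ⟨$⟩ˡ_) (σ ⟨$⟩ʳ i)) (inverseˡ σ))) ,
    (λ i → trans (cong (lookup (tabulate (σ ⟨$⟩ʳ_))) (lookup∘tabulate (σ ⟨$⟩ˡ_) i))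
             (trans (lookup∘tabulate (σ ⟨$⟩ʳ_) (σ ⟨$⟩ˡ i)) (inverseʳ σ))) ,
    ≤-trans (≤-reflexive (trans (pairs-cong λ u v → cong₂ (λ x y → adj G u v ∧ adj G x y)
        (lookup∘tabulate (σ ⟨$⟩ˡ_) u) (lookup∘tabulate (σ ⟨$⟩ˡ_) v)) (≡.sym (I≡pairs G σ)))) le

overlaps? : (G : Graph n) → Dec (∀ σ → 4 ≤ I G σ)
overlaps? G = map′ (λ ¬p σ → ≰⇒> λ le → ¬p (σ , le)) (λ all (σ , le) → <⇒≱ (all σ) le) (¬? (near-packing? G))

-- Only entries above the diagonal are read, so every Boolean matrix is a code and the search needs
-- no validity condition.
decode : Vec (Vec Bool n) n → Graph n
decode c .adj u v  = (does (u Fin.<? v) ∧ lookup (lookup c u) v) ∨ (does (v Fin.<? u) ∧ lookup (lookup c v) u)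
decode c .Graph.sym u v = Bool.∨-comm (does (u Fin.<? v) ∧ lookup (lookup c u) v) _
decode c .irrefl v = cong (λ b → (b ∧ lookup (lookup c v) v) ∨ (b ∧ lookup (lookup c v) v))
  (≢true⇒false λ p → <-irrefl refl (<ᵇ-true {toℕ v} {toℕ v} p))

encode : Graph n → Vec (Vec Bool n) n
encode G = tabulate λ u → tabulate (adj G u)

adj-decode : (G : Graph n) → ∀ u v → adj (decode (encode G)) u v ≡ adj G u v
adj-decode G u v = trans
  (cong₂ (λ a b → (does (u Fin.<? v) ∧ a) ∨ (does (v Fin.<? u) ∧ b)) (entry u v) (trans (entry v u) (Graph.sym G v u)))
  pick
  where
  entry : ∀ u v → lookup (lookup (encode G) u) v ≡ adj G u v
  entry u v = trans (cong (λ row → lookup row v) (lookup∘tabulate (λ u → tabulate (adj G u)) u))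
                (lookup∘tabulate (adj G u) v)
  pick : (does (u Fin.<? v) ∧ adj G u v) ∨ (does (v Fin.<? u) ∧ adj G u v) ≡ adj G u v
  pick with <-cmp (toℕ u) (toℕ v)
  ... | tri< p _ _ rewrite <ᵇ-true⁻¹ p with adj G u v | does (v Fin.<? u)
  ...   | true  | _     = refl
  ...   | false | true  = refl
  ...   | false | false = refl
  pick | tri> _ _ q rewrite <ᵇ-true⁻¹ q with adj G u v | does (u Fin.<? v)
  ...   | true  | true  = refl
  ...   | true  | false = refl
  ...   | false | true  = refl
  ...   | false | false = refl
  pick | tri≈ _ eq _ rewrite Fin.toℕ-injective eq | irrefl G v with does (v Fin.<? v)
  ... | true  = refl
  ... | false = refl

size-cong : {G K : Graph n} → (∀ u v → adj G u v ≡ adj K u v) → size G ≡ size K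
size-cong {G = G} {K} eq = trans (size≡pairs G) (trans (pairs-cong eq) (≡.sym (size≡pairs K)))

I-cong : {G K : Graph n} → (∀ u v → adj G u v ≡ adj K u v) → ∀ σ → I G σ ≡ I K σ
I-cong {G = G} {K} eq σ = size-cong {G = common G σ} {common K σ}
  λ u v → cong₂ _∧_ (eq u v) (eq (σ ⟨$⟩ˡ u) (σ ⟨$⟩ˡ v))

extremal? : ∀ n e → Dec (Extremal n e)
extremal? n e = map′ (λ (c , p) → decode c , p)
  (λ (G , s , all) → encode G ,
     trans (size-cong {G = decode (encode G)} {G} (adj-decode G)) s ,
     λ σ → subst (4 ≤_) (≡.sym (I-cong {G = decode (encode G)} {G} (adj-decode G) σ)) (all σ))
  (search-Vec (search-Vec search-Bool n) n λ c → (size (decode c) ≟ e) ×-dec overlaps? (decode c))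

least : {P : ℕ → Set} → (∀ e → Dec (P e)) → ∀ e → P e → ∃[ m ] IsMinimum P m
least {P} P? e p with descend {A = Σ[ e ∈ ℕ ] P e} proj₁ {λ (e , _) → ∀ x → P x → e ≤ x} step (e , p)
  where
  step : (s : Σ[ e ∈ ℕ ] P e) → (∀ x → P x → proj₁ s ≤ x) ⊎ ∃[ s′ ] proj₁ s′ < proj₁ s
  step (e , p) with Fin.any? {n = e} (λ i → P? (toℕ i))
  ... | yes (i , q) = inj₂ ((toℕ i , q) , Fin.toℕ<n i)
  ... | no ¬q = inj₁ λ x px → ≮⇒≥ λ x<e → ¬q (Fin.fromℕ< x<e , subst P (≡.sym (Fin.toℕ-fromℕ< x<e)) px)
... | (m , q) , low = m , q , low

minimum : ∀ n → 6 ≤ n → ∃[ m ] Is-f n 4 m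
minimum n 6≤n = least (extremal? n) (2 * n ∸ 4) (extremal n 6≤n)

abstract

  f₄ : ℕ → ℕ
  f₄ n with 6 ≤? n
  ... | yes 6≤n = proj₁ (minimum n 6≤n)
  -- A filler value: what is stated about `f₄ n` assumes 6 ≤ n, and the threshold in the little-o
  -- claim is at least 6.
  ... | no _    = 0

  f₄-minimum : ∀ n → 6 ≤ n → Is-f n 4 (f₄ n)
  f₄-minimum n 6≤n with 6 ≤? n
  ... | yes p = proj₂ (minimum n p)
  ... | no ¬p = contradiction 6≤n ¬p

f₄≤ : ∀ n → 6 ≤ n → f₄ n ≤ 2 * n ∸ 4
f₄≤ n 6≤n = proj₂ (f₄-minimum n 6≤n) (2 * n ∸ 4) (extremal n 6≤n)

-- All graphs with fewer than `f₄ n` edges have a near-packing, and some graph with exactly `f₄ n`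
-- edges has none.
μ₃ : ℕ → ℤ
μ₃ n = ℤ.pred (+ f₄ n)

μ₃-maximum : ∀ n → 6 ≤ n → Is-μ n (𝓔 3) (μ₃ n)
μ₃-maximum n 6≤n = below-f , λ x all → ℤ.i<j⇒i≤pred[j] (ℤ.≰⇒> λ f≤x → above-f x all f≤x)
  where
  below-f : ∀ (G : Graph n) → + size G ℤ.≤ μ₃ n → ∃[ σ ] I G σ ≤ 3
  below-f G small with near-packing? G
  ... | yes p = p
  ... | no ¬p = contradiction
    (proj₂ (f₄-minimum n 6≤n) (size G) (G , refl , λ σ → ≰⇒> λ le → ¬p (σ , le)))
    (<⇒≱ (ℤ.drop‿+<+ (ℤ.i≤pred[j]⇒i<j small)))
  above-f : ∀ x → (∀ (G : Graph n) → + size G ℤ.≤ x → ∃[ σ ] I G σ ≤ 3) → + f₄ n ℤ.≤ x → ⊥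
  above-f x all f≤x with proj₁ (f₄-minimum n 6≤n)
  ... | G , s , shared with all G (subst (λ z → + z ℤ.≤ x) (≡.sym s) f≤x)
  ...   | σ , le = <⇒≱ (shared σ) le

-- Real bounds and asymptotics

toℚᵘ-fromℤ : ∀ i → toℚᵘ (fromℤ i) ℚᵘ.≃ mkℚᵘ i 0
toℚᵘ-fromℤ i = ℚ.toℚᵘ-fromℚᵘ (mkℚᵘ i 0)

fromℤ-+ : ∀ i j → fromℤ (i ℤ.+ j) ≡ fromℤ i ℚ.+ fromℤ j
fromℤ-+ i j = ℚ.toℚᵘ-injective (begin
  toℚᵘ (fromℤ (i ℤ.+ j))               ≈⟨ toℚᵘ-fromℤ (i ℤ.+ j) ⟩
  mkℚᵘ (i ℤ.+ j) 0                     ≈⟨ *≡* (cong (ℤ._* + 1) (cong₂ ℤ._+_ (≡.sym (ℤ.*-identityʳ i)) (≡.sym (ℤ.*-identityʳ j)))) ⟩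
  mkℚᵘ i 0 ℚᵘ.+ mkℚᵘ j 0               ≈⟨ ℚᵘ.+-cong (toℚᵘ-fromℤ i) (toℚᵘ-fromℤ j) ⟨
  toℚᵘ (fromℤ i) ℚᵘ.+ toℚᵘ (fromℤ j)   ≈⟨ ℚ.toℚᵘ-homo-+ (fromℤ i) (fromℤ j) ⟨
  toℚᵘ (fromℤ i ℚ.+ fromℤ j)           ∎)
  where open import Relation.Binary.Reasoning.Setoid ℚᵘ.≃-setoid

fromℤ-* : ∀ i j → fromℤ (i ℤ.* j) ≡ fromℤ i ℚ.* fromℤ j
fromℤ-* i j = ℚ.toℚᵘ-injective (begin
  toℚᵘ (fromℤ (i ℤ.* j))               ≈⟨ toℚᵘ-fromℤ (i ℤ.* j) ⟩
  mkℚᵘ i 0 ℚᵘ.* mkℚᵘ j 0               ≈⟨ ℚᵘ.*-cong (toℚᵘ-fromℤ i) (toℚᵘ-fromℤ j) ⟨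
  toℚᵘ (fromℤ i) ℚᵘ.* toℚᵘ (fromℤ j)   ≈⟨ ℚ.toℚᵘ-homo-* (fromℤ i) (fromℤ j) ⟨
  toℚᵘ (fromℤ i ℚ.* fromℤ j)           ∎)
  where open import Relation.Binary.Reasoning.Setoid ℚᵘ.≃-setoid

fromℤ-neg : ∀ i → fromℤ (ℤ.- i) ≡ ℚ.- fromℤ i
fromℤ-neg i = ℚ.toℚᵘ-injective (begin
  toℚᵘ (fromℤ (ℤ.- i))   ≈⟨ toℚᵘ-fromℤ (ℤ.- i) ⟩
  ℚᵘ.- mkℚᵘ i 0          ≈⟨ ℚᵘ.-‿cong (toℚᵘ-fromℤ i) ⟨
  ℚᵘ.- toℚᵘ (fromℤ i)    ≈⟨ ℚ.toℚᵘ-homo‿- (fromℤ i) ⟨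
  toℚᵘ (ℚ.- fromℤ i)     ∎)
  where open import Relation.Binary.Reasoning.Setoid ℚᵘ.≃-setoid

fromℤ-minus : ∀ i j → fromℤ (i ℤ.- j) ≡ fromℤ i ℚ.- fromℤ j
fromℤ-minus i j = trans (fromℤ-+ i (ℤ.- j)) (cong (fromℤ i ℚ.+_) (fromℤ-neg j))

fromℤ-mono-< : ∀ {i j} → i ℤ.< j → fromℤ i ℚ.< fromℤ j
fromℤ-mono-< {i} {j} i<j = ℚ.toℚᵘ-cancel-<
  (ℚᵘ.<-respˡ-≃ (ℚᵘ.≃-sym (toℚᵘ-fromℤ i)) (ℚᵘ.<-respʳ-≃ (ℚᵘ.≃-sym (toℚᵘ-fromℤ j))
    (*<* (subst₂ ℤ._<_ (≡.sym (ℤ.*-identityʳ i)) (≡.sym (ℤ.*-identityʳ j)) i<j))))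

fromℤ-cancel-< : ∀ {i j} → fromℤ i ℚ.< fromℤ j → i ℤ.< j
fromℤ-cancel-< {i} {j} lt with ℚᵘ.<-respˡ-≃ (toℚᵘ-fromℤ i) (ℚᵘ.<-respʳ-≃ (toℚᵘ-fromℤ j) (ℚ.toℚᵘ-mono-< lt))
... | *<* p = subst₂ ℤ._<_ (ℤ.*-identityʳ i) (ℤ.*-identityʳ j) p

-- The real bound as an inequality between integers

gap : ℕ → ℤ → ℤ
gap n i = (+ (2 * n) ℤ.- + 7) ℤ.- i

cube : ℤ → ℤ
cube z = z ℤ.* z ℤ.* z

-- For K = 1000 n² this says that `bound n` lies strictly below `i`, without mention of cube roots.
Above : ℕ → ℕ → ℤ → Set
Above n K i = cube (gap n i) ℤ.< + K

above? : ∀ n K i → Dec (Above n K i)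
above? n K i = cube (gap n i) ℤ.<? + K

fromℤ-gap : ∀ n i → fromℤ (gap n i) ≡ (fromℕ (2 * n) ℚ.- fromℕ 7) ℚ.- fromℤ i
fromℤ-gap n i = trans (fromℤ-minus (+ (2 * n) ℤ.- + 7) i) (cong (ℚ._- fromℤ i) (fromℤ-minus (+ (2 * n)) (+ 7)))

fromℤ-cube : ∀ z → fromℤ (cube z) ≡ fromℤ z ℚ.* fromℤ z ℚ.* fromℤ z
fromℤ-cube z = trans (fromℤ-* (z ℤ.* z) z) (cong (ℚ._* fromℤ z) (fromℤ-* z z))

module _ where
  open ℚ.+-*-Solver

  minus-minus : ∀ a b → a ℚ.- (a ℚ.- b) ≡ b
  minus-minus = solve 2 (λ a b → a :- (a :- b) := b) refl

  cube-* : ∀ t r → (t ℚ.* r) ℚ.* (t ℚ.* r) ℚ.* (t ℚ.* r) ≡ (t ℚ.* t ℚ.* t) ℚ.* (r ℚ.* r ℚ.* r)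
  cube-* = solve 2 (λ t r → (t :* r) :* (t :* r) :* (t :* r) := (t :* t :* t) :* (r :* r :* r)) refl

thousand-n² : ∀ n → fromℤ (+ (1000 * n ^ 2)) ≡ fromℕ 1000 ℚ.* fromℕ (n ^ 2)
thousand-n² n = trans (cong fromℤ (ℤ.pos-* 1000 (n ^ 2))) (fromℤ-* (+ 1000) (+ (n ^ 2)))

-- Multiply (2n - 7 - i) / 10 < n^{2/3} by 10 and cube.
<ᶻ⇒Above : ∀ {n i} → bound n <ᶻ i → Above n (1000 * n ^ 2) i
<ᶻ⇒Above {n} {i} (r , r³<n² , i≡) = fromℤ-cancel-< (subst₂ ℚ._<_
    (≡.sym (trans (fromℤ-cube (gap n i)) (trans (cong (λ z → z ℚ.* z ℚ.* z) gap≡) (cube-* (fromℕ 10) r))))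
    (≡.sym (thousand-n² n))
    (ℚ.*-monoʳ-<-pos (fromℕ 1000) r³<n²))
  where
  a = fromℕ (2 * n) ℚ.- fromℕ 7
  gap≡ : fromℤ (gap n i) ≡ fromℕ 10 ℚ.* r
  gap≡ = trans (fromℤ-gap n i) (trans (cong (λ y → a ℚ.- y) i≡) (minus-minus a (fromℕ 10 ℚ.* r)))

Above⇒<ᶻ : ∀ {n i} → Above n (1000 * n ^ 2) i → bound n <ᶻ i
Above⇒<ᶻ {n} {i} lt = r ,
    subst₂ ℚ._<_ (≡.sym (trans (cube-* tenth z) (cong (tenth³ ℚ.*_) (≡.sym (fromℤ-cube (gap n i))))))
      (trans (cong (tenth³ ℚ.*_) (thousand-n² n)) (trans (≡.sym (ℚ.*-assoc tenth³ (fromℕ 1000) (fromℕ (n ^ 2))))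
        (ℚ.*-identityˡ (fromℕ (n ^ 2)))))
      (ℚ.*-monoʳ-<-pos tenth³ (fromℤ-mono-< lt)) ,
    ≡.sym (trans (cong (λ y → a ℚ.- y) (trans (≡.sym (ℚ.*-assoc (fromℕ 10) tenth z)) (ℚ.*-identityˡ z)))
      (trans (cong (λ y → a ℚ.- y) (fromℤ-gap n i)) (minus-minus a (fromℤ i))))
  where
  tenth tenth³ z a r : ℚ
  tenth = + 1 ℚ./ 10
  tenth³ = tenth ℚ.* tenth ℚ.* tenth
  z = fromℤ (gap n i)
  a = fromℕ (2 * n) ℚ.- fromℕ 7
  r = tenth ℚ.* z

cube-+ : ∀ q → cube (+ q) ≡ + (q * q * q)
cube-+ q = trans (cong (ℤ._* + q) (≡.sym (ℤ.pos-* q q))) (≡.sym (ℤ.pos-* (q * q) q))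

cube-nonNeg : ∀ z {m} → + m ℤ.≤ cube z → ∃[ q ] z ≡ + q × m ≤ q * q * q
cube-nonNeg (+ q) le = q , refl , ℤ.drop‿+≤+ (subst (_ ℤ.≤_) (cube-+ q) le)
cube-nonNeg -[1+ k ] ()

gap-+ : ∀ {n e q} → gap n (+ e) ≡ + q → e + q + 7 ≡ 2 * n
gap-+ {n} {e} {q} eq = ℤ.+-injective (begin
  + (e + q + 7)                     ≡⟨⟩
  + e ℤ.+ + q ℤ.+ + 7               ≡⟨ cong (λ z → + e ℤ.+ z ℤ.+ + 7) eq ⟨
  + e ℤ.+ gap n (+ e) ℤ.+ + 7       ≡⟨ cancel (+ e) (+ (2 * n)) (+ 7) ⟩
  + (2 * n)                         ∎)
  where
  open ≡.≡-Reasoning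
  open ℤ.+-*-Solver
  cancel : ∀ e t s → e ℤ.+ ((t ℤ.- s) ℤ.- e) ℤ.+ s ≡ t
  cancel = solve 3 (λ e t s → e :+ ((t :- s) :- e) :+ s := t) refl

-- Otherwise the gap at `f₄ n`, having a cube of at least K ≥ 0, is a natural number q. A graph
-- attaining the minimum then satisfies the hypotheses of `packs`, although each of its permutations
-- leaves at least four common edges.
above-from : ∀ n K → 6 ≤ n →
             (∀ (G : Graph n) q → size G + q + 7 ≡ 2 * n → K ≤ q * q * q → ∃[ σ ] I G σ ≤ 3) →
             Above n K (+ f₄ n)
above-from n K 6≤n packs with above? n K (+ f₄ n)
... | yes p = p
... | no ¬p with cube-nonNeg (gap n (+ f₄ n)) (ℤ.≮⇒≥ ¬p) | proj₁ (f₄-minimum n 6≤n)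
...   | q , gap≡q , cubic | G , s , shared
  with packs G q (trans (cong (λ e → e + q + 7) s) (gap-+ {n} {f₄ n} gap≡q)) cubic
...     | σ , le = contradiction le (<⇒≱ (shared σ))

f₄-above : ∀ n → 6 ≤ n → Above n (1000 * n ^ 2) (+ f₄ n)
f₄-above n 6≤n = above-from n (1000 * n ^ 2) 6≤n λ G q total cubic →
  near-packing G q total (≤-trans (≤-reflexive (cong (1000 *_) (cong (n *_) (≡.sym (*-identityʳ n))))) cubic)

bound<f₄ : ∀ n → 6 ≤ n → bound n <ᶻ + f₄ n
bound<f₄ n 6≤n = Above⇒<ᶻ {n} {+ f₄ n} (f₄-above n 6≤n)

-- The floor of the bound

crossing : {P : ℕ → Set} → (∀ j → Dec (P j)) → ¬ P 0 → ∀ J → P J → ∃[ j ] j < J × ¬ P j × P (suc j)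
crossing P? ¬P0 zero    PJ = contradiction PJ ¬P0
crossing P? ¬P0 (suc J) PJ with P? J
... | no ¬p = J , ≤-refl , ¬p , PJ
... | yes p with crossing P? ¬P0 J p
...   | j , j<J , ¬q , q = j , m≤n⇒m≤1+n j<J , ¬q , q

module Floor (n K f : ℕ) (above-f : Above n K (+ f))
             (to : ∀ {i} → Above n K i → bound n <ᶻ i) (from : ∀ {i} → bound n <ᶻ i → Above n K i) where

  -- Low enough to be no larger than the bound: its gap is 2 n + K, whose cube is at least K. The
  -- floor is then found where `Above` first switches on between here and `f`.
  start : ℤ
  start = ℤ.- (+ 7 ℤ.+ + K)

  at : ℕ → ℤ
  at j = start ℤ.+ + j

  J : ℕ
  J = 7 + K + f

  end : at J ≡ + f
  end = trans (cong (λ y → start ℤ.+ y) (trans (ℤ.pos-+ (7 + K) f) (cong (ℤ._+ + f) (ℤ.pos-+ 7 K))))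
    (cancel (+ 7 ℤ.+ + K) (+ f))
    where
    open ℤ.+-*-Solver
    cancel : ∀ a b → ℤ.- a ℤ.+ (a ℤ.+ b) ≡ b
    cancel = solve 2 (λ a b → (:- a) :+ (a :+ b) := b) refl

  next : ∀ j → at (suc j) ≡ at j ℤ.+ + 1
  next j = trans (cong at (+-comm 1 j))
    (trans (cong (λ y → start ℤ.+ y) (ℤ.pos-+ j 1)) (≡.sym (ℤ.+-assoc start (+ j) (+ 1))))

  gap-start : gap n (at 0) ≡ + (2 * n + K)
  gap-start = trans (cancel (+ (2 * n)) (+ 7) (+ K)) (≡.sym (ℤ.pos-+ (2 * n) K))
    where
    open ℤ.+-*-Solver
    cancel : ∀ a s k → (a ℤ.- s) ℤ.- (ℤ.- (s ℤ.+ k) ℤ.+ + 0) ≡ a ℤ.+ k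
    cancel = solve 3 (λ a s k → (a :- s) :- ((:- (s :+ k)) :+ con (+ 0)) := a :+ k) refl

  ¬above-start : ¬ Above n K (at 0)
  ¬above-start lt = <⇒≱ (ℤ.drop‿+<+ (subst (ℤ._< + K) (trans (cong cube gap-start) (cube-+ (2 * n + K))) lt))
    (≤-trans (m≤n+m K (2 * n)) (cube≥ (2 * n + K)))
    where
    cube≥ : ∀ x → x ≤ x * x * x
    cube≥ zero    = z≤n
    cube≥ (suc x) = ≤-trans (≤-reflexive (≡.sym (*-identityˡ (suc x)))) (*-monoˡ-≤ (suc x) {1} {suc x * suc x} (s≤s z≤n))

  below-f : ∀ {j} → j < J → at j ℤ.≤ ℤ.pred (+ f)
  below-f {j} j<J = ℤ.i<j⇒i≤pred[j] (subst (at j ℤ.<_) end (ℤ.+-monoʳ-< start (ℤ.+<+ j<J)))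

  floor : ⌊ bound n ⌋≤ ℤ.pred (+ f)
  floor with crossing (λ j → above? n K (at j)) ¬above-start J (subst (Above n K) (≡.sym end) above-f)
  ... | j , j<J , ¬above , above =
    at j , ((λ lt → ¬above (from lt)) , to (subst (Above n K) (next j) above)) , below-f j<J

floor≤μ₃ : ∀ n → 6 ≤ n → ⌊ bound n ⌋≤ μ₃ n
floor≤μ₃ n 6≤n = Floor.floor n (1000 * n ^ 2) (f₄ n) (f₄-above n 6≤n) (Above⇒<ᶻ {n}) (<ᶻ⇒Above {n})

-- The deficit is of smaller order than n

cubes-clash : ∀ a n k d x → 0 < k → d ≤ 2 * x → x * x * x < a * n ^ 2 →
              8 * a * (k * k * k) ≤ n → n < k * d → ⊥
cubes-clash a n k d x 0<k d≤2x x³<an² large n<kd =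
  <⇒≱ d<8ak² (*-cancelˡ-≤ k {{>-nonZero 0<k}} (begin
    k * (8 * a * (k * k))   ≡⟨ shuffle a k ⟩
    8 * a * (k * k * k)     ≤⟨ large ⟩
    n                       ≤⟨ <⇒≤ n<kd ⟩
    k * d                   ∎))
  where
  open ≤-Reasoning
  shuffle : ∀ a k → k * (8 * a * (k * k)) ≡ 8 * a * (k * k * k)
  shuffle = solve-∀
  eight : ∀ x → 2 * x * (2 * x * (2 * x)) ≡ 8 * (x * x * x)
  eight = solve-∀
  square : ∀ a n → 8 * (a * (n * (n * 1))) ≡ 8 * a * (n * n)
  square = solve-∀
  regroup : ∀ a k d → 8 * a * (k * d * (k * d)) ≡ 8 * a * (k * k) * (d * d)
  regroup = solve-∀
  d<8ak² : d < 8 * a * (k * k)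
  d<8ak² = *-cancelʳ-< (d * d) d (8 * a * (k * k)) (begin-strict
    d * (d * d)                  ≤⟨ *-mono-≤ d≤2x (*-mono-≤ d≤2x d≤2x) ⟩
    2 * x * (2 * x * (2 * x))    ≡⟨ eight x ⟩
    8 * (x * x * x)              <⟨ *-monoʳ-< 8 x³<an² ⟩
    8 * (a * n ^ 2)              ≡⟨ square a n ⟩
    8 * a * (n * n)              ≤⟨ *-monoʳ-≤ (8 * a) (*-mono-≤ (<⇒≤ n<kd) (<⇒≤ n<kd)) ⟩
    8 * a * (k * d * (k * d))    ≡⟨ regroup a k d ⟩
    8 * a * (k * k) * (d * d)    ∎)

gap-deficit : ∀ {n f} s x → f + (s + x) ≡ 2 * n → (+ (2 * n) ℤ.- + s) ℤ.- + f ≡ + x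
gap-deficit {n} {f} s x eq = trans (cong (λ z → (+ z ℤ.- + s) ℤ.- + f) (≡.sym eq))
  (trans (cong (λ z → (z ℤ.- + s) ℤ.- + f) (trans (ℤ.pos-+ f (s + x)) (cong (λ y → + f ℤ.+ y) (ℤ.pos-+ s x))))
    (cancel (+ f) (+ s) (+ x)))
  where
  open ℤ.+-*-Solver
  cancel : ∀ f s y → ((f ℤ.+ (s ℤ.+ y)) ℤ.- s) ℤ.- f ≡ y
  cancel = solve 3 (λ f s y → ((f :+ (s :+ y)) :- s) :- f := y) refl

-- If k d exceeded n for d = 2 n - f ≥ 14, then d ≤ 2 (d - 7) and
-- (d - 7)³ < a n² would give d³ < 8 a k² d².
deficit : ∀ a n k → 6 ≤ n → 0 < k → Above n (a * n ^ 2) (+ f₄ n) →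
          8 * a * (k * k * k) + 14 * k ≤ n → ∃[ d ] f₄ n + d ≡ 2 * n × k * d ≤ n
deficit a n k 6≤n 0<k above large with m≤n⇒∃[o]m+o≡n (≤-trans (f₄≤ n 6≤n) (m∸n≤m (2 * n) 4))
... | d , f+d≡2n = d , f+d≡2n , ≮⇒≥ absurd
  where
  absurd : n < k * d → ⊥
  absurd n<kd = cubes-clash a n k d x 0<k d≤2x x³<an² (≤-trans (m≤m+n (8 * a * (k * k * k)) (14 * k)) large) n<kd
    where
    14≤d : 14 ≤ d
    14≤d = <⇒≤ (*-cancelˡ-< k 14 d
      (≤-<-trans (≤-trans (≤-reflexive (*-comm k 14)) (≤-trans (m≤n+m (14 * k) (8 * a * (k * k * k))) large)) n<kd))
    x = d ∸ 7
    7+x≡d : 7 + x ≡ d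
    7+x≡d = m+[n∸m]≡n (≤-trans (m≤m+n 7 7) 14≤d)
    d≤2x : d ≤ 2 * x
    d≤2x = begin
      d             ≡⟨ 7+x≡d ⟨
      7 + x         ≤⟨ +-monoˡ-≤ x (∸-monoˡ-≤ 7 14≤d) ⟩
      x + x         ≡⟨ cong (λ y → x + y) (+-identityʳ x) ⟨
      2 * x         ∎
      where open ≤-Reasoning
    x³<an² : x * x * x < a * n ^ 2
    x³<an² = ℤ.drop‿+<+ (subst (ℤ._< + (a * n ^ 2))
      (trans (cong cube (gap-deficit {n} {f₄ n} 7 x (trans (cong (λ y → f₄ n + y) 7+x≡d) f+d≡2n))) (cube-+ x)) above)

fromℕ-nonNeg : ∀ n → 0ℚ ℚ.≤ fromℕ n
fromℕ-nonNeg n = ℚ.toℚᵘ-cancel-≤ (ℚᵘ.≤-respʳ-≃ (ℚᵘ.≃-sym (toℚᵘ-fromℤ (+ n))) (*≤* (ℤ.*-monoʳ-≤-nonNeg (+ 1) {+ 0} {+ n} (ℤ.+≤+ z≤n))))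

littleO-from : ∀ a → (∀ n → 6 ≤ n → Above n (a * n ^ 2) (+ f₄ n)) →
               (λ n → fromℕ (2 * n) ℚ.- fromℕ (f₄ n)) isLittleO fromℕ
littleO-from a above (mkℚ -[1+ _ ] _ _) (ℚ.*<* ())
littleO-from a above (mkℚ (+ 0) _ _) (ℚ.*<* (ℤ.+<+ ()))
-- Since ε has numerator at least 1 and denominator k, it suffices that the deficit d satisfies k d
-- ≤ n.
littleO-from a above ε@(mkℚ +[1+ p ] k-1 _) _ = 6 + (8 * a * (k * k * k) + 14 * k) , λ n N≤n →
    let 6≤n = ≤-trans (m≤m+n 6 (8 * a * (k * k * k) + 14 * k)) N≤n in
    small n (deficit a n k 6≤n z<s (above n 6≤n) (≤-trans (m≤n+m (8 * a * (k * k * k) + 14 * k) 6) N≤n))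
  where
  k : ℕ
  k = suc k-1
  small : ∀ n → ∃[ d ] f₄ n + d ≡ 2 * n × k * d ≤ n →
          ℚ.∣ fromℕ (2 * n) ℚ.- fromℕ (f₄ n) ∣ ℚ.≤ ε ℚ.* ℚ.∣ fromℕ n ∣
  small n (d , f+d≡2n , kd≤n) = subst₂ ℚ._≤_
      (trans (≡.sym (ℚ.0≤p⇒∣p∣≡p (fromℕ-nonNeg d))) (cong ℚ.∣_∣ (≡.sym difference)))
      (cong (ε ℚ.*_) (≡.sym (ℚ.0≤p⇒∣p∣≡p (fromℕ-nonNeg n))))
      (ℚ.toℚᵘ-cancel-≤ (ℚᵘ.≤-respˡ-≃ (ℚᵘ.≃-sym (toℚᵘ-fromℤ (+ d))) (ℚᵘ.≤-respʳ-≃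
        (ℚᵘ.≃-sym (ℚᵘ.≃-trans (ℚ.toℚᵘ-homo-* ε (fromℕ n)) (ℚᵘ.*-congˡ {toℚᵘ ε} (toℚᵘ-fromℤ (+ n)))))
        (*≤* scaled))))
    where
    difference : fromℕ (2 * n) ℚ.- fromℕ (f₄ n) ≡ fromℕ d
    difference = trans (≡.sym (fromℤ-minus (+ (2 * n)) (+ f₄ n)))
      (cong fromℤ (trans (cong (λ z → + z ℤ.- + f₄ n) (≡.sym f+d≡2n))
        (trans (cong (ℤ._- + f₄ n) (ℤ.pos-+ (f₄ n) d)) (cancel (+ f₄ n) (+ d)))))
      where
      open ℤ.+-*-Solver
      cancel : ∀ f d → (f ℤ.+ d) ℤ.- f ≡ d
      cancel = solve 2 (λ f d → (f :+ d) :- f := d) refl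
    scaled : + d ℤ.* + suc (k-1 * 1) ℤ.≤ (+ suc p ℤ.* + n) ℤ.* + 1
    scaled = subst₂ ℤ._≤_ (ℤ.pos-* d (suc (k-1 * 1)))
      (≡.sym (trans (ℤ.*-identityʳ _) (≡.sym (ℤ.pos-* (suc p) n))))
      (ℤ.+≤+ (begin
        d * suc (k-1 * 1)   ≡⟨ trans (cong (λ z → d * suc z) (*-identityʳ k-1)) (*-comm d k) ⟩
        k * d               ≤⟨ kd≤n ⟩
        n                   ≤⟨ m≤m+n n (p * n) ⟩
        suc p * n           ∎))
      where open ≤-Reasoning

littleO : (λ n → fromℕ (2 * n) ℚ.- fromℕ (f₄ n)) isLittleO fromℕ
littleO = littleO-from 1000 f₄-above

theorem1 : Σ[ f₄ ∈ (ℕ → ℕ) ] Σ[ μ₃ ∈ (ℕ → ℤ) ]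
    (∀ n → 6 ≤ n → Is-f n 4 (f₄ n))
    × (∀ n → 6 ≤ n → Is-μ n (𝓔 3) (μ₃ n))
    × (∀ n → 6 ≤ n → (bound n <ᶻ + f₄ n) × (f₄ n ≤ 2 * n ∸ 4))
    × ((λ n → fromℕ (2 * n) - fromℕ (f₄ n)) isLittleO fromℕ)
    × (∀ n → 6 ≤ n → ⌊ bound n ⌋≤ μ₃ n)
    × (∀ n → 6 ≤ n → (bound n <ᶻ + f₄ n) ⇔ (⌊ bound n ⌋≤ μ₃ n))
theorem1 = f₄ , μ₃ , f₄-minimum , μ₃-maximum ,
  (λ n 6≤n → bound<f₄ n 6≤n , f₄≤ n 6≤n) , littleO , floor≤μ₃ ,
  λ n 6≤n → mk⇔ (λ _ → floor≤μ₃ n 6≤n) (λ _ → bound<f₄ n 6≤n)
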